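{- For any partitions $\lambda,\mu$ we have, in the ring $\widehat\Lambda(x\|a)$, $$\widehat s_\lambda(x\|a)\,\widehat s_\mu(x\|a)=\sum_\nu\widehat c_{\lambda\mu}^{\,\nu}(a)\,\widehat s_\nu(x\|a),$$ where $\widehat s_\lambda(x\|a)$ are the dual Schur functions and $\widehat c_{\lambda\mu}^{\,\nu}(a)$ are the dual Littlewood--Richardson polynomials.
   Context: Let $a=(a_i)_{i\in\mathbb Z}$ be a sequence of commuting indeterminates and $\mathbb Q[a]$ the polynomial ring in the $a_i$. The ring $\Lambda(x\|a)$: its elements are sequences $P=(P_0,P_1,P_2,\dots)$, where $P_n$ is a symmetric polynomial in $x_1,\dots,x_n$ with coefficients in $\mathbb Q[a]$, the total degrees of the $P_n$ in the $x_i$ are bounded, and $P_n(x_1,\dots,x_{n-1},a_n)=P_{n-1}(x_1,\dots,x_{n-1})$ for all $n\geqslant 1$; multiplication is componentwise. It is freely generated over $\mathbb Q[a]$ by the double power sums $p_k(x\|a)=\sum_{i\geqslant 1}(x_i^k-a_i^k)$, $k\geqslant 1$ (the sequence $\sum_{i=1}^n(x_i^k-a_i^k)$, $n\geqslant 0$). Double Schur functions: for a partition $\lambda$ with length $\ell(\lambda)\leqslant n$, $$s_\lambda(x_1,\dots,x_n\|a)=\frac{\det\big[(x_i\|a)^{\lambda_j+n-j}\big]_{i,j=1}^n}{\prod_{1\leqslant i<j\leqslant n}(x_i-x_j)},\qquad (x_i\|a)^r=(x_i-a_n)(x_i-a_{n-1})\cdots(x_i-a_{n-r+1}),\ (x_i\|a)^0=1,$$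 and $s_\lambda(x_1,\dots,x_n\|a)=0$ if $\ell(\lambda)>n$. This sequence is $s_\lambda(x\|a)\in\Lambda(x\|a)$; the $s_\lambda(x\|a)$ form a $\mathbb Q[a]$-basis of $\Lambda(x\|a)$. Dual Littlewood--Richardson polynomials: let $\Delta:\Lambda(x\|a)\to\Lambda(x\|a)\otimes_{\mathbb Q[a]}\Lambda(x\|a)$ be the $\mathbb Q[a]$-linear ring homomorphism with $\Delta(p_k(x\|a))=p_k(x\|a)\otimes 1+1\otimes p_k(x\|a)$ for all $k\geqslant 1$. The polynomials $\widehat c_{\lambda\mu}^{\,\nu}(a)\in\mathbb Q[a]$ are defined by $\Delta(s_\nu(x\|a))=\sum_{\lambda,\mu}\widehat c_{\lambda\mu}^{\,\nu}(a)\,s_\lambda(x\|a)\otimes s_\mu(x\|a)$. Dual Schur functions: let $\widehat\Lambda(x\|a)$ be the ring of formal (possibly infinite) sums $\sum_{\lambda}c_\lambda(a)s_\lambda(x)$, $c_\lambda(a)\in\mathbb Q[a]$, with $s_\lambda(x)$ the ordinary Schur functions. Let $d$ be the number of boxes on the main diagonal of $\lambda$. For $n\geqslant\ell(\lambda)$, $$\widehat s_\lambda(x_1,\dots,x_n\|a)=\frac{\det[A_{ij}]_{i,j=1}^n}{\prod_{1\leqslant i<j\leqslant n}(x_i-x_j)},$$ where $A_{ij}=\dfrac{x_i^{\lambda_j+n-j}}{(1-a_0x_i)(1-a_{ -1}x_i)\cdots(1-a_{j-\lambda_j}x_i)}$ for $1\leqslant j\leqslant d$ and $A_{ij}=x_i^{\lambda_j+n-j}(1-a_1x_i)\cdots(1-a_{j-\lambda_j-1}x_i)$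 for $d<j\leqslant n$; it is $0$ if $\ell(\lambda)>n$. These are compatible with setting $x_n=0$ and define $\widehat s_\lambda(x\|a)\in\widehat\Lambda(x\|a)$. -}

module Defs where

open import Algebra.Bundles using (CommutativeMonoid; CommutativeRing)
open import Algebra.Morphism.Structures using (module RingMorphisms)
open import Data.Bool.Base using (if_then_else_)
open import Data.Fin.Base using (Fin; zero; suc; toℕ; punchIn)
open import Data.Fin.Permutation using (Permutation′; _⟨$⟩ʳ_)
import Data.Fin.Properties as Fin
open import Data.Integer.Base as ℤ using (ℤ)
open import Data.List.Base as List using (List; []; _∷_; _++_; foldr; length; filter; upTo)
import Data.List.Properties as List
open import Data.List.Membership.Propositional using (_∉_)
open import Data.List.Relation.Unary.All using (All)
open import Data.List.Relation.Unary.Linked using (Linked)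
open import Data.List.Relation.Unary.Unique.Propositional using (Unique)
open import Data.Nat.Base as ℕ using (ℕ; zero; suc; _∸_; _⊔_; _≤_; _<_; _≥_; z≤n)
import Data.Nat.Properties as ℕ
open import Data.Product.Base using (Σ; ∃; _×_; _,_; proj₁; proj₂)
import Data.Rational.Properties as ℚ
open import Data.Vec.Base using (Vec; []; _∷_)
open import Function.Base using (_∘_)
open import Level using (0ℓ)
open import Relation.Binary.PropositionalEquality.Core as ≡ using (_≡_)
open import Relation.Binary.Bundles using (Setoid)
open import Relation.Binary.Structures using (IsEquivalence)
open import Relation.Nullary.Decidable.Core using (does)

Ring : Set₁
Ring = CommutativeRing 0ℓ 0ℓ

∣_∣ : Ring → Set
∣_∣ = CommutativeRing.Carrier

module _ {A : Set} (_≈_ : A → A → Set) where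

  open import Algebra.Definitions _≈_

  makeRing : (_+_ _*_ : A → A → A) (-_ : A → A) (0# 1# : A) → IsEquivalence _≈_ →
             Congruent₂ _+_ → Associative _+_ → Commutative _+_ → LeftIdentity 0# _+_ →
             Congruent₁ -_ → LeftInverse 0# -_ _+_ →
             Congruent₂ _*_ → Associative _*_ → Commutative _*_ → LeftIdentity 1# _*_ →
             _*_ DistributesOverˡ _+_ → Ring
  makeRing _+_ _*_ -_ 0# 1# isEquivalence +-cong +-assoc +-comm +-identityˡ -‿cong -‿inverseˡ
           *-cong *-assoc *-comm *-identityˡ distribˡ = record
    { _≈_ = _≈_ ; _+_ = _+_ ; _*_ = _*_ ; -_ = -_ ; 0# = 0# ; 1# = 1#
    ; isCommutativeRing = record
      { isRing = record
        { +-isAbelianGroup = record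
          { isGroup = record
            { isMonoid = record
              { isSemigroup = record
                { isMagma = record { isEquivalence = isEquivalence ; ∙-cong = +-cong }
                ; assoc = +-assoc
                }
              ; identity = comm∧idˡ⇒id +-comm +-identityˡ
              }
            ; inverse = comm∧invˡ⇒inv +-comm -‿inverseˡ
            ; ⁻¹-cong = -‿cong
            }
          ; comm = +-comm
          }
        ; *-cong = *-cong
        ; *-assoc = *-assoc
        ; *-identity = comm∧idˡ⇒id *-comm *-identityˡ
        ; distrib = comm∧distrˡ⇒distr +-cong *-comm distribˡ
        }
      ; *-comm = *-comm
      }
    }
    where
    setoid : Setoid 0ℓ 0ℓ
    setoid = record { isEquivalence = isEquivalence }
    open import Algebra.Consequences.Setoid setoid

module RingOps (R : Ring) where
  open CommutativeRing R hiding (zero)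
  open import Algebra.Properties.CommutativeMonoid.Sum +-commutativeMonoid public using (sum)
  open import Algebra.Properties.CommutativeMonoid.Sum *-commutativeMonoid public
    renaming (sum to product) using ()
  open import Algebra.Properties.Semiring.Exp semiring public using (_^_)

  det : ∀ {n} → (Fin n → Fin n → Carrier) → Carrier
  det {zero}  M = 1#
  det {suc n} M =
    sum λ j → (- 1#) ^ toℕ j * (M zero j * det λ i k → M (suc i) (punchIn j k))

  vandermonde : ∀ {n} → (Fin n → Carrier) → Carrier
  vandermonde x = product λ i → product λ j →
    if does (i Fin.<? j) then x i - x j else 1#

  -- f = det M / ∏_{i<j} (xᵢ - xⱼ).  It is only used where the xᵢ are
  -- indeterminates, so that the denominator is not a zero divisor and f is
  -- determined by x and M.
  IsBialternant : ∀ {n} → (Fin n → Carrier) → (Fin n → Fin n → Carrier) → Carrier → Set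
  IsBialternant x M f = f * vandermonde x ≈ det M

-- m = ∑_{i ∈ I} f i, where all but finitely many of the f i vanish.
module _ (M : CommutativeMonoid 0ℓ 0ℓ) where
  open CommutativeMonoid M

  record HasSum {I : Set} (f : I → Carrier) (m : Carrier) : Set where
    field
      support  : List I
      unique   : Unique support
      vanishes : ∀ {i} → i ∉ support → f i ≈ ε
      total    : foldr _∙_ ε (List.map f support) ≈ m

-- Polynomials: R[V] is presented as the free commutative R-algebra on V,
-- that is, arithmetical expressions modulo the laws of commutative R-algebras.
module Polynomial (R : Ring) where
  private module R = CommutativeRing R

  infixl 6 _+_
  infixl 7 _*_
  infix  8 -_

  data Poly (V : Set) : Set where
    con     : R.Carrier → Poly V
    var     : V → Poly V
    _+_ _*_ : Poly V → Poly V → Poly V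
    -_      : Poly V → Poly V

  infix 4 _≈_

  data _≈_ {V : Set} : Poly V → Poly V → Set where
    refl       : ∀ {p} → p ≈ p
    sym        : ∀ {p q} → p ≈ q → q ≈ p
    trans      : ∀ {p q r} → p ≈ q → q ≈ r → p ≈ r
    +-cong     : ∀ {p p′ q q′} → p ≈ p′ → q ≈ q′ → p + q ≈ p′ + q′
    *-cong     : ∀ {p p′ q q′} → p ≈ p′ → q ≈ q′ → p * q ≈ p′ * q′
    -‿cong     : ∀ {p p′} → p ≈ p′ → - p ≈ - p′
    +-assoc    : ∀ p q r → (p + q) + r ≈ p + (q + r)
    +-comm     : ∀ p q → p + q ≈ q + p
    +-identity : ∀ p → con R.0# + p ≈ p
    -‿inverse  : ∀ p → - p + p ≈ con R.0#
    *-assoc    : ∀ p q r → (p * q) * r ≈ p * (q * r)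
    *-comm     : ∀ p q → p * q ≈ q * p
    *-identity : ∀ p → con R.1# * p ≈ p
    distrib    : ∀ p q r → p * (q + r) ≈ p * q + p * r
    con-cong   : ∀ {a b} → a R.≈ b → con a ≈ con b
    con-+      : ∀ a b → con (a R.+ b) ≈ con a + con b
    con-*      : ∀ a b → con (a R.* b) ≈ con a * con b

  polynomialRing : Set → Ring
  polynomialRing V = makeRing (_≈_ {V}) _+_ _*_ -_ (con R.0#) (con R.1#)
    (record { refl = refl ; sym = sym ; trans = trans })
    +-cong +-assoc +-comm +-identity -‿cong -‿inverse
    *-cong *-assoc *-comm *-identity distrib

  substitute : ∀ {V W} → (V → Poly W) → Poly V → Poly W
  substitute σ (con a) = con a
  substitute σ (var v) = σ v
  substitute σ (p + q) = substitute σ p + substitute σ q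
  substitute σ (p * q) = substitute σ p * substitute σ q
  substitute σ (- p)   = - substitute σ p

  substitute-cong : ∀ {V W} (σ : V → Poly W) {p q} → p ≈ q → substitute σ p ≈ substitute σ q
  substitute-cong σ refl             = refl
  substitute-cong σ (sym e)          = sym (substitute-cong σ e)
  substitute-cong σ (trans e e′)     = trans (substitute-cong σ e) (substitute-cong σ e′)
  substitute-cong σ (+-cong e e′)    = +-cong (substitute-cong σ e) (substitute-cong σ e′)
  substitute-cong σ (*-cong e e′)    = *-cong (substitute-cong σ e) (substitute-cong σ e′)
  substitute-cong σ (-‿cong e)       = -‿cong (substitute-cong σ e)
  substitute-cong σ (+-assoc _ _ _)  = +-assoc _ _ _
  substitute-cong σ (+-comm _ _)     = +-comm _ _
  substitute-cong σ (+-identity _)   = +-identity _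
  substitute-cong σ (-‿inverse _)    = -‿inverse _
  substitute-cong σ (*-assoc _ _ _)  = *-assoc _ _ _
  substitute-cong σ (*-comm _ _)     = *-comm _ _
  substitute-cong σ (*-identity _)   = *-identity _
  substitute-cong σ (distrib _ _ _)  = distrib _ _ _
  substitute-cong σ (con-cong e)     = con-cong e
  substitute-cong σ (con-+ _ _)      = con-+ _ _
  substitute-cong σ (con-* _ _)      = con-* _ _

  expressionDegree : ∀ {V} → Poly V → ℕ
  expressionDegree (con _) = 0
  expressionDegree (var _) = 1
  expressionDegree (p + q) = expressionDegree p ⊔ expressionDegree q
  expressionDegree (p * q) = expressionDegree p ℕ.+ expressionDegree q
  expressionDegree (- p)   = expressionDegree p

  -- The total degree is at most d.  An expression may have larger degree
  -- than the polynomial it denotes (cancellation), but each polynomial is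
  -- denoted by some expression of its own degree.
  DegreeAtMost : ∀ {V} → ℕ → Poly V → Set
  DegreeAtMost d p = ∃ λ q → (q ≈ p) × (expressionDegree q ≤ d)

module PowerSeries (R : Ring) where
  open CommutativeRing R hiding (zero)
  open RingOps R using (sum; _^_)
  open import Algebra.Properties.CommutativeMonoid.Sum +-commutativeMonoid using (sum-cong-≋)
  open import Algebra.Properties.Ring ring using (-0#≈0#)
  open import Relation.Binary.Reasoning.Setoid setoid

  Series₁ : Set
  Series₁ = ℕ → Carrier

  infix 4 _≋_
  _≋_ : Series₁ → Series₁ → Set
  f ≋ g = ∀ k → f k ≈ g k

  infixl 6 _⊕_
  _⊕_ : Series₁ → Series₁ → Series₁
  (f ⊕ g) k = f k + g k

  infixl 7 _⊛_
  _⊛_ : Series₁ → Series₁ → Series₁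
  (f ⊛ g) k = sum {suc k} λ i → f (toℕ i) * g (k ∸ toℕ i)

  constant : Carrier → Series₁
  constant c zero    = c
  constant c (suc k) = 0#

  indeterminate : Series₁
  indeterminate 1 = 1#
  indeterminate _ = 0#

  tail : Series₁ → Series₁
  tail f k = f (suc k)

  infixl 7 _·_
  _·_ : Carrier → Series₁ → Series₁
  (c · f) k = c * f k

  ⊛-cong : ∀ {f f′ g g′} → f ≋ f′ → g ≋ g′ → f ⊛ g ≋ f′ ⊛ g′
  ⊛-cong p q k = sum-cong-≋ {suc k} λ i → *-cong (p (toℕ i)) (q (k ∸ toℕ i))

  ⊛-zero : ∀ f g → (f ⊛ g) 0 ≈ f 0 * g 0
  ⊛-zero f g = +-identityʳ _

  swap : ∀ a b c → a + (b + c) ≈ b + (a + c)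
  swap a b c = begin
    a + (b + c)  ≈⟨ +-assoc a b c ⟨
    (a + b) + c  ≈⟨ +-congʳ (+-comm a b) ⟩
    (b + a) + c  ≈⟨ +-assoc b a c ⟩
    b + (a + c)  ∎

  interchange : ∀ a b c d → (a + b) + (c + d) ≈ (a + c) + (b + d)
  interchange a b c d = begin
    (a + b) + (c + d)  ≈⟨ +-assoc a b (c + d) ⟩
    a + (b + (c + d))  ≈⟨ +-congˡ (swap b c d) ⟩
    a + (c + (b + d))  ≈⟨ +-assoc a c (b + d) ⟨
    (a + c) + (b + d)  ∎

  ⊛-last : ∀ f g k → (f ⊛ g) (suc k) ≈ f (suc k) * g 0 + (f ⊛ tail g) k
  ⊛-last f g zero = begin
    f 0 * g 1 + (f 1 * g 0 + 0#)  ≈⟨ swap _ _ _ ⟩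
    f 1 * g 0 + (f 0 * g 1 + 0#)  ∎
  ⊛-last f g (suc k) = begin
    f 0 * g (suc (suc k)) + (tail f ⊛ g) (suc k)
      ≈⟨ +-congˡ (⊛-last (tail f) g k) ⟩
    f 0 * g (suc (suc k)) + (f (suc (suc k)) * g 0 + (tail f ⊛ tail g) k)
      ≈⟨ swap _ _ _ ⟩
    f (suc (suc k)) * g 0 + (f 0 * g (suc (suc k)) + (tail f ⊛ tail g) k)
      ∎

  ⊛-comm : ∀ f g → f ⊛ g ≋ g ⊛ f
  ⊛-comm f g zero = +-congʳ (*-comm _ _)
  ⊛-comm f g (suc k) = begin
    f 0 * g (suc k) + (tail f ⊛ g) k  ≈⟨ +-cong (*-comm _ _) (⊛-comm (tail f) g k) ⟩
    g (suc k) * f 0 + (g ⊛ tail f) k  ≈⟨ ⊛-last g f k ⟨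
    (g ⊛ f) (suc k)                   ∎

  ⊛-distribˡ : ∀ f g h → f ⊛ (g ⊕ h) ≋ f ⊛ g ⊕ f ⊛ h
  ⊛-distribˡ f g h zero = begin
    f 0 * (g 0 + h 0) + 0#                   ≈⟨ +-identityʳ _ ⟩
    f 0 * (g 0 + h 0)                        ≈⟨ distribˡ _ _ _ ⟩
    f 0 * g 0 + f 0 * h 0                    ≈⟨ +-cong (⊛-zero f g) (⊛-zero f h) ⟨
    (f 0 * g 0 + 0#) + (f 0 * h 0 + 0#)      ∎
  ⊛-distribˡ f g h (suc k) = begin
    f 0 * (g (suc k) + h (suc k)) + (tail f ⊛ (g ⊕ h)) k
      ≈⟨ +-cong (distribˡ _ _ _) (⊛-distribˡ (tail f) g h k) ⟩
    (f 0 * g (suc k) + f 0 * h (suc k)) + ((tail f ⊛ g) k + (tail f ⊛ h) k)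
      ≈⟨ interchange _ _ _ _ ⟩
    (f 0 * g (suc k) + (tail f ⊛ g) k) + (f 0 * h (suc k) + (tail f ⊛ h) k)
      ∎

  ⊛-distribʳ : ∀ f g h → (g ⊕ h) ⊛ f ≋ g ⊛ f ⊕ h ⊛ f
  ⊛-distribʳ f g h k = begin
    ((g ⊕ h) ⊛ f) k        ≈⟨ ⊛-comm (g ⊕ h) f k ⟩
    (f ⊛ (g ⊕ h)) k        ≈⟨ ⊛-distribˡ f g h k ⟩
    (f ⊛ g) k + (f ⊛ h) k  ≈⟨ +-cong (⊛-comm f g k) (⊛-comm f h k) ⟩
    (g ⊛ f) k + (h ⊛ f) k  ∎

  ·-⊛ : ∀ c f g → (c · f) ⊛ g ≋ c · (f ⊛ g)
  ·-⊛ c f g zero = begin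
    c * f 0 * g 0 + 0#    ≈⟨ +-identityʳ _ ⟩
    c * f 0 * g 0         ≈⟨ *-assoc _ _ _ ⟩
    c * (f 0 * g 0)       ≈⟨ *-congˡ (⊛-zero f g) ⟨
    c * (f 0 * g 0 + 0#)  ∎
  ·-⊛ c f g (suc k) = begin
    c * f 0 * g (suc k) + ((c · tail f) ⊛ g) k    ≈⟨ +-cong (*-assoc _ _ _) (·-⊛ c (tail f) g k) ⟩
    c * (f 0 * g (suc k)) + c * (tail f ⊛ g) k    ≈⟨ distribˡ _ _ _ ⟨
    c * (f 0 * g (suc k) + (tail f ⊛ g) k)        ∎

  ⊛-assoc : ∀ f g h → (f ⊛ g) ⊛ h ≋ f ⊛ (g ⊛ h)
  ⊛-assoc f g h zero = begin
    (f 0 * g 0 + 0#) * h 0 + 0#    ≈⟨ +-congʳ (*-congʳ (+-identityʳ _)) ⟩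
    f 0 * g 0 * h 0 + 0#           ≈⟨ +-congʳ (*-assoc _ _ _) ⟩
    f 0 * (g 0 * h 0) + 0#         ≈⟨ +-congʳ (*-congˡ (+-identityʳ _)) ⟨
    f 0 * (g 0 * h 0 + 0#) + 0#    ∎
  ⊛-assoc f g h (suc k) = begin
    (f 0 * g 0 + 0#) * h (suc k) + ((f 0 · tail g ⊕ tail f ⊛ g) ⊛ h) k
      ≈⟨ +-cong (trans (*-congʳ (+-identityʳ _)) (*-assoc _ _ _))
                (⊛-distribʳ h (f 0 · tail g) (tail f ⊛ g) k) ⟩
    f 0 * (g 0 * h (suc k)) + (((f 0 · tail g) ⊛ h) k + ((tail f ⊛ g) ⊛ h) k)
      ≈⟨ +-congˡ (+-cong (·-⊛ (f 0) (tail g) h k) (⊛-assoc (tail f) g h k)) ⟩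
    f 0 * (g 0 * h (suc k)) + (f 0 * (tail g ⊛ h) k + (tail f ⊛ (g ⊛ h)) k)
      ≈⟨ +-assoc _ _ _ ⟨
    (f 0 * (g 0 * h (suc k)) + f 0 * (tail g ⊛ h) k) + (tail f ⊛ (g ⊛ h)) k
      ≈⟨ +-congʳ (distribˡ _ _ _) ⟨
    f 0 * (g 0 * h (suc k) + (tail g ⊛ h) k) + (tail f ⊛ (g ⊛ h)) k
      ∎

  0⊛ : ∀ f → (λ _ → 0#) ⊛ f ≋ λ _ → 0#
  0⊛ f zero    = trans (+-identityʳ _) (zeroˡ _)
  0⊛ f (suc k) = trans (+-cong (zeroˡ _) (0⊛ f k)) (+-identityˡ _)

  constant-⊛ : ∀ c f → constant c ⊛ f ≋ c · f
  constant-⊛ c f zero    = +-identityʳ _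
  constant-⊛ c f (suc k) = trans (+-congˡ (0⊛ f k)) (+-identityʳ _)

  powerSeriesRing : Ring
  powerSeriesRing = makeRing _≋_ _⊕_ _⊛_ (λ f k → - f k) (λ _ → 0#) (constant 1#)
    (record { refl = λ _ → refl ; sym = λ e k → sym (e k) ; trans = λ e e′ k → trans (e k) (e′ k) })
    (λ e e′ k → +-cong (e k) (e′ k)) (λ f g h k → +-assoc _ _ _) (λ f g k → +-comm _ _)
    (λ f k → +-identityˡ _) (λ e k → -‿cong (e k)) (λ f k → -‿inverseˡ _)
    ⊛-cong ⊛-assoc ⊛-comm (λ f k → trans (constant-⊛ 1# f k) (*-identityˡ _)) ⊛-distribˡ

  constant-cong : ∀ {c d} → c ≈ d → constant c ≋ constant d
  constant-cong e zero    = e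
  constant-cong e (suc k) = refl

  constant-* : ∀ c d → constant (c * d) ≋ constant c ⊛ constant d
  constant-* c d zero    = sym (constant-⊛ c (constant d) 0)
  constant-* c d (suc k) = sym (trans (constant-⊛ c (constant d) (suc k)) (zeroʳ c))

  constant-‿- : ∀ c d → constant (c - d) ≋ constant c ⊕ (λ k → - constant d k)
  constant-‿- c d zero    = refl
  constant-‿- c d (suc k) = sym (-‿inverseʳ 0#)

  indeterminate-⊛ : ∀ f k → (indeterminate ⊛ f) (suc k) ≈ f k
  indeterminate-⊛ f k = begin
    0# * f (suc k) + (tail indeterminate ⊛ f) k  ≈⟨ +-congʳ (zeroˡ _) ⟩
    0# + (tail indeterminate ⊛ f) k              ≈⟨ +-identityˡ _ ⟩
    (tail indeterminate ⊛ f) k                   ≈⟨ ⊛-cong {g = f} tail≋1 (λ _ → refl) k ⟩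
    (constant 1# ⊛ f) k                          ≈⟨ constant-⊛ 1# f k ⟩
    1# * f k                                     ≈⟨ *-identityˡ _ ⟩
    f k                                          ∎
    where
    tail≋1 : tail indeterminate ≋ constant 1#
    tail≋1 zero    = refl
    tail≋1 (suc k) = refl

  geometricSeries : Carrier → Series₁
  geometricSeries c k = c ^ k

  geometricSeries-inverse : ∀ c → let open CommutativeRing powerSeriesRing using () renaming (_*_ to _⊗_; _-_ to _⊖_) in
    (constant 1# ⊖ constant c ⊗ indeterminate) ⊗ geometricSeries c ≋ constant 1#
  geometricSeries-inverse c k = begin
    ((constant 1# ⊕ neg ct) ⊛ g) k           ≈⟨ ⊛-distribʳ g (constant 1#) (neg ct) k ⟩
    (constant 1# ⊛ g) k + (neg ct ⊛ g) k     ≈⟨ +-cong (trans (constant-⊛ 1# g k) (*-identityˡ _))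
                                                       (sym (-‿distribˡ-* ct g k)) ⟩
    g k - (ct ⊛ g) k                         ≈⟨ +-congˡ (-‿cong (trans (⊛-assoc (constant c) indeterminate g k)
                                                       (constant-⊛ c (indeterminate ⊛ g) k))) ⟩
    g k - c * (indeterminate ⊛ g) k          ≈⟨ last k ⟩
    constant 1# k                            ∎
    where
    open import Algebra.Properties.Ring (CommutativeRing.ring powerSeriesRing) using (-‿distribˡ-*)
    g : Series₁
    g = geometricSeries c
    ct : Series₁
    ct = constant c ⊛ indeterminate
    neg : Series₁ → Series₁
    neg f k = - f k
    last : ∀ k → g k - c * (indeterminate ⊛ g) k ≈ constant 1# k
    last zero = begin
      1# - c * (0# * 1# + 0#)  ≈⟨ +-congˡ (-‿cong (*-congˡ (trans (+-identityʳ _) (zeroˡ _)))) ⟩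
      1# - c * 0#              ≈⟨ +-congˡ (-‿cong (zeroʳ c)) ⟩
      1# - 0#                  ≈⟨ +-congˡ -0#≈0# ⟩
      1# + 0#                  ≈⟨ +-identityʳ _ ⟩
      1#                       ∎
    last (suc k) = trans (+-congˡ (-‿cong (*-congˡ (indeterminate-⊛ g k)))) (-‿inverseʳ _)

-- R[[x₁,…,xₙ]] = R[[x₂,…,xₙ]][[x₁]]
module MultivariateSeries (R : Ring) where
  seriesRing : ℕ → Ring
  seriesRing zero    = R
  seriesRing (suc n) = PowerSeries.powerSeriesRing (seriesRing n)

  coefficient : ∀ n → Vec ℕ n → ∣ seriesRing n ∣ → ∣ R ∣
  coefficient zero    []      f = f
  coefficient (suc n) (k ∷ α) f = coefficient n α (f k)

  scalar : ∀ n → ∣ R ∣ → ∣ seriesRing n ∣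
  scalar zero    c = c
  scalar (suc n) c = PowerSeries.constant (seriesRing n) (scalar n c)

  x : ∀ n → Fin n → ∣ seriesRing n ∣
  x (suc n) zero    = PowerSeries.indeterminate (seriesRing n)
  x (suc n) (suc i) = PowerSeries.constant (seriesRing n) (x n i)

  -- 1 / (1 - c xᵢ) = ∑ₖ cᵏ xᵢᵏ
  geometric : ∀ n → ∣ R ∣ → Fin n → ∣ seriesRing n ∣
  geometric (suc n) c zero    = PowerSeries.geometricSeries (seriesRing n) (scalar n c)
  geometric (suc n) c (suc i) = PowerSeries.constant (seriesRing n) (geometric n c i)

  geometric-inverse : ∀ n c i → let open CommutativeRing (seriesRing n) in
    (1# - scalar n c * x n i) * geometric n c i ≈ 1#
  geometric-inverse (suc n) c zero    = geometricSeries-inverse (scalar n c)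
    where open PowerSeries (seriesRing n)
  geometric-inverse (suc n) c (suc i) = begin
    (1# - scalar (suc n) c * x (suc n) (suc i)) * geometric (suc n) c (suc i)
      ≈⟨ *-congʳ {x = geometric (suc n) c (suc i)} (+-congˡ {1#} (-‿cong (constant-* (scalar n c) (x n i)))) ⟨
    (1# - constant (scalar n c S.* x n i)) * geometric (suc n) c (suc i)
      ≈⟨ *-congʳ {x = geometric (suc n) c (suc i)} (constant-‿- S.1# (scalar n c S.* x n i)) ⟨
    constant (S.1# S.- scalar n c S.* x n i) * constant (geometric n c i)
      ≈⟨ constant-* (S.1# S.- scalar n c S.* x n i) (geometric n c i) ⟨
    constant ((S.1# S.- scalar n c S.* x n i) S.* geometric n c i)
      ≈⟨ constant-cong (geometric-inverse n c i) ⟩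
    1#
      ∎
    where
    module S = CommutativeRing (seriesRing n)
    open PowerSeries (seriesRing n)
    open CommutativeRing powerSeriesRing
    open import Relation.Binary.Reasoning.Setoid setoid

  -- f = ∑_{i ∈ I} F i as formal power series: each coefficient of f is the
  -- sum of the corresponding coefficients of the F i, of which all but
  -- finitely many vanish.
  IsFormalSum : ∀ n {I : Set} → (I → ∣ seriesRing n ∣) → ∣ seriesRing n ∣ → Set
  IsFormalSum n F f = ∀ α →
    HasSum (CommutativeRing.+-commutativeMonoid R) (λ i → coefficient n α (F i)) (coefficient n α f)

-- The tensor product A ⊗_R B of the commutative R-algebras given by ring
-- homomorphisms R → A and R → B (only the underlying maps are needed here).
module TensorProduct (R A B : Ring) (ι : ∣ R ∣ → ∣ A ∣) (κ : ∣ R ∣ → ∣ B ∣) where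
  private
    module A = CommutativeRing A
    module B = CommutativeRing B

  -- The list (a₁ , b₁) ∷ (a₂ , b₂) ∷ … stands for ∑ aᵢ ⊗ bᵢ.
  Tensor : Set
  Tensor = List (A.Carrier × B.Carrier)

  infix 8 _⊗_
  _⊗_ : A.Carrier → B.Carrier → Tensor
  a ⊗ b = (a , b) ∷ []

  infix 4 _≈_

  data _≈_ : Tensor → Tensor → Set where
    refl     : ∀ {t} → t ≈ t
    sym      : ∀ {t u} → t ≈ u → u ≈ t
    trans    : ∀ {t u v} → t ≈ u → u ≈ v → t ≈ v
    ++-cong  : ∀ {t t′ u u′} → t ≈ t′ → u ≈ u′ → t ++ u ≈ t′ ++ u′
    ++-comm  : ∀ t u → t ++ u ≈ u ++ t
    ⊗-cong   : ∀ {a a′ b b′} → a A.≈ a′ → b B.≈ b′ → a ⊗ b ≈ a′ ⊗ b′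
    ⊗-zero   : ∀ b → A.0# ⊗ b ≈ []
    ⊗-distʳ  : ∀ a a′ b → (a A.+ a′) ⊗ b ≈ a ⊗ b ++ a′ ⊗ b
    ⊗-distˡ  : ∀ a b b′ → a ⊗ (b B.+ b′) ≈ a ⊗ b ++ a ⊗ b′
    balanced : ∀ r a b → (ι r A.* a) ⊗ b ≈ a ⊗ (κ r B.* b)

  neg : Tensor → Tensor
  neg = List.map λ (a , b) → A.- a , b

  scale : A.Carrier × B.Carrier → Tensor → Tensor
  scale (a , b) = List.map λ (c , d) → a A.* c , b B.* d

  infixl 7 _*_
  _*_ : Tensor → Tensor → Tensor
  t * u = List.concatMap (λ p → scale p u) t

  ≡⇒≈ : ∀ {t u} → t ≡ u → t ≈ u
  ≡⇒≈ ≡.refl = refl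

  neg-cong : ∀ {t u} → t ≈ u → neg t ≈ neg u
  neg-cong refl             = refl
  neg-cong (sym e)          = sym (neg-cong e)
  neg-cong (trans e e′)     = trans (neg-cong e) (neg-cong e′)
  neg-cong (++-cong {t} {t′} {u} {u′} e e′)
    rewrite List.map-++ (λ (a , b) → A.- a , b) t u
          | List.map-++ (λ (a , b) → A.- a , b) t′ u′ = ++-cong (neg-cong e) (neg-cong e′)
  neg-cong (++-comm t u)
    rewrite List.map-++ (λ (a , b) → A.- a , b) t u
          | List.map-++ (λ (a , b) → A.- a , b) u t = ++-comm (neg t) (neg u)
  neg-cong (⊗-cong e e′)    = ⊗-cong (A.-‿cong e) e′
  neg-cong (⊗-zero b)       = trans (⊗-cong -0#≈0# B.refl) (⊗-zero b)
    where open import Algebra.Properties.Ring A.ring using (-0#≈0#)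
  neg-cong (⊗-distʳ a a′ b) = trans (⊗-cong (A.sym (-‿+-comm a a′)) B.refl) (⊗-distʳ _ _ b)
    where open import Algebra.Properties.Ring A.ring using (-‿+-comm)
  neg-cong (⊗-distˡ a b b′) = ⊗-distˡ _ b b′
  neg-cong (balanced r a b) = trans (⊗-cong (-‿distribʳ-* (ι r) a) B.refl) (balanced r _ b)
    where open import Algebra.Properties.Ring A.ring using (-‿distribʳ-*)

  neg-inverse : ∀ t → neg t ++ t ≈ []
  neg-inverse []            = refl
  neg-inverse ((a , b) ∷ t) =
    trans (++-cong {(A.- a) ⊗ b} refl (trans (++-comm (neg t) (a ⊗ b ++ t))
                                      (++-cong {a ⊗ b} refl (++-comm t (neg t)))))
    (++-cong {(A.- a) ⊗ b ++ a ⊗ b} {[]} {neg t ++ t} {[]}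
      (trans (sym (⊗-distʳ _ _ b)) (trans (⊗-cong (A.-‿inverseˡ a) B.refl) (⊗-zero b)))
      (neg-inverse t))

  scale-cong : ∀ p {t u} → t ≈ u → scale p t ≈ scale p u
  scale-cong p refl         = refl
  scale-cong p (sym e)      = sym (scale-cong p e)
  scale-cong p (trans e e′) = trans (scale-cong p e) (scale-cong p e′)
  scale-cong (a , b) (++-cong {t} {t′} {u} {u′} e e′)
    rewrite List.map-++ (λ (c , d) → a A.* c , b B.* d) t u
          | List.map-++ (λ (c , d) → a A.* c , b B.* d) t′ u′ =
    ++-cong (scale-cong (a , b) e) (scale-cong (a , b) e′)
  scale-cong (a , b) (++-comm t u)
    rewrite List.map-++ (λ (c , d) → a A.* c , b B.* d) t u
          | List.map-++ (λ (c , d) → a A.* c , b B.* d) u t =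
    ++-comm (scale (a , b) t) (scale (a , b) u)
  scale-cong p       (⊗-cong e e′)    = ⊗-cong (A.*-congˡ e) (B.*-congˡ e′)
  scale-cong (a , b) (⊗-zero d)       = trans (⊗-cong (A.zeroʳ a) B.refl) (⊗-zero _)
  scale-cong (a , b) (⊗-distʳ c c′ d) = trans (⊗-cong (A.distribˡ a c c′) B.refl) (⊗-distʳ _ _ _)
  scale-cong (a , b) (⊗-distˡ c d d′) = trans (⊗-cong A.refl (B.distribˡ b d d′)) (⊗-distˡ _ _ _)
  scale-cong (a , b) (balanced r c d) =
    trans (⊗-cong (A-swap a (ι r) c) B.refl)
    (trans (balanced r (a A.* c) (b B.* d)) (⊗-cong A.refl (B-swap (κ r) b d)))
    where
    open import Algebra.Properties.CommutativeSemigroup A.*-commutativeSemigroup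
      renaming (x∙yz≈y∙xz to A-swap) using ()
    open import Algebra.Properties.CommutativeSemigroup B.*-commutativeSemigroup
      renaming (x∙yz≈y∙xz to B-swap) using ()

  *-congˡ : ∀ t {u u′} → u ≈ u′ → t * u ≈ t * u′
  *-congˡ []      e = refl
  *-congˡ (p ∷ t) e = ++-cong (scale-cong p e) (*-congˡ t e)

  *-[] : ∀ t → t * [] ≡ []
  *-[] []      = ≡.refl
  *-[] (p ∷ t) = *-[] t

  *-consʳ : ∀ t p u → t * (p ∷ u) ≈ scale p t ++ t * u
  *-consʳ []      p u = refl
  *-consʳ ((c , d) ∷ t) (a , b) u =
    trans (++-cong {(c A.* a) ⊗ (d B.* b)} (⊗-cong (A.*-comm c a) (B.*-comm d b))
            (++-cong {scale (c , d) u} refl (*-consʳ t (a , b) u)))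
    (++-cong {(a A.* c) ⊗ (b B.* d)} refl
      (trans (≡⇒≈ (≡.sym (List.++-assoc (scale (c , d) u) (scale (a , b) t) (t * u))))
      (trans (++-cong {u = t * u} (++-comm (scale (c , d) u) (scale (a , b) t)) refl)
             (≡⇒≈ (List.++-assoc (scale (a , b) t) (scale (c , d) u) (t * u))))))

  *-comm : ∀ t u → t * u ≈ u * t
  *-comm []      u = ≡⇒≈ (≡.sym (*-[] u))
  *-comm (p ∷ t) u = trans (++-cong {scale p u} refl (*-comm t u)) (sym (*-consʳ u p t))

  *-cong : ∀ {t t′ u u′} → t ≈ t′ → u ≈ u′ → t * u ≈ t′ * u′
  *-cong {t} {t′} {u} {u′} e e′ =
    trans (*-congˡ t e′) (trans (*-comm t u′) (trans (*-congˡ u′ e) (*-comm u′ t′)))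

  *-distribʳ : ∀ t u v → (t ++ u) * v ≡ t * v ++ u * v
  *-distribʳ t u v = List.concatMap-++ (λ p → scale p v) t u

  *-distribˡ : ∀ t u v → t * (u ++ v) ≈ t * u ++ t * v
  *-distribˡ t u v =
    trans (*-comm t (u ++ v)) (trans (≡⇒≈ (*-distribʳ u v t)) (++-cong (*-comm u t) (*-comm v t)))

  scale-scale : ∀ p q t → scale p (scale q t) ≈ scale (proj₁ p A.* proj₁ q , proj₂ p B.* proj₂ q) t
  scale-scale p q []      = refl
  scale-scale p q (r ∷ t) =
    ++-cong (⊗-cong (A.sym (A.*-assoc _ _ _)) (B.sym (B.*-assoc _ _ _))) (scale-scale p q t)

  scale-* : ∀ p t u → scale p t * u ≈ scale p (t * u)
  scale-* p []      u = refl
  scale-* p (q ∷ t) u =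
    trans (++-cong (sym (scale-scale p q u)) (scale-* p t u))
          (≡⇒≈ (≡.sym (List.map-++ _ (scale q u) (t * u))))

  *-assoc : ∀ t u v → (t * u) * v ≈ t * (u * v)
  *-assoc []      u v = refl
  *-assoc (p ∷ t) u v =
    trans (≡⇒≈ (*-distribʳ (scale p u) (t * u) v)) (++-cong (scale-* p u v) (*-assoc t u v))

  *-identityˡ : ∀ t → (A.1# ⊗ B.1#) * t ≈ t
  *-identityˡ t = trans (≡⇒≈ (List.++-identityʳ _)) (unit t)
    where
    unit : ∀ t → scale (A.1# , B.1#) t ≈ t
    unit []      = refl
    unit (p ∷ t) = ++-cong (⊗-cong (A.*-identityˡ _) (B.*-identityˡ _)) (unit t)

  tensorRing : Ring
  tensorRing = makeRing _≈_ _++_ _*_ neg [] (A.1# ⊗ B.1#)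
    (record { refl = refl ; sym = sym ; trans = trans })
    ++-cong (λ t u v → ≡⇒≈ (List.++-assoc t u v)) ++-comm (λ _ → refl)
    neg-cong neg-inverse *-cong *-assoc *-comm *-identityˡ *-distribˡ

-- The proofs are irrelevant so that partitions with the same parts are
-- propositionally equal.
record Partition : Set where
  constructor partition
  field
    parts       : List ℕ
    .decreasing : Linked _≥_ parts
    .positive   : All (0 <_) parts

open Partition public using (parts)

ℓ : Partition → ℕ
ℓ λ′ = length (parts λ′)

-- part λ′ j is λ_{j+1}, and is 0 for j ≥ ℓ(λ).
part : Partition → ℕ → ℕ
part λ′ = nth (parts λ′)
  where
  nth : List ℕ → ℕ → ℕ
  nth []       j       = 0
  nth (k ∷ ks) zero    = k
  nth (k ∷ ks) (suc j) = nth ks j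

-- The number of diagonal boxes (j+1 , j+1), i.e. of rows j with j < λ_{j+1}.
diagonal : Partition → ℕ
diagonal λ′ = length (filter (λ j → j ℕ.<? part λ′ j) (upTo (ℓ λ′)))

-- λ_j + n - j for the (zero-based) column j
exponent : Partition → ∀ n → Fin n → ℕ
exponent λ′ n j = part λ′ (toℕ j) ℕ.+ (n ∸ suc (toℕ j))

ℚ[a]-ring : Ring
ℚ[a]-ring = Polynomial.polynomialRing ℚ.+-*-commutativeRing ℤ

ℚ[a] : Set
ℚ[a] = ∣ ℚ[a]-ring ∣

a : ℤ → ℚ[a]
a = Polynomial.var

module ℚ[a][x] where
  open Polynomial ℚ[a]-ring public

  ring : ℕ → Ring
  ring n = polynomialRing (Fin n)

  snoc : ∀ {A : Set} {n} → (Fin n → A) → A → Fin (suc n) → A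
  snoc {n = zero}  v c i       = c
  snoc {n = suc n} v c zero    = v zero
  snoc {n = suc n} v c (suc i) = snoc (v ∘ suc) c i

  -- P(x_π(1),…,x_π(n))
  permute : ∀ {n} → Permutation′ n → Poly (Fin n) → Poly (Fin n)
  permute π = substitute λ i → var (π ⟨$⟩ʳ i)

  -- P(x₁,…,xₙ,c)
  setLast : ∀ {n} → ℚ[a] → Poly (Fin (suc n)) → Poly (Fin n)
  setLast c = substitute (snoc var (con c))

open ℚ[a][x] using (Poly)

record Λ : Set where
  open ℚ[a][x]
  field
    at        : ∀ n → Poly (Fin n)
    symmetric : ∀ n (π : Permutation′ n) → permute π (at n) ≈ at n
    bounded   : ∃ λ d → ∀ n → DegreeAtMost d (at n)
    stable    : ∀ n → setLast (a (ℤ.+ suc n)) (at (suc n)) ≈ at n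

open Λ public using (at)

module _ where
  open ℚ[a][x]

  infixl 6 _+Λ_
  infixl 7 _*Λ_

  _+Λ_ _*Λ_ : Λ → Λ → Λ
  P +Λ Q = record
    { at        = λ n → at P n + at Q n
    ; symmetric = λ n π → +-cong (P.symmetric n π) (Q.symmetric n π)
    ; bounded   = let (d , b) = P.bounded ; (e , c) = Q.bounded in d ⊔ e , λ n →
        let (p , p≈ , p≤) = b n ; (q , q≈ , q≤) = c n in
        p + q , +-cong p≈ q≈ , ℕ.⊔-mono-≤ p≤ q≤
    ; stable    = λ n → +-cong (P.stable n) (Q.stable n)
    }
    where
    module P = Λ P
    module Q = Λ Q
  P *Λ Q = record
    { at        = λ n → at P n * at Q n
    ; symmetric = λ n π → *-cong (P.symmetric n π) (Q.symmetric n π)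
    ; bounded   = let (d , b) = P.bounded ; (e , c) = Q.bounded in d ℕ.+ e , λ n →
        let (p , p≈ , p≤) = b n ; (q , q≈ , q≤) = c n in
        p * q , *-cong p≈ q≈ , ℕ.+-mono-≤ p≤ q≤
    ; stable    = λ n → *-cong (P.stable n) (Q.stable n)
    }
    where
    module P = Λ P
    module Q = Λ Q

  -Λ_ : Λ → Λ
  -Λ P = record
    { at        = λ n → - at P n
    ; symmetric = λ n π → -‿cong (P.symmetric n π)
    ; bounded   = let (d , b) = P.bounded in d , λ n →
        let (p , p≈ , p≤) = b n in - p , -‿cong p≈ , p≤
    ; stable    = λ n → -‿cong (P.stable n)
    }
    where
    module P = Λ P

  constantΛ : ℚ[a] → Λ
  constantΛ c = record
    { at        = λ n → con c
    ; symmetric = λ n π → refl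
    ; bounded   = 0 , λ n → con c , refl , z≤n
    ; stable    = λ n → refl
    }

  Λ-ring : Ring
  Λ-ring = makeRing (λ P Q → ∀ n → at P n ≈ at Q n) _+Λ_ _*Λ_ -Λ_
    (constantΛ (CommutativeRing.0# ℚ[a]-ring)) (constantΛ (CommutativeRing.1# ℚ[a]-ring))
    (record { refl = λ n → refl ; sym = λ e n → sym (e n) ; trans = λ e e′ n → trans (e n) (e′ n) })
    (λ e e′ n → +-cong (e n) (e′ n)) (λ P Q R n → +-assoc _ _ _) (λ P Q n → +-comm _ _)
    (λ P n → +-identity _) (λ e n → -‿cong (e n)) (λ P n → -‿inverse _)
    (λ e e′ n → *-cong (e n) (e′ n)) (λ P Q R n → *-assoc _ _ _) (λ P Q n → *-comm _ _)
    (λ P n → *-identity _) (λ P Q R n → distrib _ _ _)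

  private
    module Ring′ {n : ℕ} where
      open RingOps (ring n) public
      open CommutativeRing (ring n) public using (_-_)

  open Ring′
  open RingOps ℚ[a]-ring using () renaming (_^_ to _^ₐ_)

  substitute-^ : ∀ {m n} (σ : Fin m → Poly (Fin n)) p k → substitute σ (p ^ k) ≡ substitute σ p ^ k
  substitute-^ σ p zero    = ≡.refl
  substitute-^ σ p (suc k) = ≡.cong (substitute σ p *_) (substitute-^ σ p k)

  con-^ : ∀ {n} c k → con c ^ k ≈ con {Fin n} (c ^ₐ k)
  con-^ c zero    = refl
  con-^ c (suc k) = trans (*-cong refl (con-^ c k)) (sym (con-* _ _))

  -- ∑ᵢ (yᵢᵏ - bᵢᵏ)
  powerSum : ℕ → ∀ {m n} → (ℕ → ℚ[a]) → (Fin m → Poly (Fin n)) → Poly (Fin n)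
  powerSum k b y = sum λ i → y i ^ k - con (b (toℕ i) ^ₐ k)

  substitute-powerSum : ∀ k {l m n} b (σ : Fin m → Poly (Fin n)) (y : Fin l → Poly (Fin m)) →
                        substitute σ (powerSum k b y) ≡ powerSum k b (substitute σ ∘ y)
  substitute-powerSum k {zero}  b σ y = ≡.refl
  substitute-powerSum k {suc l} b σ y = ≡.cong₂ _+_
    (≡.cong (_- con (b 0 ^ₐ k)) (substitute-^ σ (y zero) k))
    (substitute-powerSum k (b ∘ suc) σ (y ∘ suc))

  powerSum-permute : ∀ k {m n} b (π : Permutation′ m) (y : Fin m → Poly (Fin n)) →
                     powerSum k b (y ∘ (π ⟨$⟩ʳ_)) ≈ powerSum k b y
  powerSum-permute k {m} {n} b π y =
    trans (∑-distrib-+ (f ∘ (π ⟨$⟩ʳ_)) g)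
    (trans (+-cong (sym (sum-permute f π)) refl) (sym (∑-distrib-+ f g)))
    where
    open import Algebra.Properties.CommutativeMonoid.Sum
      (CommutativeRing.+-commutativeMonoid (ring n)) using (∑-distrib-+; sum-permute)
    f g : Fin m → Poly (Fin n)
    f i = y i ^ k
    g i = - con (b (toℕ i) ^ₐ k)

  powerSum-snoc : ∀ k {m n} b (y : Fin m → Poly (Fin n)) →
                  powerSum k b (snoc y (con (b m))) ≈ powerSum k b y
  powerSum-snoc k {zero} {n} b y = trans (+-identityʳ _)
    (trans (+-cong (con-^ (b 0) k) refl) (-‿inverseʳ _))
    where open CommutativeRing (ring n) using (-‿inverseʳ; +-identityʳ)
  powerSum-snoc k {suc m} b y = +-cong refl (powerSum-snoc k (b ∘ suc) (y ∘ suc))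

  expressionDegree-^ : ∀ {n} (i : Fin n) k → expressionDegree (var i ^ k) ≤ k
  expressionDegree-^ i zero    = z≤n
  expressionDegree-^ i (suc k) = ℕ.+-monoʳ-≤ 1 (expressionDegree-^ i k)

  expressionDegree-powerSum : ∀ k {m n} b (v : Fin m → Fin n) →
                              expressionDegree (powerSum k b (var ∘ v)) ≤ k
  expressionDegree-powerSum k {zero}  b v = z≤n
  expressionDegree-powerSum k {suc m} b v = ℕ.⊔-lub
    (ℕ.⊔-lub (expressionDegree-^ (v zero) k) z≤n)
    (expressionDegree-powerSum k (b ∘ suc) (v ∘ suc))

  positives : ℕ → ℚ[a]
  positives i = a (ℤ.+ suc i)

  p : ℕ → Λ
  p k = record
    { at        = λ n → powerSum k positives var
    ; symmetric = λ n π → trans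
        (≡⇒≈ (substitute-powerSum k positives (λ i → var (π ⟨$⟩ʳ i)) var))
        (powerSum-permute k positives π var)
    ; bounded   = k , λ n → powerSum k positives var , refl , expressionDegree-powerSum k {n} {n} positives λ i → i
    ; stable    = λ n → trans
        (≡⇒≈ (substitute-powerSum k positives (snoc var (con (positives n))) var))
        (powerSum-snoc k positives var)
    }
    where
    ≡⇒≈ : ∀ {n} {P Q : Poly (Fin n)} → P ≡ Q → P ≈ Q
    ≡⇒≈ ≡.refl = refl

  -- (xᵢ‖a)ʳ = (xᵢ - aₙ)(xᵢ - aₙ₋₁)⋯(xᵢ - aₙ₋ᵣ₊₁)
  doublePower : ∀ n → Fin n → ℕ → Poly (Fin n)
  doublePower n i r = product λ (k : Fin r) → var i - con (a (ℤ.+ n ℤ.- ℤ.+ toℕ k))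

  IsDoubleSchur : Partition → Λ → Set
  IsDoubleSchur λ′ P = ∀ n →
    (ℓ λ′ ≤ n → IsBialternant {n} var (λ i j → doublePower n i (exponent λ′ n j)) (at P n)) ×
    (n < ℓ λ′ → at P n ≈ con (CommutativeRing.0# ℚ[a]-ring))

open TensorProduct ℚ[a]-ring Λ-ring Λ-ring constantΛ constantΛ public
  using (_⊗_; scale) renaming (Tensor to Λ⊗Λ; tensorRing to Λ⊗Λ-ring)

infixr 7 _•_
_•_ : ℚ[a] → Λ⊗Λ → Λ⊗Λ
c • t = scale (constantΛ c , CommutativeRing.1# Λ-ring) t

record IsComultiplication (Δ : Λ → Λ⊗Λ) : Set where
  open CommutativeRing Λ⊗Λ-ring using (_≈_; _+_)
  open CommutativeRing Λ-ring using (1#)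
  open RingMorphisms (CommutativeRing.rawRing Λ-ring) (CommutativeRing.rawRing Λ⊗Λ-ring)
  field
    isRingHomomorphism : IsRingHomomorphism Δ
    linear             : ∀ c P → Δ (constantΛ c *Λ P) ≈ c • Δ P
    powerSums          : ∀ k → 1 ≤ k → Δ (p k) ≈ p k ⊗ 1# + 1# ⊗ p k

-- ĉ λ μ ν is the coefficient of s_λ ⊗ s_μ in Δ(s_ν).
IsDualLittlewoodRichardson : (Partition → Λ) → (Λ → Λ⊗Λ) →
                             (Partition → Partition → Partition → ℚ[a]) → Set
IsDualLittlewoodRichardson s Δ ĉ = ∀ ν →
  HasSum (CommutativeRing.+-commutativeMonoid Λ⊗Λ-ring)
         {Partition × Partition} (λ (λ′ , μ) → ĉ λ′ μ ν • s λ′ ⊗ s μ) (Δ (s ν))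

open MultivariateSeries ℚ[a]-ring

-- ∏ₙ ℚ[a][[x₁,…,xₙ]]
sequenceRing : Ring
sequenceRing = makeRing {∀ n → ∣ seriesRing n ∣} (λ F G → ∀ n → S._≈_ n (F n) (G n))
  (λ F G n → S._+_ n (F n) (G n)) (λ F G n → S._*_ n (F n) (G n)) (λ F n → S.-_ n (F n))
  (λ n → S.0# n) (λ n → S.1# n)
  (record { refl = λ n → S.refl n ; sym = λ e n → S.sym n (e n) ; trans = λ e f n → S.trans n (e n) (f n) })
  (λ e f n → S.+-cong n (e n) (f n)) (λ F G H n → S.+-assoc n (F n) (G n) (H n))
  (λ F G n → S.+-comm n (F n) (G n)) (λ F n → S.+-identityˡ n (F n))
  (λ e n → S.-‿cong n (e n)) (λ F n → S.-‿inverseˡ n (F n))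
  (λ e f n → S.*-cong n (e n) (f n)) (λ F G H n → S.*-assoc n (F n) (G n) (H n))
  (λ F G n → S.*-comm n (F n) (G n)) (λ F n → S.*-identityˡ n (F n))
  (λ F G H n → S.distribˡ n (F n) (G n) (H n))
  where
  module S n = CommutativeRing (seriesRing n)

Sequence : Set
Sequence = ∣ sequenceRing ∣

infixr 7 _•̂_
_•̂_ : ℚ[a] → Sequence → Sequence
(c •̂ F) n = scalar n c * F n
  where open CommutativeRing (seriesRing n) using (_*_)

-- Both sides of an identity between (possibly infinite) sums in Λ̂ are compared
-- in ∏ₙ ℚ[a][[x₁,…,xₙ]].  The coefficient of s_λ(x) in a formal sum is a finite
-- linear combination of coefficients of its value in ℓ(λ) variables, and
-- conversely, so this is the same as comparing coefficients of each s_λ(x).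
infix 4 _≈∑_
_≈∑_ : ∀ {I : Set} → Sequence → (I → Sequence) → Set
F ≈∑ Fs = ∀ n → IsFormalSum n (λ i → Fs i n) (F n)

-- S n is s_λ(x₁,…,xₙ) for the ordinary Schur function s_λ(x).
IsSchur : Partition → Sequence → Set
IsSchur λ′ S = ∀ n →
  let open CommutativeRing (seriesRing n)
      open RingOps (seriesRing n)
  in
  (ℓ λ′ ≤ n → IsBialternant (x n) (λ i j → x n i ^ exponent λ′ n j) (S n)) ×
  (n < ℓ λ′ → S n ≈ 0#)

-- A formal sum ∑_λ c_λ s_λ(x), regarded as the sequence of its values in
-- ℚ[a][[x₁,…,xₙ]], n ≥ 0.  The field schur is determined by isSchur.  Products
-- of such sums are products of sequences: Λ̂ is a subring of sequenceRing.
record Λ̂ : Set where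
  field
    sequence     : Sequence
    coefficients : Partition → ℚ[a]
    schur        : Partition → Sequence
    isSchur      : ∀ λ′ → IsSchur λ′ (schur λ′)
    expansion    : sequence ≈∑ λ λ′ → coefficients λ′ •̂ schur λ′

open Λ̂ public using (sequence)

-- The matrix entry A_ij, with zero-based j: the first case is j < d, with
-- the denominator (1 - a₀ xᵢ)(1 - a₋₁ xᵢ)⋯(1 - a_{(j+1) - λ_{j+1}} xᵢ).
dualEntry : Partition → ∀ n → Fin n → Fin n → ∣ seriesRing n ∣
dualEntry λ′ n i j = x n i ^ exponent λ′ n j *
  (if does (toℕ j ℕ.<? diagonal λ′)
   then (product λ (k : Fin (part λ′ (toℕ j) ∸ toℕ j)) → geometric n (a (ℤ.- ℤ.+ toℕ k)) i)
   else (product λ (k : Fin (toℕ j ∸ part λ′ (toℕ j))) → 1# - scalar n (a (ℤ.+ suc (toℕ k))) * x n i))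
  where
  open CommutativeRing (seriesRing n)
  open RingOps (seriesRing n)

IsDualSchur : Partition → Λ̂ → Set
IsDualSchur λ′ S = ∀ n →
  let open CommutativeRing (seriesRing n)
      open RingOps (seriesRing n)
  in
  (ℓ λ′ ≤ n → IsBialternant (x n) (dualEntry λ′ n) (sequence S n)) ×
  (n < ℓ λ′ → sequence S n ≈ 0#)

{-# OPTIONS --safe #-}

-- Newton interpolation at the nodes a_N, a_{N-1}, … gives linear functionals
-- on ℚ[a][x₁,…,x_N]: the coefficients in the basis ∏ᵢ (xᵢ‖a)^{eᵢ}.  Multiplying
-- by the Vandermonde product V(x) first, one obtains functionals s_ν* on Λ(x‖a)
-- with s_ν*(s_μ) = δ_{νμ}, and an element of Λ(x‖a) killed by all of them is 0.
-- The coefficient K_α of yᵅ in the Cauchy kernel ∏ᵢⱼ (1 - aᵢ yⱼ) / (1 - xᵢ yⱼ)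
-- is a product of elements h_k of Λ(x‖a), and the Cauchy determinant shows that
-- s_ν*(K_α) is the coefficient of yᵅ in ŝ_ν(y‖a).  Hence
--   K_α = ∑_ν [yᵅ] ŝ_ν(y‖a) s_ν(x‖a).
-- The relation k h_k = ∑_{i ≥ 1} p_i h_{k-i} yields Δ h_k = ∑ h_i ⊗ h_{k-i}, so
-- Δ K_α = ∑_{β+γ=α} K_β ⊗ K_γ.  Apply s_λ* ⊗ s_μ* to both expressions for Δ K_α.

module Submission where

open import Algebra.Bundles using (CommutativeRing; RawRing)
open import Algebra.Morphism.Structures using (module RingMorphisms)
import Algebra.Solver.Ring
open import Algebra.Solver.Ring.AlmostCommutativeRing using (fromCommutativeRing; _-Raw-AlmostCommutative⟶_)
open import Data.Bool.Base using (Bool; true; false; if_then_else_)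
open import Data.Fin.Base using (Fin; zero; suc; toℕ; fromℕ; fromℕ<; inject₁; punchIn)
open import Data.Fin.Permutation using (permutation)
import Data.Fin.Properties as Fin
open import Data.Integer.Base as ℤ using (ℤ)
import Data.Integer.Properties as ℤ
open import Data.List.Base as List using (List; []; _∷_; _++_; applyUpTo; concatMap; deduplicate; filter; foldr; length; upTo)
import Data.List.Membership.DecPropositional as Membership
open import Data.List.Membership.Propositional using (_∈_; _∉_)
open import Data.List.Membership.Propositional.Properties using (∈-concatMap⁺; ∈-deduplicate⁺; ∈-map⁺; ∈-upTo⁺)
import Data.List.Properties as List
open import Data.List.Relation.Unary.All as All using (All; []; _∷_)
open import Data.List.Relation.Unary.AllPairs using (_∷_)
open import Data.List.Relation.Unary.Any as Any using (here; there)
open import Data.List.Relation.Unary.Linked as Linked using (Linked; []; [-]; _∷_)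
import Data.List.Relation.Unary.Unique.DecPropositional.Properties as Unique
open import Data.List.Relation.Unary.Unique.Propositional using (Unique)
open import Data.Maybe.Base using (Maybe; just; nothing)
open import Data.Nat.Base as ℕ using (ℕ; zero; suc; _∸_; _≤_; _≥_; z≤n; s≤s)
import Data.Nat.Properties as ℕ
open import Data.Product.Base using (∃; _×_; _,_; proj₁; proj₂)
open import Data.Product.Properties using (≡-dec)
import Data.Rational.Base as ℚ
import Data.Rational.Properties as ℚ
open import Data.Unit.Base using (⊤; tt)
open import Data.Vec.Base as Vec using (Vec; []; _∷_; lookup; tabulate)
import Data.Vec.Properties as Vec
open import Data.Vec.Relation.Unary.All as Allᵥ using ([]; _∷_) renaming (All to Allᵥ)
open import Defs
open import Function.Base using (_∘_; id)
open import Level using (0ℓ)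
open import Relation.Binary.Definitions using (DecidableEquality; tri<; tri≈; tri>)
open import Relation.Binary.PropositionalEquality.Core as ≡ using (_≡_; _≢_)
import Relation.Binary.Reasoning.Setoid as SetoidReasoning
open import Relation.Nullary.Decidable.Core using (Dec; does; no; recompute; yes)
open import Relation.Nullary.Negation.Core using (contradiction)
open import Relation.Unary using (Decidable)

-- The factor V(x) has two effects. It turns s_μ into the determinant of the (xᵢ‖a)^(μⱼ + N - j),
-- whose Newton coefficients are determinants of Kronecker deltas. It also makes V P antisymmetric,
-- so that the coefficients at the exponents λ + δ determine P. At equal exponents antisymmetry
-- gives only x = -x, and the relation for k h_k is solved by dividing by k: in both places integers
-- are inverted in ℚ.
--
-- The obstacle is the number of variables. The nodes a_N, a_{N-1}, ... depend on N, the functional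
-- s_ν* needs N ≥ ℓ(ν), and the Cauchy determinant needs as many y as x, while the length of α is
-- fixed. Hence α is padded with zeros. This changes neither K_α, as h_0 = 1, nor the coefficient of
-- yᵅ in ŝ_ν, by stability.
--
-- The two cases of A_ij are a single formula, tʳ ∏_{k=1..N} (1 - a_k t) / ∏_{k=0..r} (1 - a_{N-k}
-- t) with r = λⱼ + N - j: the numerator or the denominator cancels completely. This series is the
-- coefficient of (x‖a)ʳ in the Newton expansion of ∏_{k=1..N} (1 - a_k t) / (1 - x t).

-- The ring solver of the standard library with integer coefficients, an
-- integer being a pair (m , n) that stands for m - n.
module IntegerSolver (R : Ring) where
  open CommutativeRing R hiding (zero)
  open import Algebra.Properties.Ring ring
  open import Algebra.Properties.AbelianGroup +-abelianGroup using (⁻¹-∙-comm)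
  open import Algebra.Properties.CommutativeSemigroup +-commutativeSemigroup using () renaming (interchange to +-interchange)
  open import Algebra.Properties.Semiring.Mult.TCOptimised semiring renaming (_×_ to _×′_)
  open import Relation.Binary.Reasoning.Setoid setoid

  private
    -- A zero subtrahend is left out, so that (0 , 0) and (1 , 0) denote `0#` and `1#`
    -- definitionally, as the uses of `:0` and `:1` require.
    ⟦_⟧ : ℕ × ℕ → Carrier
    ⟦ m , zero  ⟧ = m ×′ 1#
    ⟦ m , suc n ⟧ = m ×′ 1# - suc n ×′ 1#

    ⟦⟧≈ : ∀ m n → ⟦ m , n ⟧ ≈ m ×′ 1# - n ×′ 1#
    ⟦⟧≈ m zero    = sym (trans (+-congˡ -0#≈0#) (+-identityʳ _))
    ⟦⟧≈ m (suc n) = refl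

    -- At least one component becomes 0. Each integer then has a single representative, and `_≟_`
    -- can compare coefficients by `_≡_`.
    normalise : ℕ × ℕ → ℕ × ℕ
    normalise (m , n) = m ∸ n , n ∸ m

    cancel : ∀ a b c → (c + a) - (c + b) ≈ a - b
    cancel a b c = begin
      (c + a) + - (c + b)    ≈⟨ +-congˡ (⁻¹-∙-comm c b) ⟨
      (c + a) + (- c + - b)  ≈⟨ +-interchange c a (- c) (- b) ⟩
      (c - c) + (a - b)      ≈⟨ +-congʳ (-‿inverseʳ c) ⟩
      0# + (a - b)           ≈⟨ +-identityˡ _ ⟩
      a - b                  ∎

    normalise-correct : ∀ m n → ⟦ normalise (m , n) ⟧ ≈ m ×′ 1# - n ×′ 1#
    normalise-correct zero    zero    = ⟦⟧≈ 0 0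
    normalise-correct zero    (suc n) = refl
    normalise-correct (suc m) zero    = ⟦⟧≈ (suc m) 0
    normalise-correct (suc m) (suc n) = begin
      ⟦ normalise (m , n) ⟧                  ≈⟨ normalise-correct m n ⟩
      m ×′ 1# - n ×′ 1#                      ≈⟨ cancel _ _ 1# ⟨
      (1# + m ×′ 1#) - (1# + n ×′ 1#)        ≈⟨ +-cong (×-homo-+ 1# 1 m) (-‿cong (×-homo-+ 1# 1 n)) ⟨
      suc m ×′ 1# - suc n ×′ 1#              ∎

    coefficients : RawRing 0ℓ 0ℓ
    coefficients = record
      { Carrier = ℕ × ℕ
      ; _≈_ = _≡_
      ; _+_ = λ (m , n) (p , q) → normalise (m ℕ.+ p , n ℕ.+ q)
      ; _*_ = λ (m , n) (p , q) → normalise (m ℕ.* p ℕ.+ n ℕ.* q , m ℕ.* q ℕ.+ n ℕ.* p)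
      ; -_  = λ (m , n) → n , m
      ; 0#  = 0 , 0
      ; 1#  = 1 , 0
      }

    +-homo : ∀ m n p q → ⟦ normalise (m ℕ.+ p , n ℕ.+ q) ⟧ ≈ ⟦ m , n ⟧ + ⟦ p , q ⟧
    +-homo m n p q = begin
      ⟦ normalise (m ℕ.+ p , n ℕ.+ q) ⟧                    ≈⟨ normalise-correct (m ℕ.+ p) (n ℕ.+ q) ⟩
      (m ℕ.+ p) ×′ 1# - (n ℕ.+ q) ×′ 1#
        ≈⟨ +-cong (×-homo-+ 1# m p) (trans (-‿cong (×-homo-+ 1# n q)) (sym (⁻¹-∙-comm _ _))) ⟩
      (m ×′ 1# + p ×′ 1#) + (- (n ×′ 1#) - q ×′ 1#)        ≈⟨ +-interchange _ _ _ _ ⟩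
      (m ×′ 1# - n ×′ 1#) + (p ×′ 1# - q ×′ 1#)            ≈⟨ +-cong (⟦⟧≈ m n) (⟦⟧≈ p q) ⟨
      ⟦ m , n ⟧ + ⟦ p , q ⟧                                ∎

    difference-* : ∀ a b c d → (a - b) * (c - d) ≈ (a * c + b * d) - (a * d + b * c)
    difference-* a b c d = begin
      (a - b) * (c - d)                                ≈⟨ distribˡ _ _ _ ⟩
      (a - b) * c + (a - b) * - d                      ≈⟨ +-cong (distribʳ _ _ _) (distribʳ _ _ _) ⟩
      (a * c + - b * c) + (a * - d + - b * - d)
        ≈⟨ +-cong (+-congˡ (sym (-‿distribˡ-* b c))) (+-cong (sym (-‿distribʳ-* a d)) (-x*-y b d)) ⟩
      (a * c - b * c) + (- (a * d) + b * d)            ≈⟨ +-congˡ (+-comm _ _) ⟩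
      (a * c - b * c) + (b * d - a * d)                ≈⟨ +-interchange _ _ _ _ ⟩
      (a * c + b * d) + (- (b * c) - a * d)            ≈⟨ +-congˡ (trans (+-comm _ _) (⁻¹-∙-comm _ _)) ⟩
      (a * c + b * d) - (a * d + b * c)                ∎
      where
      -x*-y : ∀ x y → - x * - y ≈ x * y
      -x*-y x y = trans (sym (-‿distribˡ-* x (- y))) (trans (-‿cong (sym (-‿distribʳ-* x y))) (-‿involutive _))

    *-homo : ∀ m n p q → ⟦ normalise (m ℕ.* p ℕ.+ n ℕ.* q , m ℕ.* q ℕ.+ n ℕ.* p) ⟧ ≈ ⟦ m , n ⟧ * ⟦ p , q ⟧
    *-homo m n p q = begin
      ⟦ normalise (m ℕ.* p ℕ.+ n ℕ.* q , m ℕ.* q ℕ.+ n ℕ.* p) ⟧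
        ≈⟨ normalise-correct (m ℕ.* p ℕ.+ n ℕ.* q) _ ⟩
      (m ℕ.* p ℕ.+ n ℕ.* q) ×′ 1# - (m ℕ.* q ℕ.+ n ℕ.* p) ×′ 1#
        ≈⟨ +-cong (sum-of-products m p n q) (-‿cong (sum-of-products m q n p)) ⟩
      (m ×′ 1# * p ×′ 1# + n ×′ 1# * q ×′ 1#) - (m ×′ 1# * q ×′ 1# + n ×′ 1# * p ×′ 1#)
        ≈⟨ difference-* _ _ _ _ ⟨
      (m ×′ 1# - n ×′ 1#) * (p ×′ 1# - q ×′ 1#)
        ≈⟨ *-cong (⟦⟧≈ m n) (⟦⟧≈ p q) ⟨
      ⟦ m , n ⟧ * ⟦ p , q ⟧
        ∎
      where
      sum-of-products : ∀ a b c d → (a ℕ.* b ℕ.+ c ℕ.* d) ×′ 1# ≈ a ×′ 1# * b ×′ 1# + c ×′ 1# * d ×′ 1#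
      sum-of-products a b c d =
        trans (×-homo-+ 1# (a ℕ.* b) (c ℕ.* d)) (+-cong (×1-homo-* a b) (×1-homo-* c d))

    -‿homo : ∀ m n → ⟦ n , m ⟧ ≈ - ⟦ m , n ⟧
    -‿homo m n = begin
      ⟦ n , m ⟧                ≈⟨ ⟦⟧≈ n m ⟩
      n ×′ 1# - m ×′ 1#        ≈⟨ +-congʳ (-‿involutive _) ⟨
      - - (n ×′ 1#) - m ×′ 1#  ≈⟨ +-comm _ _ ⟩
      - (m ×′ 1#) - - (n ×′ 1#) ≈⟨ ⁻¹-∙-comm _ _ ⟩
      - (m ×′ 1# - n ×′ 1#)    ≈⟨ -‿cong (⟦⟧≈ m n) ⟨
      - ⟦ m , n ⟧              ∎

    morphism : coefficients -Raw-AlmostCommutative⟶ fromCommutativeRing R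
    morphism = record
      { ⟦_⟧    = ⟦_⟧
      ; +-homo = λ (m , n) (p , q) → +-homo m n p q
      ; *-homo = λ (m , n) (p , q) → *-homo m n p q
      ; -‿homo = λ (m , n) → -‿homo m n
      ; 0-homo = refl
      ; 1-homo = refl
      }

    _≟_ : ∀ i j → Maybe (⟦ i ⟧ ≈ ⟦ j ⟧)
    i ≟ j with ≡-dec ℕ._≟_ ℕ._≟_ i j
    ... | yes ≡.refl = just refl
    ... | no _       = nothing

  open Algebra.Solver.Ring coefficients (fromCommutativeRing R) morphism _≟_ public
    using (solve; _:=_; _:+_; _:*_; _:-_; :-_)
    renaming (con to coefficient)

  :1 : ∀ {n} → Algebra.Solver.Ring.Polynomial coefficients (fromCommutativeRing R) morphism _≟_ n
  :1 = coefficient (1 , 0)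

  :0 : ∀ {n} → Algebra.Solver.Ring.Polynomial coefficients (fromCommutativeRing R) morphism _≟_ n
  :0 = coefficient (0 , 0)

-- Additive maps and ring homomorphisms

record Additive (A B : Ring) (f : ∣ A ∣ → ∣ B ∣) : Set where
  private
    module A = CommutativeRing A
    module B = CommutativeRing B
  field
    cong   : ∀ {x y} → x A.≈ y → f x B.≈ f y
    +-homo : ∀ x y → f (x A.+ y) B.≈ f x B.+ f y

  open import Algebra.Properties.Ring B.ring
  open import Relation.Binary.Reasoning.Setoid B.setoid

  0-homo : f A.0# B.≈ B.0#
  0-homo = x+x≈x⇒x≈0 (f A.0#) (B.trans (B.sym (+-homo A.0# A.0#)) (cong (A.+-identityˡ A.0#)))

  -‿homo : ∀ x → f (A.- x) B.≈ B.- f x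
  -‿homo x = +-inverseˡ-unique (f (A.- x)) (f x)
    (B.trans (B.sym (+-homo (A.- x) x)) (B.trans (cong (A.-‿inverseˡ x)) 0-homo))

  ∸-homo : ∀ x y → f (x A.- y) B.≈ f x B.- f y
  ∸-homo x y = B.trans (+-homo x (A.- y)) (B.+-congˡ (-‿homo y))

  sum-homo : ∀ {n} (g : Fin n → ∣ A ∣) → f (RingOps.sum A g) B.≈ RingOps.sum B (f ∘ g)
  sum-homo {zero}  g = 0-homo
  sum-homo {suc n} g = B.trans (+-homo _ _) (B.+-congˡ (sum-homo (g ∘ suc)))

  foldr-homo : ∀ {I : Set} (g : I → ∣ A ∣) is →
               f (foldr A._+_ A.0# (List.map g is)) B.≈ foldr B._+_ B.0# (List.map (f ∘ g) is)
  foldr-homo g []       = 0-homo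
  foldr-homo g (i ∷ is) = B.trans (+-homo _ _) (B.+-congˡ (foldr-homo g is))

-- Kept apart from `Additive` because the Newton functionals and the extraction of coefficients are
-- additive without being multiplicative.
record Hom (A B : Ring) (f : ∣ A ∣ → ∣ B ∣) : Set where
  private
    module A = CommutativeRing A
    module B = CommutativeRing B
    module A′ = RingOps A
    module B′ = RingOps B
  field
    additive : Additive A B f
    *-homo   : ∀ x y → f (x A.* y) B.≈ f x B.* f y
    1-homo   : f A.1# B.≈ B.1#

  open Additive additive public

  product-homo : ∀ {n} (g : Fin n → ∣ A ∣) → f (A′.product g) B.≈ B′.product (f ∘ g)
  product-homo {zero}  g = 1-homo
  product-homo {suc n} g = B.trans (*-homo _ _) (B.*-congˡ (product-homo (g ∘ suc)))

  ^-homo : ∀ x k → f (x A′.^ k) B.≈ f x B′.^ k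
  ^-homo x zero    = 1-homo
  ^-homo x (suc k) = B.trans (*-homo _ _) (B.*-congˡ (^-homo x k))

  sign-homo : ∀ k → f ((A.- A.1#) A′.^ k) B.≈ (B.- B.1#) B′.^ k
  sign-homo k = B.trans (^-homo _ k) (B′-^-congˡ k (B.trans (-‿homo A.1#) (B.-‿cong 1-homo)))
    where open import Algebra.Properties.Semiring.Exp B.semiring using () renaming (^-congˡ to B′-^-congˡ)

  det-homo : ∀ {n} (M : Fin n → Fin n → ∣ A ∣) → f (A′.det M) B.≈ B′.det λ i j → f (M i j)
  det-homo {zero}  M = 1-homo
  det-homo {suc n} M = B.trans (sum-homo term) (sum-cong-≋ {suc n} {f ∘ term} {term′} λ j →
    B.trans (*-homo _ _) (B.*-cong (sign-homo (toℕ j))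
      (B.trans (*-homo _ _) (B.*-congˡ (det-homo λ i k → M (suc i) (punchIn j k))))))
    where
    open import Algebra.Properties.CommutativeMonoid.Sum B.+-commutativeMonoid using (sum-cong-≋)
    term : Fin (suc n) → ∣ A ∣
    term j = (A.- A.1#) A′.^ toℕ j A.* (M zero j A.* A′.det λ i k → M (suc i) (punchIn j k))
    term′ : Fin (suc n) → ∣ B ∣
    term′ j = (B.- B.1#) B′.^ toℕ j B.* (f (M zero j) B.* B′.det λ i k → f (M (suc i) (punchIn j k)))

  vandermonde-homo : ∀ {n} (x : Fin n → ∣ A ∣) → f (A′.vandermonde x) B.≈ B′.vandermonde (f ∘ x)
  vandermonde-homo {n} x = B.trans
    (product-homo {n} λ i → A′.product λ j → if does (i Fin.<? j) then x i A.- x j else A.1#)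
    (sum-cong-≋ {n} λ i → B.trans
      (product-homo {n} λ j → if does (i Fin.<? j) then x i A.- x j else A.1#)
      (sum-cong-≋ {n} λ j → factor i j))
    where
    open import Algebra.Properties.CommutativeMonoid.Sum B.*-commutativeMonoid using (sum-cong-≋)
    factor : ∀ i j → f (if does (i Fin.<? j) then x i A.- x j else A.1#) B.≈
                     (if does (i Fin.<? j) then f (x i) B.- f (x j) else B.1#)
    factor i j with does (i Fin.<? j)
    ... | true  = ∸-homo _ _
    ... | false = 1-homo

-- Determinants

module Determinant (R : Ring) where
  open CommutativeRing R hiding (zero)
  open RingOps R
  open IntegerSolver R
  open import Algebra.Properties.Semiring.Sum semiring hiding (sum)
  open import Algebra.Properties.CommutativeMonoid.Sum *-commutativeMonoid
    using () renaming (sum-cong-≋ to product-cong; sum-remove to product-remove; ∑-distrib-+ to product-*) public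
  open import Algebra.Properties.Ring ring
  open import Relation.Binary.Reasoning.Setoid setoid

  sum-cong : ∀ {n} {f g : Fin n → Carrier} → (∀ i → f i ≈ g i) → sum f ≈ sum g
  sum-cong {n} e = sum-cong-≋ {n} e

  sum≈0 : ∀ {n} {f : Fin n → Carrier} → (∀ i → f i ≈ 0#) → sum f ≈ 0#
  sum≈0 {n} e = trans (sum-cong e) (sum-replicate-zero n)

  product≈1 : ∀ {n} {f : Fin n → Carrier} → (∀ i → f i ≈ 1#) → product f ≈ 1#
  product≈1 {zero}  e = refl
  product≈1 {suc n} e = trans (*-cong (e zero) (product≈1 (e ∘ suc))) (*-identityˡ _)

  sum-linear : ∀ {n} c (f g : Fin n → Carrier) → sum (λ i → f i + c * g i) ≈ sum f + c * sum g
  sum-linear c f g = trans (∑-distrib-+ f (λ i → c * g i)) (+-congˡ (sym (*-distribˡ-sum c g)))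

  sign : ∀ {n} → Fin n → Carrier
  sign i = (- 1#) ^ toℕ i

  det-cong : ∀ {n} {M N : Fin n → Fin n → Carrier} → (∀ i j → M i j ≈ N i j) → det M ≈ det N
  det-cong {zero}  e = refl
  det-cong {suc n} e = sum-cong λ j → *-congˡ {sign j}
    (*-cong (e zero j) (det-cong λ i k → e (suc i) (punchIn j k)))

  det-rowScale : ∀ {n} (c : Fin n → Carrier) M → det (λ i j → c i * M i j) ≈ product c * det M
  det-rowScale {zero}  c M = sym (*-identityˡ _)
  det-rowScale {suc n} c M = begin
    det (λ i j → c i * M i j)
      ≈⟨ sum-cong (λ j → trans (*-congˡ (*-congˡ (det-rowScale (c ∘ suc) λ i k → M (suc i) (punchIn j k))))
           (rearrange (sign j) (c zero) (M zero j) (product (c ∘ suc)) _)) ⟩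
    sum (λ j → product c * (sign j * (M zero j * det λ i k → M (suc i) (punchIn j k))))
      ≈⟨ *-distribˡ-sum (product c) (λ j → sign j * (M zero j * det λ i k → M (suc i) (punchIn j k))) ⟨
    product c * det M
      ∎
    where
    rearrange : ∀ s c m p d → s * ((c * m) * (p * d)) ≈ (c * p) * (s * (m * d))
    rearrange = solve 5 (λ s c m p d → s :* ((c :* m) :* (p :* d)) := (c :* p) :* (s :* (m :* d))) refl

  det-columnScale : ∀ {n} (c : Fin n → Carrier) M → det (λ i j → M i j * c j) ≈ product c * det M
  det-columnScale {zero}  c M = sym (*-identityˡ _)
  det-columnScale {suc n} c M = begin
    det (λ i j → M i j * c j)
      ≈⟨ sum-cong (λ j → trans (*-congˡ (*-congˡ (det-columnScale (c ∘ punchIn j) λ i k → M (suc i) (punchIn j k))))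
           (trans (rearrange (sign j) (c j) (M zero j) (product (c ∘ punchIn j)) _)
                  (*-congʳ (sym (product-remove {i = j} c))))) ⟩
    sum (λ j → product c * (sign j * (M zero j * det λ i k → M (suc i) (punchIn j k))))
      ≈⟨ *-distribˡ-sum (product c) (λ j → sign j * (M zero j * det λ i k → M (suc i) (punchIn j k))) ⟨
    product c * det M
      ∎
    where
    rearrange : ∀ s c m p d → s * ((m * c) * (p * d)) ≈ (c * p) * (s * (m * d))
    rearrange = solve 5 (λ s c m p d → s :* ((m :* c) :* (p :* d)) := (c :* p) :* (s :* (m :* d))) refl

  -- The corner term is common to both expansions. In every other term of the first-row expansion
  -- the minor is expanded along its first column by induction; after exchanging the two sums, the
  -- factor -1 of `sign (suc j)` passes to `sign (suc i)`.
  det-firstColumn : ∀ {n} (M : Fin (suc n) → Fin (suc n) → Carrier) →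
    det M ≈ sum λ i → sign i * (M i zero * det λ k j → M (punchIn i k) (suc j))
  det-firstColumn {zero}  M = refl
  det-firstColumn {suc n} M = +-congˡ (begin
    sum (λ j → sign (suc j) * (M zero (suc j) * det λ i k → M (suc i) (punchIn (suc j) k)))
      ≈⟨ sum-cong (λ j → trans (*-congˡ (*-congˡ (det-firstColumn λ i k → M (suc i) (punchIn (suc j) k))))
           (distribute (sign (suc j)) (M zero (suc j)) λ i → sign i * (M (suc i) zero * minor i j))) ⟩
    sum (λ j → sum λ i → sign (suc j) * (M zero (suc j) * (sign i * (M (suc i) zero * minor i j))))
      ≈⟨ ∑-comm (λ j i → sign (suc j) * (M zero (suc j) * (sign i * (M (suc i) zero * minor i j)))) ⟩
    sum (λ i → sum λ j → sign (suc j) * (M zero (suc j) * (sign i * (M (suc i) zero * minor i j))))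
      ≈⟨ sum-cong (λ i → sum-cong λ j → rearrange (- 1#) (sign j) (M zero (suc j)) (sign i) (M (suc i) zero) (minor i j)) ⟩
    sum (λ i → sum λ j → sign (suc i) * (M (suc i) zero * (sign j * (M zero (suc j) * minor i j))))
      ≈⟨ sum-cong (λ i → distribute (sign (suc i)) (M (suc i) zero) λ j → sign j * (M zero (suc j) * minor i j)) ⟨
    sum (λ i → sign (suc i) * (M (suc i) zero * det λ k j → M (punchIn (suc i) k) (suc j)))
      ∎)
    where
    minor : Fin (suc n) → Fin (suc n) → Carrier
    minor i j = det λ k l → M (suc (punchIn i k)) (suc (punchIn j l))
    distribute : ∀ s m (f : Fin (suc n) → Carrier) → s * (m * sum f) ≈ sum λ i → s * (m * f i)
    distribute s m f = trans (*-congˡ (*-distribˡ-sum m f)) (*-distribˡ-sum s (λ i → m * f i))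
    rearrange : ∀ e s m t l d → (e * s) * (m * (t * (l * d))) ≈ (e * t) * (l * (s * (m * d)))
    rearrange = solve 6 (λ e s m t l d → (e :* s) :* (m :* (t :* (l :* d))) := (e :* t) :* (l :* (s :* (m :* d)))) refl

  det-transpose : ∀ {n} (M : Fin n → Fin n → Carrier) → det (λ i j → M j i) ≈ det M
  det-transpose {zero}  M = refl
  det-transpose {suc n} M = trans
    (sum-cong {f = λ i → sign i * (M i zero * det λ j k → M (punchIn i k) (suc j))} λ i → *-congˡ {sign i} (*-congˡ {M i zero}
      (det-transpose λ k j → M (punchIn i k) (suc j))))
    (sym (det-firstColumn M))

  det-zeroFirstColumn : ∀ {n} (M : Fin (suc n) → Fin (suc n) → Carrier) → (∀ i → M i zero ≈ 0#) → det M ≈ 0#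
  det-zeroFirstColumn M e = trans (det-firstColumn M)
    (sum≈0 {f = λ i → sign i * (M i zero * det λ k j → M (punchIn i k) (suc j))} λ i →
      trans (*-congˡ (trans (*-congʳ (e i)) (zeroˡ _))) (zeroʳ _))

  -- The expansion of a determinant along its first two rows v and w; the
  -- minor on the columns f is G f.
  laplace₂ : ∀ {n} → (Fin (suc (suc n)) → Carrier) → (Fin (suc (suc n)) → Carrier) →
             ((Fin n → Fin (suc (suc n))) → Carrier) → Carrier
  laplace₂ v w G = sum λ j → sign j * (v j * sum λ k → sign k * (w (punchIn j k) * G (λ c → punchIn j (punchIn k c))))

  private
    lift : ∀ {m n} → (Fin m → Fin n) → Fin (suc m) → Fin (suc n)
    lift f zero    = zero
    lift f (suc c) = suc (f c)

    -- Different compositions of `punchIn` select the same columns, but only pointwise. Function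
    -- extensionality is replaced by this condition on the family of minors.
    Congruent : ∀ {m n} → ((Fin m → Fin n) → Carrier) → Set
    Congruent G = ∀ {f g} → (∀ i → f i ≡ g i) → G f ≈ G g

    -- The terms in which both of the deleted columns are positive.
    inner : ∀ {n} → (Fin (suc (suc n)) → Carrier) → (Fin (suc (suc n)) → Carrier) →
            ((Fin n → Fin (suc (suc n))) → Carrier) → Carrier
    inner v w G = sum λ j → sign j * (v (suc j) * sum λ k → sign k * (w (suc (punchIn j k)) * G (λ c → punchIn (suc j) (punchIn (suc k) c))))

    outer : ∀ {n} → (Fin (suc (suc n)) → Carrier) → ((Fin n → Fin (suc (suc n))) → Carrier) → Carrier
    outer w G = sum λ k → sign k * (w (suc k) * G (λ c → suc (punchIn k c)))

    -- The terms are sorted by whether column 0 is taken by v, by w or by neither. If w takes it, v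
    -- takes a column `suc j`, whose sign carries an additional -1; hence the difference of the two
    -- outer sums.
    laplace₂-split : ∀ {n} v w (G : (Fin n → Fin (suc (suc n))) → Carrier) →
                     laplace₂ v w G ≈ (v zero * outer w G - w zero * outer v G) + inner v w G
    laplace₂-split {n} v w G = begin
      1# * (v zero * outer w G) + sum (λ j → sign (suc j) * (v (suc j) * (1# * (w zero * g j) + sum λ k → sign (suc k) * h j k)))
        ≈⟨ +-cong (*-identityˡ _) (sum-cong λ j → trans
             (*-congˡ {sign (suc j)} (*-congˡ {v (suc j)} (+-congˡ {1# * (w zero * g j)} (trans
                (sum-cong λ k → *-assoc (- 1#) (sign k) (h j k))
                (sym (*-distribˡ-sum (- 1#) (λ k → sign k * h j k)))))))
             (rearrange (sign j) (v (suc j)) (w zero) (g j) (sum λ k → sign k * h j k))) ⟩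
      v zero * outer w G + sum (λ j → sign j * (v (suc j) * sum (λ k → sign k * h j k)) + (- w zero) * (sign j * (v (suc j) * g j)))
        ≈⟨ +-congˡ (sum-linear (- w zero) (λ j → sign j * (v (suc j) * sum λ k → sign k * h j k)) (λ j → sign j * (v (suc j) * g j))) ⟩
      v zero * outer w G + (inner v w G + (- w zero) * outer v G)
        ≈⟨ solve 5 (λ a b c d e → a :* b :+ (e :+ (:- c) :* d) := (a :* b :- c :* d) :+ e) refl (v zero) (outer w G) (w zero) (outer v G) (inner v w G) ⟩
      (v zero * outer w G - w zero * outer v G) + inner v w G
        ∎
      where
      g : Fin (suc n) → Carrier
      g j = G (λ c → suc (punchIn j c))
      h : Fin (suc n) → Fin n → Carrier
      h j k = w (suc (punchIn j k)) * G (λ c → punchIn (suc j) (punchIn (suc k) c))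
      rearrange : ∀ s v w g t → (- 1# * s) * (v * (1# * (w * g) + - 1# * t)) ≈ s * (v * t) + (- w) * (s * (v * g))
      rearrange = solve 5 (λ s v w g t → (:- :1 :* s) :* (v :* (:1 :* (w :* g) :+ :- :1 :* t)) := s :* (v :* t) :+ (:- w) :* (s :* (v :* g))) refl

    inner-laplace₂ : ∀ {n} v w (G : (Fin (suc n) → Fin (suc (suc (suc n)))) → Carrier) → Congruent G →
                     inner v w G ≈ laplace₂ (v ∘ suc) (w ∘ suc) (G ∘ lift)
    inner-laplace₂ {n} v w G G-cong = sum-cong
      {f = λ j → sign j * (v (suc j) * sum λ k → term j k)} {g = λ j → sign j * (v (suc j) * sum λ k → term′ j k)}
      λ j → *-congˡ {sign j} (*-congˡ {v (suc j)} (sum-cong {f = term j} {g = term′ j}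
        λ k → *-congˡ {sign k} (*-congˡ {w (suc (punchIn j k))} (G-cong λ { zero → ≡.refl ; (suc c) → ≡.refl }))))
      where
      term term′ : Fin (suc (suc n)) → Fin (suc n) → Carrier
      term  j k = sign k * (w (suc (punchIn j k)) * G (λ c → punchIn (suc j) (punchIn (suc k) c)))
      term′ j k = sign k * (w (suc (punchIn j k)) * G (lift (λ c → punchIn j (punchIn k c))))

    lift-cong : ∀ {m n} {f g : Fin m → Fin n} → (∀ i → f i ≡ g i) → ∀ i → lift f i ≡ lift g i
    lift-cong e zero    = ≡.refl
    lift-cong e (suc i) = ≡.cong suc (e i)

  -- For v = w the two outer sums cancel, and the inner one is the same expansion on one column
  -- less. No division by 2 occurs, so this holds in every commutative ring.
  laplace₂-diagonal : ∀ {n} v (G : (Fin n → Fin (suc (suc n))) → Carrier) → Congruent G → laplace₂ v v G ≈ 0#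
  laplace₂-diagonal {zero}  v G G-cong = trans (laplace₂-split v v G)
    (trans (+-cong (-‿inverseʳ _) (trans (+-identityʳ _) (trans (*-identityˡ _) (zeroʳ (v (suc zero)))))) (+-identityʳ _))
  laplace₂-diagonal {suc n} v G G-cong = trans (laplace₂-split v v G)
    (trans (+-cong (-‿inverseʳ _) (trans (inner-laplace₂ v v G G-cong)
      (laplace₂-diagonal (v ∘ suc) (G ∘ lift) (G-cong ∘ lift-cong)))) (+-identityʳ _))

  laplace₂-linearˡ : ∀ {n} c u v w (G : (Fin n → Fin (suc (suc n))) → Carrier) →
                     laplace₂ (λ j → u j + c * v j) w G ≈ laplace₂ u w G + c * laplace₂ v w G
  laplace₂-linearˡ {n} c u v w G = trans
    (sum-cong {g = λ j → term u j + c * term v j} λ j →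
      solve 5 (λ s u c v t → s :* ((u :+ c :* v) :* t) := s :* (u :* t) :+ c :* (s :* (v :* t))) refl
        (sign j) (u j) c (v j) (rest j))
    (sum-linear c (term u) (term v))
    where
    rest : Fin (suc (suc n)) → Carrier
    rest j = sum λ k → sign k * (w (punchIn j k) * G (λ c → punchIn j (punchIn k c)))
    term : (Fin (suc (suc n)) → Carrier) → Fin (suc (suc n)) → Carrier
    term u j = sign j * (u j * rest j)

  laplace₂-linearʳ : ∀ {n} c u v w (G : (Fin n → Fin (suc (suc n))) → Carrier) →
                     laplace₂ w (λ j → u j + c * v j) G ≈ laplace₂ w u G + c * laplace₂ w v G
  laplace₂-linearʳ {n} c u v w G = trans
    (sum-cong {f = λ j → sign j * (w j * sum (term (λ j → u j + c * v j) j))} {g = λ j → term′ u j + c * term′ v j} λ j → trans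
      (*-congˡ {sign j} (*-congˡ {w j} (trans
        (sum-cong {f = term (λ j → u j + c * v j) j} {g = λ k → term u j k + c * term v j k} λ k →
          solve 5 (λ s u c v t → s :* ((u :+ c :* v) :* t) := s :* (u :* t) :+ c :* (s :* (v :* t))) refl
            (sign k) (u (punchIn j k)) c (v (punchIn j k)) (G (λ c → punchIn j (punchIn k c))))
        (sum-linear c (term u j) (term v j)))))
      (solve 5 (λ s w a c b → s :* (w :* (a :+ c :* b)) := s :* (w :* a) :+ c :* (s :* (w :* b))) refl
        (sign j) (w j) (sum (term u j)) c (sum (term v j))))
    (sum-linear c (term′ u) (term′ v))
    where
    term : (Fin (suc (suc n)) → Carrier) → Fin (suc (suc n)) → Fin (suc n) → Carrier
    term u j k = sign k * (u (punchIn j k) * G (λ c → punchIn j (punchIn k c)))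
    term′ : (Fin (suc (suc n)) → Carrier) → Fin (suc (suc n)) → Carrier
    term′ u j = sign j * (w j * sum (term u j))

  -- Polarisation: a bilinear form that vanishes on the diagonal is alternating, as its value at (v
  -- + w, v + w) shows.
  laplace₂-swap : ∀ {n} v w (G : (Fin n → Fin (suc (suc n))) → Carrier) → Congruent G →
                  laplace₂ v w G ≈ - laplace₂ w v G
  laplace₂-swap v w G G-cong = +-inverseˡ-unique _ _ (begin
    laplace₂ v w G + laplace₂ w v G
      ≈⟨ solve 4 (λ a b c d → b :+ c := ((a :+ :1 :* c) :+ :1 :* (b :+ :1 :* d)) :- a :- d) refl
           (laplace₂ v v G) (laplace₂ v w G) (laplace₂ w v G) (laplace₂ w w G) ⟩
    ((laplace₂ v v G + 1# * laplace₂ w v G) + 1# * (laplace₂ v w G + 1# * laplace₂ w w G)) - laplace₂ v v G - laplace₂ w w G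
      ≈⟨ +-cong (+-cong (+-cong (laplace₂-linearˡ 1# v w v G) (*-congˡ (laplace₂-linearˡ 1# v w w G))) refl) refl ⟨
    (laplace₂ u v G + 1# * laplace₂ u w G) - laplace₂ v v G - laplace₂ w w G
      ≈⟨ +-congʳ (+-congʳ (laplace₂-linearʳ 1# v w u G)) ⟨
    laplace₂ u u G - laplace₂ v v G - laplace₂ w w G
      ≈⟨ +-cong (+-cong (laplace₂-diagonal u G G-cong) (-‿cong (laplace₂-diagonal v G G-cong))) (-‿cong (laplace₂-diagonal w G G-cong)) ⟩
    0# - 0# - 0#
      ≈⟨ solve 0 (:0 :- :0 :- :0 := :0) refl ⟩
    0#
      ∎)
    where
    u : Fin _ → Carrier
    u j = v j + 1# * w j

  infixr 5 _◂_
  _◂_ : ∀ {n} → (Fin n → Carrier) → ∀ {m} → (Fin m → Fin n → Carrier) → Fin (suc m) → Fin n → Carrier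
  (v ◂ N) zero    = v
  (v ◂ N) (suc i) = N i

  -- The row below v is restored by linearity, since the expansion with v twice vanishes. To reach
  -- the remaining rows it is swapped above v: expanding along it leaves minors with first row v, to
  -- which the induction applies.
  det-rowUpdate : ∀ {n} (v : Fin (suc n) → Carrier) N (c : Fin n → Carrier) →
                  det (v ◂ λ i j → N i j + c i * v j) ≈ det (v ◂ N)
  det-rowUpdate {zero}  v N c = refl
  det-rowUpdate {suc n} v N c = begin
    laplace₂ v (λ j → N zero j + c zero * v j) G
      ≈⟨ laplace₂-linearʳ (c zero) (N zero) v v G ⟩
    laplace₂ v (N zero) G + c zero * laplace₂ v v G
      ≈⟨ +-congˡ (trans (*-congˡ (laplace₂-diagonal v G G-cong)) (zeroʳ _)) ⟩
    laplace₂ v (N zero) G + 0#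
      ≈⟨ +-identityʳ _ ⟩
    laplace₂ v (N zero) G
      ≈⟨ laplace₂-swap v (N zero) G G-cong ⟩
    - laplace₂ (N zero) v G
      ≈⟨ -‿cong (sum-cong {f = λ j → sign j * (N zero j * det (updated j))} λ j → *-congˡ {sign j} (*-congˡ {N zero j}
           (det-rowUpdate (v ∘ punchIn j) (λ i k → N (suc i) (punchIn j k)) (c ∘ suc)))) ⟩
    - laplace₂ (N zero) v G′
      ≈⟨ laplace₂-swap v (N zero) G′ G′-cong ⟨
    laplace₂ v (N zero) G′
      ∎
    where
    updated : Fin (suc (suc n)) → Fin (suc n) → Fin (suc n) → Carrier
    updated j = (v ∘ punchIn j) ◂ λ i k → N (suc i) (punchIn j k) + c (suc i) * v (punchIn j k)
    G G′ : (Fin n → Fin (suc (suc n))) → Carrier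
    G  f = det λ i k → N (suc i) (f k) + c (suc i) * v (f k)
    G′ f = det λ i k → N (suc i) (f k)
    G-cong : Congruent G
    G-cong e = det-cong λ i k → reflexive (≡.cong (λ l → N (suc i) l + c (suc i) * v l) (e k))
    G′-cong : Congruent G′
    G′-cong e = det-cong λ i k → reflexive (≡.cong (N (suc i)) (e k))

  -- Subtracting `N i zero` times the row of ones clears the first column below its top entry. In
  -- the expansion along the first row all minors but the first retain this zero column.
  det-firstRowOnes : ∀ {n} (N : Fin n → Fin (suc n) → Carrier) →
                     det ((λ _ → 1#) ◂ N) ≈ det (λ i j → N i (suc j) - N i zero)
  det-firstRowOnes {zero}  N = solve 0 (:1 :* (:1 :* :1) :+ :0 := :1) refl
  det-firstRowOnes {suc n} N = begin
    det ((λ _ → 1#) ◂ N)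
      ≈⟨ det-rowUpdate (λ _ → 1#) N (λ i → - N i zero) ⟨
    1# * (1# * det (λ i j → N i (suc j) + - N i zero * 1#)) + sum (λ j → sign (suc j) * (1# * det λ i k → N i (punchIn (suc j) k) + - N i zero * 1#))
      ≈⟨ +-cong (trans (*-identityˡ _) (trans (*-identityˡ _)
             (det-cong {M = λ i j → N i (suc j) + - N i zero * 1#} λ i j → +-congˡ (*-identityʳ _))))
           (sum≈0 {f = λ j → sign (suc j) * (1# * det (minor j))} λ j →
             trans (*-congˡ {sign (suc j)} (trans (*-identityˡ _) (det-zeroFirstColumn (minor j) λ i →
               trans (+-congˡ (*-identityʳ _)) (-‿inverseʳ (N i zero))))) (zeroʳ _)) ⟩
    det (λ i j → N i (suc j) - N i zero) + 0#
      ≈⟨ +-identityʳ _ ⟩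
    det (λ i j → N i (suc j) - N i zero)
      ∎
    where
    minor : Fin (suc n) → Fin (suc n) → Fin (suc n) → Carrier
    minor j i k = N i (punchIn (suc j) k) + - N i zero * 1#

  vandermonde-suc : ∀ {n} (x : Fin (suc n) → Carrier) →
                    vandermonde x ≈ product (λ j → x zero - x (suc j)) * vandermonde (x ∘ suc)
  vandermonde-suc {n} x = *-cong (*-identityˡ _) (product-cong {n} λ i → *-identityˡ _)

  vandermonde-cong : ∀ {n} {x y : Fin n → Carrier} → (∀ i → x i ≈ y i) → vandermonde x ≈ vandermonde y
  vandermonde-cong {zero}  e = refl
  vandermonde-cong {suc n} {x} {y} e = begin
    vandermonde x
      ≈⟨ vandermonde-suc x ⟩
    product (λ j → x zero - x (suc j)) * vandermonde (x ∘ suc)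
      ≈⟨ *-cong (product-cong {n} λ j → +-cong (e zero) (-‿cong (e (suc j)))) (vandermonde-cong (e ∘ suc)) ⟩
    product (λ j → y zero - y (suc j)) * vandermonde (y ∘ suc)
      ≈⟨ vandermonde-suc y ⟨
    vandermonde y
      ∎

  -- Here `g i j` plays the role of 1 / (1 - xᵢ yⱼ) and enters through its defining equation, which
  -- avoids fractions. Subtracting the first row from the others splits off xᵢ - x₀ from the rows
  -- and g₀ⱼ from the columns; a row of ones remains, which permits the same with the first column
  -- and leads to size n.
  cauchy : ∀ {n} (x y : Fin n → Carrier) (g : Fin n → Fin n → Carrier) →
           (∀ i j → (1# - x i * y j) * g i j ≈ 1#) →
           det g ≈ (vandermonde x * vandermonde y) * product λ i → product λ j → g i j
  cauchy {zero}  x y g e = solve 0 (:1 := (:1 :* :1) :* :1) refl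
  cauchy {suc n} x y g e = begin
    det g
      ≈⟨ det-cong subtractFirstRow ⟩
    det (g zero ◂ λ i j → (x (suc i) - x zero) * (y j * g (suc i) j) * g zero j + 1# * g zero j)
      ≈⟨ det-rowUpdate (g zero) (λ i j → (x (suc i) - x zero) * (y j * g (suc i) j) * g zero j) (λ _ → 1#) ⟩
    det (g zero ◂ λ i j → (x (suc i) - x zero) * (y j * g (suc i) j) * g zero j)
      ≈⟨ det-cong scaledRows ⟩
    det (λ i j → ((λ _ → 1#) ◂ N) i j * g zero j)
      ≈⟨ det-columnScale (g zero) ((λ _ → 1#) ◂ N) ⟩
    product (g zero) * det ((λ _ → 1#) ◂ N)
      ≈⟨ *-congˡ (trans (det-firstRowOnes N) (det-cong subtractFirstColumn)) ⟩
    product (g zero) * det (λ i j → ((x zero - x (suc i)) * g (suc i) zero) * (g (suc i) (suc j) * (y zero - y (suc j))))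
      ≈⟨ *-congˡ (trans (det-rowScale (λ i → (x zero - x (suc i)) * g (suc i) zero) (λ i j → g (suc i) (suc j) * (y zero - y (suc j))))
           (*-cong (product-* (λ i → x zero - x (suc i)) (λ i → g (suc i) zero))
              (trans (det-columnScale (λ j → y zero - y (suc j)) (λ i j → g (suc i) (suc j)))
                (*-congˡ (cauchy (x ∘ suc) (y ∘ suc) (λ i j → g (suc i) (suc j)) λ i j → e (suc i) (suc j)))))) ⟩
    product (g zero) * ((Πx * product (λ i → g (suc i) zero)) * (Πy * ((Vx * Vy) * product (λ i → product λ j → g (suc i) (suc j)))))
      ≈⟨ solve 7 (λ p a b c u v w → p :* ((a :* b) :* (c :* ((u :* v) :* w))) := ((a :* u) :* (c :* v)) :* (p :* (b :* w))) refl
           (product (g zero)) Πx (product (λ i → g (suc i) zero)) Πy Vx Vy _ ⟩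
    ((Πx * Vx) * (Πy * Vy)) * (product (g zero) * (product (λ i → g (suc i) zero) * product (λ i → product λ j → g (suc i) (suc j))))
      ≈⟨ *-cong (*-cong (vandermonde-suc x) (vandermonde-suc y)) (*-congˡ (product-* (λ i → g (suc i) zero) (λ i → product λ j → g (suc i) (suc j)))) ⟨
    (vandermonde x * vandermonde y) * product (λ i → product λ j → g i j)
      ∎
    where
    Πx Πy Vx Vy : Carrier
    Πx = product λ i → x zero - x (suc i)
    Πy = product λ j → y zero - y (suc j)
    Vx = vandermonde (x ∘ suc)
    Vy = vandermonde (y ∘ suc)
    N : Fin n → Fin (suc n) → Carrier
    N i j = (x (suc i) - x zero) * (y j * g (suc i) j)
    difference : ∀ i k j → g i j ≈ (x i - x k) * (y j * g i j) * g k j + g k j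
    difference i k j = begin
      g i j
        ≈⟨ solve 2 (λ g h → g := g :* :1 :+ h :- h :* :1) refl (g i j) (g k j) ⟩
      g i j * 1# + g k j - g k j * 1#
        ≈⟨ +-cong (+-congʳ (*-congˡ (e k j))) (-‿cong (*-congˡ (e i j))) ⟨
      g i j * ((1# - x k * y j) * g k j) + g k j - g k j * ((1# - x i * y j) * g i j)
        ≈⟨ solve 5 (λ g h x z y → g :* ((:1 :- z :* y) :* h) :+ h :- h :* ((:1 :- x :* y) :* g) := (x :- z) :* (y :* g) :* h :+ h) refl
             (g i j) (g k j) (x i) (x k) (y j) ⟩
      (x i - x k) * (y j * g i j) * g k j + g k j
        ∎
    subtractFirstRow : ∀ i j → g i j ≈ (g zero ◂ λ i j → (x (suc i) - x zero) * (y j * g (suc i) j) * g zero j + 1# * g zero j) i j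
    subtractFirstRow zero    j = refl
    subtractFirstRow (suc i) j = trans (difference (suc i) zero j) (+-congˡ (sym (*-identityˡ _)))
    scaledRows : ∀ i j → (g zero ◂ λ i j → (x (suc i) - x zero) * (y j * g (suc i) j) * g zero j) i j ≈ ((λ _ → 1#) ◂ N) i j * g zero j
    scaledRows zero    j = sym (*-identityˡ _)
    scaledRows (suc i) j = refl
    subtractFirstColumn : ∀ i j → N i (suc j) - N i zero ≈ ((x zero - x (suc i)) * g (suc i) zero) * (g (suc i) (suc j) * (y zero - y (suc j)))
    subtractFirstColumn i j = begin
      (X - x zero) * (y (suc j) * g₁) - (X - x zero) * (y zero * g₀)
        ≈⟨ solve 6 (λ X x y₁ g₁ y₀ g₀ → (X :- x) :* (y₁ :* g₁) :- (X :- x) :* (y₀ :* g₀) := (X :- x) :* ((y₁ :* g₁) :* :1 :- (y₀ :* g₀) :* :1)) refl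
             X (x zero) (y (suc j)) g₁ (y zero) g₀ ⟩
      (X - x zero) * ((y (suc j) * g₁) * 1# - (y zero * g₀) * 1#)
        ≈⟨ *-congˡ (+-cong (*-congˡ (e (suc i) zero)) (-‿cong (*-congˡ (e (suc i) (suc j))))) ⟨
      (X - x zero) * ((y (suc j) * g₁) * ((1# - X * y zero) * g₀) - (y zero * g₀) * ((1# - X * y (suc j)) * g₁))
        ≈⟨ solve 6 (λ X x y₁ g₁ y₀ g₀ → (X :- x) :* ((y₁ :* g₁) :* ((:1 :- X :* y₀) :* g₀) :- (y₀ :* g₀) :* ((:1 :- X :* y₁) :* g₁)) := ((x :- X) :* g₀) :* (g₁ :* (y₀ :- y₁))) refl
             X (x zero) (y (suc j)) g₁ (y zero) g₀ ⟩
      ((x zero - X) * g₀) * (g₁ * (y zero - y (suc j)))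
        ∎
      where
      X g₀ g₁ : Carrier
      X = x (suc i)
      g₀ = g (suc i) zero
      g₁ = g (suc i) (suc j)

∘-hom : ∀ {A B C : Ring} {f : ∣ A ∣ → ∣ B ∣} {g : ∣ B ∣ → ∣ C ∣} → Hom B C g → Hom A B f → Hom A C (g ∘ f)
∘-hom {C = C} G F = record
  { additive = record
    { cong   = G.cong ∘ F.cong
    ; +-homo = λ x y → trans (G.cong (F.+-homo x y)) (G.+-homo _ _)
    }
  ; *-homo = λ x y → trans (G.cong (F.*-homo x y)) (G.*-homo _ _)
  ; 1-homo = trans (G.cong F.1-homo) G.1-homo
  }
  where
  module F = Hom F
  module G = Hom G
  open CommutativeRing C using (trans)

id-hom : ∀ {A : Ring} → Hom A A id
id-hom {A} = record
  { additive = record { cong = id ; +-homo = λ x y → refl }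
  ; *-homo = λ x y → refl
  ; 1-homo = refl
  }
  where open CommutativeRing A using (refl)

-- Formal power series

-- Bialternants are given by the equation f V = det M alone; regularity of V is what makes f
-- determined by it.
Regular : (R : Ring) → ∣ R ∣ → Set
Regular R c = ∀ f → c * f ≈ 0# → f ≈ 0#
  where open CommutativeRing R

module _ (R : Ring) where
  open CommutativeRing R hiding (zero)
  open RingOps R
  open import Algebra.Properties.Ring ring

  *-regular : ∀ {c d} → Regular R c → Regular R d → Regular R (c * d)
  *-regular p q f e = q f (p _ (trans (sym (*-assoc _ _ f)) e))

  1-regular : Regular R 1#
  1-regular f e = trans (sym (*-identityˡ f)) e

  regular-cong : ∀ {c d} → c ≈ d → Regular R c → Regular R d
  regular-cong e p f e′ = p f (trans (*-congʳ e) e′)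

  product-regular : ∀ {n} (c : Fin n → Carrier) → (∀ i → Regular R (c i)) → Regular R (product c)
  product-regular {zero}  c p = 1-regular
  product-regular {suc n} c p = *-regular (p zero) (product-regular (c ∘ suc) (p ∘ suc))

  regular-cancel : ∀ {c} → Regular R c → ∀ {f g} → c * f ≈ c * g → f ≈ g
  regular-cancel p {f} {g} e = x∙y⁻¹≈ε⇒x≈y f g (p (f - g)
    (trans (x[y-z]≈xy-xz _ f g) (trans (+-congʳ e) (-‿inverseʳ _))))

  vandermonde-regular : ∀ {n} (x : Fin n → Carrier) →
    (∀ {i j} → toℕ i ℕ.< toℕ j → Regular R (x i - x j)) → Regular R (vandermonde x)
  vandermonde-regular {zero}  x p = 1-regular
  vandermonde-regular {suc n} x p = regular-cong (sym (Determinant.vandermonde-suc R x))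
    (*-regular (product-regular (λ j → x zero - x (suc j)) λ j → p (s≤s z≤n))
               (vandermonde-regular (x ∘ suc) (p ∘ s≤s)))

module Series (R : Ring) where
  open CommutativeRing R hiding (zero)
  open RingOps R
  open PowerSeries R
  open Determinant R using (sum-cong)
  open import Algebra.Properties.CommutativeMonoid.Sum +-commutativeMonoid using (∑-distrib-+; sum-replicate)
  open import Algebra.Properties.Semiring.Mult semiring using (×-homo-+; ×-assoc-*; ×-comm-*; ×-congʳ) renaming (_×_ to _⋆_)
  open import Algebra.Properties.Semiring.Sum semiring using (*-distribˡ-sum)
  open import Algebra.Properties.Semiring.Exp semiring using (^-homo-*)
  open import Algebra.Properties.Ring ring
  open import Relation.Binary.Reasoning.Setoid setoid
  module P = CommutativeRing powerSeriesRing

  constant-hom : Hom R powerSeriesRing constant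
  constant-hom = record
    { additive = record
      { cong   = constant-cong
      ; +-homo = λ { c d zero → refl ; c d (suc k) → sym (+-identityˡ 0#) }
      }
    ; *-homo = constant-*
    ; 1-homo = λ k → refl
    }

  evaluate₀-hom : Hom powerSeriesRing R (λ f → f 0)
  evaluate₀-hom = record
    { additive = record { cong = λ e → e 0 ; +-homo = λ f g → refl }
    ; *-homo   = ⊛-zero
    ; 1-homo   = refl
    }

  indeterminate-regular : Regular powerSeriesRing indeterminate
  indeterminate-regular f e k = trans (sym (indeterminate-⊛ f k)) (e (suc k))

  constant-regular : ∀ {c} → Regular R c → Regular powerSeriesRing (constant c)
  constant-regular {c} p f e k = p (f k) (trans (sym (constant-⊛ c f k)) (e k))

  -- No nonzero element is divisible by every power of c in a compatible way.
  Separated : Carrier → Set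
  Separated c = ∀ (f : ℕ → Carrier) → (∀ k → f k ≈ c * f (suc k)) → ∀ k → f k ≈ 0#

  indeterminate-zero : ∀ f → (indeterminate ⊛ f) 0 ≈ 0#
  indeterminate-zero f = trans (⊛-zero indeterminate f) (zeroˡ _)

  -- If (t - c) f = 0 then f_k = c f_{k+1} for all k.
  indeterminate-constant-regular : ∀ {c} → Separated c → Regular powerSeriesRing (indeterminate P.- constant c)
  indeterminate-constant-regular {c} sep f e = sep f λ k → begin
    f k
      ≈⟨ trans (+-assoc _ _ _) (trans (+-congˡ (-‿inverseˡ _)) (+-identityʳ _)) ⟨
    (f k - c * f (suc k)) + c * f (suc k)
      ≈⟨ +-congʳ (+-cong (indeterminate-⊛ f k) (-‿cong (constant-⊛ c f (suc k)))) ⟨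
    ((indeterminate ⊛ f) (suc k) - (constant c ⊛ f) (suc k)) + c * f (suc k)
      ≈⟨ +-congʳ (trans (sym (expand k)) (e (suc k))) ⟩
    0# + c * f (suc k)
      ≈⟨ +-identityˡ _ ⟩
    c * f (suc k)
      ∎
    where
    expand : ∀ k → ((indeterminate P.- constant c) ⊛ f) (suc k) ≈ (indeterminate ⊛ f) (suc k) - (constant c ⊛ f) (suc k)
    expand k = P.trans {(indeterminate P.- constant c) ⊛ f} (⊛-distribʳ f indeterminate (P.- constant c))
      (P.+-cong {indeterminate ⊛ f} (λ _ → refl) (λ k → sym (P-‿distribˡ-* (constant c) f k))) (suc k)
      where open import Algebra.Properties.Ring P.ring using () renaming (-‿distribˡ-* to P-‿distribˡ-*)

  -- The Euler operator t d/dt, which is a derivation without shifting degrees.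
  θ : Series₁ → Series₁
  θ f k = k ⋆ f k

  θ-⊛ : ∀ f g → θ (f ⊛ g) ≋ θ f ⊛ g ⊕ f ⊛ θ g
  θ-⊛ f g k = begin
    k ⋆ sum {suc k} (λ i → f (toℕ i) * g (k ∸ toℕ i))
      ≈⟨ multiple (suc k) (λ i → f (toℕ i) * g (k ∸ toℕ i)) ⟩
    sum {suc k} (λ i → k ⋆ (f (toℕ i) * g (k ∸ toℕ i)))
      ≈⟨ sum-cong {suc k} product-rule ⟩
    sum {suc k} (λ i → (toℕ i ⋆ f (toℕ i)) * g (k ∸ toℕ i) + f (toℕ i) * ((k ∸ toℕ i) ⋆ g (k ∸ toℕ i)))
      ≈⟨ ∑-distrib-+ {suc k} (λ i → θ f (toℕ i) * g (k ∸ toℕ i)) (λ i → f (toℕ i) * θ g (k ∸ toℕ i)) ⟩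
    (θ f ⊛ g ⊕ f ⊛ θ g) k
      ∎
    where
    multiple : ∀ n (h : Fin n → Carrier) → k ⋆ sum h ≈ sum (λ i → k ⋆ h i)
    multiple n h = begin
      k ⋆ sum h              ≈⟨ ×-congʳ k (*-identityˡ (sum h)) ⟨
      k ⋆ (1# * sum h)       ≈⟨ ×-assoc-* k 1# _ ⟨
      (k ⋆ 1#) * sum h       ≈⟨ *-distribˡ-sum (k ⋆ 1#) h ⟩
      sum (λ i → (k ⋆ 1#) * h i) ≈⟨ sum-cong {n} (λ i → trans (×-assoc-* k 1# (h i)) (×-congʳ k (*-identityˡ (h i)))) ⟩
      sum (λ i → k ⋆ h i)    ∎
    product-rule : ∀ (i : Fin (suc k)) → k ⋆ (f (toℕ i) * g (k ∸ toℕ i)) ≈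
      (toℕ i ⋆ f (toℕ i)) * g (k ∸ toℕ i) + f (toℕ i) * ((k ∸ toℕ i) ⋆ g (k ∸ toℕ i))
    product-rule i = begin
      k ⋆ (f (toℕ i) * g (k ∸ toℕ i))
        ≡⟨ ≡.cong (_⋆ (f (toℕ i) * g (k ∸ toℕ i))) (ℕ.m+[n∸m]≡n (ℕ.s≤s⁻¹ (Fin.toℕ<n i))) ⟨
      (toℕ i ℕ.+ (k ∸ toℕ i)) ⋆ (f (toℕ i) * g (k ∸ toℕ i))
        ≈⟨ ×-homo-+ _ (toℕ i) (k ∸ toℕ i) ⟩
      toℕ i ⋆ (f (toℕ i) * g (k ∸ toℕ i)) + (k ∸ toℕ i) ⋆ (f (toℕ i) * g (k ∸ toℕ i))
        ≈⟨ +-cong (×-assoc-* (toℕ i) _ _) (×-comm-* (k ∸ toℕ i) _ _) ⟨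
      (toℕ i ⋆ f (toℕ i)) * g (k ∸ toℕ i) + f (toℕ i) * ((k ∸ toℕ i) ⋆ g (k ∸ toℕ i))
        ∎

  -- q = t f′ / f
  LogDerivative : Series₁ → Series₁ → Set
  LogDerivative f q = θ f ≋ q ⊛ f

  -- As q has no constant term, the coefficient at k + 1 of θ f = q f expresses (k + 1) f_{k+1} by
  -- f_0, ..., f_k. The induction is strong: the first argument of `agree` only bounds the index.
  logDerivative-unique : (∀ k → ∃ λ u → u * (suc k ⋆ 1#) ≈ 1#) → ∀ {q} → q 0 ≈ 0# →
    ∀ {f g} → LogDerivative f q → LogDerivative g q → f 0 ≈ g 0 → f ≋ g
  logDerivative-unique inverse {q} q₀ {f} {g} F G e k = agree k k ℕ.≤-refl
    where
    divide : ∀ k {x y} → suc k ⋆ x ≈ suc k ⋆ y → x ≈ y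
    divide k {x} {y} e = begin
      x                             ≈⟨ undo x ⟨
      proj₁ (inverse k) * (suc k ⋆ x) ≈⟨ *-congˡ e ⟩
      proj₁ (inverse k) * (suc k ⋆ y) ≈⟨ undo y ⟩
      y                             ∎
      where
      undo : ∀ x → proj₁ (inverse k) * (suc k ⋆ x) ≈ x
      undo x = begin
        proj₁ (inverse k) * (suc k ⋆ x)         ≈⟨ *-congˡ (trans (×-assoc-* (suc k) 1# x) (×-congʳ (suc k) (*-identityˡ x))) ⟨
        proj₁ (inverse k) * ((suc k ⋆ 1#) * x)  ≈⟨ *-assoc _ _ x ⟨
        (proj₁ (inverse k) * (suc k ⋆ 1#)) * x  ≈⟨ *-congʳ (proj₂ (inverse k)) ⟩
        1# * x                                  ≈⟨ *-identityˡ x ⟩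
        x                                       ∎
    agree : ∀ k j → j ≤ k → f j ≈ g j
    agree k       zero    _         = e
    agree (suc k) (suc j) (s≤s j≤k) = divide j (begin
      suc j ⋆ f (suc j)                        ≈⟨ F (suc j) ⟩
      q 0 * f (suc j) + (tail q ⊛ f) j         ≈⟨ +-congʳ (trans (*-congʳ q₀) (zeroˡ _)) ⟩
      0# + (tail q ⊛ f) j
        ≈⟨ +-congˡ (sum-cong {suc j} λ i → *-congˡ {q (suc (toℕ i))} (agree k (j ∸ toℕ i) (ℕ.≤-trans (ℕ.m∸n≤m j (toℕ i)) j≤k))) ⟩
      0# + (tail q ⊛ g) j                      ≈⟨ +-congʳ (trans (*-congʳ q₀) (zeroˡ _)) ⟨
      q 0 * g (suc j) + (tail q ⊛ g) j         ≈⟨ G (suc j) ⟨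
      suc j ⋆ g (suc j)                        ∎)

  θ-cong : ∀ {f g} → f ≋ g → θ f ≋ θ g
  θ-cong e k = ×-congʳ k (e k)

  θ-1 : θ (constant 1#) ≋ λ _ → 0#
  θ-1 zero    = refl
  θ-1 (suc k) = trans (sym (trans (×-comm-* (suc k) 0# 0#) (×-congʳ (suc k) (zeroˡ 0#)))) (zeroˡ _)

  open IntegerSolver powerSeriesRing using (solve; _:=_; _:*_; _:+_; _:-_; :-_; :1; :0)
  private module ≋ = SetoidReasoning P.setoid

  logDerivative-⊛ : ∀ {f g p q} → LogDerivative f p → LogDerivative g q →
                            LogDerivative (f ⊛ g) (p ⊕ q)
  logDerivative-⊛ {f} {g} {p} {q} F G = ≋.begin
    θ (f ⊛ g)                    ≋.≈⟨ θ-⊛ f g ⟩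
    θ f ⊛ g ⊕ f ⊛ θ g            ≋.≈⟨ P.+-cong {θ f ⊛ g} (⊛-cong {g = g} F (λ _ → refl)) (⊛-cong {f} (λ _ → refl) G) ⟩
    (p ⊛ f) ⊛ g ⊕ f ⊛ (q ⊛ g)    ≋.≈⟨ solve 4 (λ f g p q → (p :* f) :* g :+ f :* (q :* g) := (p :+ q) :* (f :* g)) (λ _ → refl) f g p q ⟩
    (p ⊕ q) ⊛ (f ⊛ g)            ≋.∎

  logDerivative-product : ∀ {n} (f q : Fin n → Series₁) → (∀ i → LogDerivative (f i) (q i)) →
    LogDerivative (RingOps.product powerSeriesRing f) (RingOps.sum powerSeriesRing q)
  logDerivative-product {zero}  f q e = P.trans {θ (constant 1#)} θ-1 (P.sym {(λ _ → 0#) ⊛ constant 1#} (0⊛ (constant 1#)))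
  logDerivative-product {suc n} f q e = logDerivative-⊛
    {f zero} {RingOps.product powerSeriesRing (f ∘ suc)} {q zero} {RingOps.sum powerSeriesRing (q ∘ suc)} (e zero) (logDerivative-product (f ∘ suc) (q ∘ suc) (e ∘ suc))

  linear : Carrier → Series₁
  linear c = P.1# P.- constant c ⊛ indeterminate

  linear-zero : ∀ c → linear c 0 ≈ 1#
  linear-zero c = trans (+-congˡ (-‿cong (trans (⊛-zero (constant c) indeterminate) (zeroʳ c))))
    (trans (+-congˡ -0#≈0#) (+-identityʳ _))

  linear-inverse : ∀ c → linear c ⊛ geometricSeries c ≋ P.1#
  linear-inverse = geometricSeries-inverse

  -- The series ct / (1 - ct), which is the logarithmic derivative of 1 / (1 - ct).
  positivePowers : Carrier → Series₁
  positivePowers c zero    = 0#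
  positivePowers c (suc k) = c ^ suc k

  geometricSeries-logDerivative : ∀ c → LogDerivative (geometricSeries c) (positivePowers c)
  geometricSeries-logDerivative c zero    = sym (trans (+-identityʳ _) (zeroˡ _))
  geometricSeries-logDerivative c (suc k) = sym (begin
    0# * c ^ suc k + sum {suc k} (λ i → c ^ suc (toℕ i) * c ^ (k ∸ toℕ i))
      ≈⟨ +-cong (zeroˡ _) (sum-cong {suc k} λ i → power i) ⟩
    0# + sum {suc k} (λ i → c ^ suc k)
      ≈⟨ +-identityˡ _ ⟩
    sum {suc k} (λ i → c ^ suc k)
      ≈⟨ sum-replicate (suc k) ⟩
    suc k ⋆ c ^ suc k
      ∎)
    where
    power : ∀ (i : Fin (suc k)) → c ^ suc (toℕ i) * c ^ (k ∸ toℕ i) ≈ c ^ suc k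
    power i = trans (sym (^-homo-* c (suc (toℕ i)) (k ∸ toℕ i)))
      (reflexive (≡.cong (λ m → c ^ suc m) (ℕ.m+[n∸m]≡n (ℕ.s≤s⁻¹ (Fin.toℕ<n i)))))

  -- Differentiate (1 - ct) · 1/(1 - ct) = 1.
  linear-logDerivative : ∀ c → LogDerivative (linear c) (P.- positivePowers c)
  linear-logDerivative c = ≋.begin
    θ l
      ≋.≈⟨ P.trans {θ l} (λ k → sym (P.*-identityʳ (θ l) k)) (P.*-congˡ {θ l} (P.sym {l ⊛ g} (linear-inverse c))) ⟩
    θ l ⊛ (l ⊛ g)
      -- The factor l g = 1 brings in θ l g + l q g, which is θ (l g) = 0 because θ g = q g; what is
      -- left is -q l.
      ≋.≈⟨ solve 4 (λ l g s q → s :* (l :* g) := l :* (s :* g :+ l :* (q :* g)) :- (q :* l) :* (l :* g)) (λ _ → refl) l g (θ l) q ⟩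
    (l ⊛ (θ l ⊛ g ⊕ l ⊛ (q ⊛ g))) P.- (q ⊛ l) ⊛ (l ⊛ g)
      ≋.≈⟨ P.+-cong {l ⊛ (θ l ⊛ g ⊕ l ⊛ (q ⊛ g))} (P.*-congˡ {l} vanishes)
            (P.-‿cong {(q ⊛ l) ⊛ (l ⊛ g)} (P.*-congˡ {q ⊛ l} (linear-inverse c))) ⟩
    (l ⊛ P.0#) P.- (q ⊛ l) ⊛ P.1#
      ≋.≈⟨ solve 2 (λ l q → l :* :0 :- (q :* l) :* :1 := (:- q) :* l) (λ _ → refl) l q ⟩
    (P.- q) ⊛ l
      ≋.∎
    where
    l g q : Series₁
    l = linear c
    g = geometricSeries c
    q = positivePowers c
    vanishes : θ l ⊛ g ⊕ l ⊛ (q ⊛ g) ≋ P.0#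
    vanishes = ≋.begin
      θ l ⊛ g ⊕ l ⊛ (q ⊛ g) ≋.≈⟨ P.+-congˡ {θ l ⊛ g} (P.*-congˡ {l} (geometricSeries-logDerivative c)) ⟨
      θ l ⊛ g ⊕ l ⊛ θ g     ≋.≈⟨ θ-⊛ l g ⟨
      θ (l ⊛ g)             ≋.≈⟨ θ-cong (linear-inverse c) ⟩
      θ P.1#                ≋.≈⟨ θ-1 ⟩
      P.0#                  ≋.∎

module _ (A B : Ring) where
  private
    module A = CommutativeRing A
    module B = CommutativeRing B
    module Â = PowerSeries A
    module B̂ = PowerSeries B

  map-additive : ∀ {f} → Additive A B f → Additive Â.powerSeriesRing B̂.powerSeriesRing (f ∘_)
  map-additive F = record { cong = λ e k → F.cong (e k) ; +-homo = λ s t k → F.+-homo (s k) (t k) }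
    where module F = Additive F

  map-hom : ∀ {f} → Hom A B f → Hom Â.powerSeriesRing B̂.powerSeriesRing (f ∘_)
  map-hom {f} F = record
    { additive = map-additive F.additive
    ; *-homo   = λ s t k → B.trans (F.sum-homo {suc k} λ i → s (toℕ i) A.* t (k ∸ toℕ i))
        (Determinant.sum-cong B {suc k} λ i → F.*-homo (s (toℕ i)) (t (k ∸ toℕ i)))
    ; 1-homo   = λ { zero → F.1-homo ; (suc k) → F.0-homo }
    }
    where module F = Hom F

  map-constant : ∀ {f} → Additive A B f → ∀ c → (f ∘ Â.constant c) B̂.≋ B̂.constant (f c)
  map-constant F c zero    = B.refl
  map-constant F c (suc k) = Additive.0-homo F

  map-indeterminate : ∀ {f} → Hom A B f → (f ∘ Â.indeterminate) B̂.≋ B̂.indeterminate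
  map-indeterminate F zero          = Hom.0-homo F
  map-indeterminate F (suc zero)    = Hom.1-homo F
  map-indeterminate F (suc (suc k)) = Hom.0-homo F

  map-geometricSeries : ∀ {f} → Hom A B f → ∀ c → (f ∘ Â.geometricSeries c) B̂.≋ B̂.geometricSeries (f c)
  map-geometricSeries F c k = Hom.^-homo F c k

-- Power series in several variables

module Multivariate (R : Ring) where
  open CommutativeRing R hiding (zero)
  open RingOps R
  open MultivariateSeries R
  open PowerSeries R using (Series₁; powerSeriesRing)
  private
    module S n = CommutativeRing (seriesRing n)
    module P n = PowerSeries (seriesRing n)
    module O n = RingOps (seriesRing n)

  scalar-hom : ∀ n → Hom R (seriesRing n) (scalar n)
  scalar-hom zero    = id-hom
  scalar-hom (suc n) = ∘-hom (Series.constant-hom (seriesRing n)) (scalar-hom n)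

  -- The substitution t ↦ xᵢ
  embed : ∀ n → Fin n → Series₁ → ∣ seriesRing n ∣
  embed (suc n) zero    f k = scalar n (f k)
  embed (suc n) (suc i) f   = P.constant n (embed n i f)

  embed-hom : ∀ n i → Hom powerSeriesRing (seriesRing n) (embed n i)
  embed-hom (suc n) zero    = map-hom R (seriesRing n) (scalar-hom n)
  embed-hom (suc n) (suc i) = ∘-hom (Series.constant-hom (seriesRing n)) (embed-hom n i)

  embed-constant : ∀ n i c → S._≈_ n (embed n i (PowerSeries.constant R c)) (scalar n c)
  embed-constant (suc n) zero    c = map-constant R (seriesRing n) (Hom.additive (scalar-hom n)) c
  embed-constant (suc n) (suc i) c = P.constant-cong n (embed-constant n i c)

  embed-indeterminate : ∀ n i → S._≈_ n (embed n i (PowerSeries.indeterminate R)) (x n i)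
  embed-indeterminate (suc n) zero    = map-indeterminate R (seriesRing n) (scalar-hom n)
  embed-indeterminate (suc n) (suc i) = P.constant-cong n (embed-indeterminate n i)

  embed-geometricSeries : ∀ n i c → S._≈_ n (embed n i (PowerSeries.geometricSeries R c)) (geometric n c i)
  embed-geometricSeries (suc n) zero    c = map-geometricSeries R (seriesRing n) (scalar-hom n) c
  embed-geometricSeries (suc n) (suc i) c = P.constant-cong n (embed-geometricSeries n i c)

  coefficient-additive : ∀ n α → Additive (seriesRing n) R (coefficient n α)
  coefficient-additive zero    []      = Hom.additive id-hom
  coefficient-additive (suc n) (k ∷ α) = record
    { cong   = λ e → C.cong (e k)
    ; +-homo = λ f g → C.+-homo (f k) (g k)
    }
    where module C = Additive (coefficient-additive n α)

  module Coefficient n α = Additive (coefficient-additive n α)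

  coefficient-injective : ∀ n {f g} → (∀ α → coefficient n α f ≈ coefficient n α g) → S._≈_ n f g
  coefficient-injective zero    e   = e []
  coefficient-injective (suc n) e k = coefficient-injective n λ α → e (k ∷ α)

  coefficient-scalar : ∀ n α c f → coefficient n α (S._*_ n (scalar n c) f) ≈ c * coefficient n α f
  coefficient-scalar zero    []      c f = refl
  coefficient-scalar (suc n) (k ∷ α) c f =
    trans (Coefficient.cong n α (P.constant-⊛ n (scalar n c) f k)) (coefficient-scalar n α c (f k))

  ⊛-constant : ∀ n f c k → S._≈_ n (P._⊛_ n f (P.constant n c) k) (S._*_ n (f k) c)
  ⊛-constant n f c k = S.trans n (P.⊛-comm n f (P.constant n c) k)
    (S.trans n (P.constant-⊛ n c f k) (S.*-comm n c (f k)))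

  -- The i-th factor involves only the i-th variable, so extraction of a coefficient is
  -- multiplicative on this product although it is not in general.
  coefficient-product : ∀ n α (H : Fin n → Series₁) →
    coefficient n α (O.product n λ i → embed n i (H i)) ≈ product λ i → H i (lookup α i)
  coefficient-product zero    []      H = refl
  coefficient-product (suc n) (k ∷ α) H = begin
    coefficient n α (P._⊛_ n (embed (suc n) zero (H zero)) (O.product (suc n) λ i → P.constant n (embed n i (H (suc i)))) k)
      ≈⟨ Coefficient.cong n α (P.⊛-cong n {embed (suc n) zero (H zero)} (λ _ → S.refl n)
           (S.sym (suc n) {P.constant n (O.product n λ i → embed n i (H (suc i)))}
             (Hom.product-homo (Series.constant-hom (seriesRing n)) λ i → embed n i (H (suc i)))) k) ⟩
    coefficient n α (P._⊛_ n (embed (suc n) zero (H zero)) (P.constant n (O.product n λ i → embed n i (H (suc i)))) k)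
      ≈⟨ Coefficient.cong n α (⊛-constant n (embed (suc n) zero (H zero)) _ k) ⟩
    coefficient n α (S._*_ n (scalar n (H zero k)) (O.product n λ i → embed n i (H (suc i))))
      ≈⟨ coefficient-scalar n α (H zero k) _ ⟩
    H zero k * coefficient n α (O.product n λ i → embed n i (H (suc i)))
      ≈⟨ *-congˡ (coefficient-product n α (H ∘ suc)) ⟩
    H zero k * product (λ i → H (suc i) (lookup α i))
      ∎
    where open import Relation.Binary.Reasoning.Setoid setoid

  -- Row i involves only the i-th variable. Every term of the determinant is thus a product of
  -- series in separate variables, and the coefficient can be taken row by row.
  coefficient-det : ∀ n α (M : Fin n → Fin n → Series₁) →
    coefficient n α (O.det n λ i j → embed n i (M i j)) ≈ det λ i j → M i j (lookup α i)
  coefficient-det zero    []      M = refl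
  coefficient-det (suc n) (k ∷ α) M = begin
    coefficient n α (O.det (suc n) M′ k)
      ≈⟨ Coefficient.sum-homo (suc n) (k ∷ α) term ⟩
    sum (λ j → coefficient n α (term j k))
      ≈⟨ Determinant.sum-cong R (λ j → begin
           coefficient n α (term j k)
             ≈⟨ Coefficient.cong n α (term-coefficient j) ⟩
           coefficient n α (sign j S′.* (scalar n (M zero j k) S′.* minor j))
             ≈⟨ Coefficient.cong n α (S′.*-congʳ (S′.sym (Hom.sign-homo (scalar-hom n) (toℕ j)))) ⟩
           coefficient n α (scalar n ((- 1#) ^ toℕ j) S′.* (scalar n (M zero j k) S′.* minor j))
             ≈⟨ trans (coefficient-scalar n α _ _) (*-congˡ (coefficient-scalar n α _ (minor j))) ⟩
           (- 1#) ^ toℕ j * (M zero j k * coefficient n α (minor j))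
             ≈⟨ *-congˡ (*-congˡ (coefficient-det n α λ i l → M (suc i) (punchIn j l))) ⟩
           (- 1#) ^ toℕ j * (M zero j k * det λ i l → M (suc i) (punchIn j l) (lookup α i))
             ∎) ⟩
    det (λ i j → M i j (lookup (k ∷ α) i))
      ∎
    where
    open import Relation.Binary.Reasoning.Setoid setoid
    module S′ = CommutativeRing (seriesRing n)
    module S″ = CommutativeRing (seriesRing (suc n))
    module constant = Hom (Series.constant-hom (seriesRing n))
    M′ : Fin (suc n) → Fin (suc n) → ∣ seriesRing (suc n) ∣
    M′ i j = embed (suc n) i (M i j)
    sign : Fin (suc n) → ∣ seriesRing n ∣
    sign j = O._^_ n (S′.- S′.1#) (toℕ j)
    minor : Fin (suc n) → ∣ seriesRing n ∣
    minor j = O.det n λ i l → embed n i (M (suc i) (punchIn j l))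
    term : Fin (suc n) → ∣ seriesRing (suc n) ∣
    term j = O._^_ (suc n) (S″.- S″.1#) (toℕ j) S″.* (M′ zero j S″.* O.det (suc n) λ i l → M′ (suc i) (punchIn j l))
    term-coefficient : ∀ j → S._≈_ n (term j k) (sign j S′.* (scalar n (M zero j k) S′.* minor j))
    term-coefficient j = S′.trans
      (P.⊛-cong n {O._^_ (suc n) (S″.- S″.1#) (toℕ j)} {P.constant n (sign j)}
        (S″.sym {P.constant n (sign j)} (constant.sign-homo (toℕ j)))
        (P.⊛-cong n {M′ zero j} (λ _ → S.refl n)
          (S″.sym {P.constant n (minor j)} (constant.det-homo λ i l → embed n i (M (suc i) (punchIn j l))))) k)
      (S′.trans (P.constant-⊛ n (sign j) (M′ zero j S″.* P.constant n (minor j)) k) (S′.*-congˡ (⊛-constant n (M′ zero j) (minor j) k)))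

  -- If f_k = x f_{k+1} for the outermost variable x, then each f_k has constant coefficient 0, and
  -- its coefficient at l + 1 is that of f_{k+1} at l: induction on l, for all k at once. For an
  -- inner variable the argument applies to each coefficient.
  x-separated : ∀ n i → Series.Separated (seriesRing n) (x n i)
  x-separated (suc n) zero f e k zero = S.trans n (e k 0) (Series.indeterminate-zero (seriesRing n) (f (suc k)))
  x-separated (suc n) zero f e k (suc l) = S.trans n (e k (suc l))
    (S.trans n (P.indeterminate-⊛ n (f (suc k)) l) (x-separated (suc n) zero f e (suc k) l))
  x-separated (suc n) (suc i) f e k l = x-separated n i (λ k → f k l)
    (λ k → S.trans n (e k l) (P.constant-⊛ n (x n i) (f (suc k)) l)) k

  x-regular : ∀ n i → Regular (seriesRing n) (x n i)
  x-regular (suc n) zero    = Series.indeterminate-regular (seriesRing n)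
  x-regular (suc n) (suc i) = Series.constant-regular (seriesRing n) (x-regular n i)

  x-difference-regular : ∀ n {i j} → toℕ i ℕ.< toℕ j → Regular (seriesRing n) (S._-_ n (x n i) (x n j))
  x-difference-regular (suc n) {zero}  {suc j} _         =
    Series.indeterminate-constant-regular (seriesRing n) (x-separated n j)
  x-difference-regular (suc n) {suc i} {suc j} (s≤s i<j) =
    regular-cong (seriesRing (suc n)) {P.constant n (S._-_ n (x n i) (x n j))}
      (P.constant-‿- n (x n i) (x n j)) (Series.constant-regular (seriesRing n) (x-difference-regular n i<j))

  vandermonde-x-regular : ∀ n → Regular (seriesRing n) (O.vandermonde n (x n))
  vandermonde-x-regular n = vandermonde-regular (seriesRing n) (x n) (x-difference-regular n)

module _ (A B : Ring) where
  private
    module A = CommutativeRing A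
    module B = CommutativeRing B
    module Â = MultivariateSeries A
    module B̂ = MultivariateSeries B

  mapCoefficients : (∣ A ∣ → ∣ B ∣) → ∀ n → ∣ Â.seriesRing n ∣ → ∣ B̂.seriesRing n ∣
  mapCoefficients f zero    s   = f s
  mapCoefficients f (suc n) s k = mapCoefficients f n (s k)

  coefficient-map : ∀ f n α s → B̂.coefficient n α (mapCoefficients f n s) ≡ f (Â.coefficient n α s)
  coefficient-map f zero    []      s = ≡.refl
  coefficient-map f (suc n) (k ∷ α) s = coefficient-map f n α (s k)

  mapCoefficients-additive : ∀ {f} → Additive A B f → ∀ n → Additive (Â.seriesRing n) (B̂.seriesRing n) (mapCoefficients f n)
  mapCoefficients-additive F zero    = F
  mapCoefficients-additive F (suc n) = map-additive (Â.seriesRing n) (B̂.seriesRing n) (mapCoefficients-additive F n)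

  mapCoefficients-hom : ∀ {f} → Hom A B f → ∀ n → Hom (Â.seriesRing n) (B̂.seriesRing n) (mapCoefficients f n)
  mapCoefficients-hom F zero    = F
  mapCoefficients-hom F (suc n) = map-hom (Â.seriesRing n) (B̂.seriesRing n) (mapCoefficients-hom F n)

  mapCoefficients-x : ∀ {f} (F : Hom A B f) n i → CommutativeRing._≈_ (B̂.seriesRing n) (mapCoefficients f n (Â.x n i)) (B̂.x n i)
  mapCoefficients-x F (suc n) zero    = map-indeterminate (Â.seriesRing n) (B̂.seriesRing n) (mapCoefficients-hom F n)
  mapCoefficients-x F (suc n) (suc i) = CommutativeRing.trans (B̂.seriesRing (suc n))
    {mapCoefficients _ n ∘ PowerSeries.constant (Â.seriesRing n) (Â.x n i)}
    {PowerSeries.constant (B̂.seriesRing n) (mapCoefficients _ n (Â.x n i))}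
    (map-constant (Â.seriesRing n) (B̂.seriesRing n) (mapCoefficients-additive (Hom.additive F) n) (Â.x n i))
    (PowerSeries.constant-cong (B̂.seriesRing n) (mapCoefficients-x F n i))

module _ (A B : Ring) where
  private
    module A = CommutativeRing A
    module B = CommutativeRing B
    module Â n = CommutativeRing (MultivariateSeries.seriesRing A n)
    module B̂ n = CommutativeRing (MultivariateSeries.seriesRing B n)

  -- Meant for a Newton functional φ, which is not multiplicative but commutes with factors whose
  -- coefficients lie in the base ring, such as the Vandermonde product in y.
  mapCoefficients-linear : ∀ {ι φ} → Additive A B φ → (∀ r p → φ (ι r A.* p) B.≈ r B.* φ p) →
    ∀ n f F → B̂._≈_ n (mapCoefficients A B φ n (Â._*_ n (mapCoefficients B A ι n f) F)) (B̂._*_ n f (mapCoefficients A B φ n F))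
  mapCoefficients-linear Φ l zero    f F = l f F
  mapCoefficients-linear {ι} Φ l (suc n) f F k = B̂.trans n
    (Additive.sum-homo (mapCoefficients-additive A B Φ n) {suc k} λ i → Â._*_ n (mapCoefficients B A ι n (f (toℕ i))) (F (k ∸ toℕ i)))
    (Determinant.sum-cong (MultivariateSeries.seriesRing B n) {suc k} λ i → mapCoefficients-linear Φ l n (f (toℕ i)) (F (k ∸ toℕ i)))

-- Alternation under adjacent transpositions

-- The transposition of k and k + 1
adjacent : ∀ {m} → Fin m → Fin (suc m) → Fin (suc m)
adjacent zero    zero          = suc zero
adjacent zero    (suc zero)    = zero
adjacent zero    (suc (suc i)) = suc (suc i)
adjacent (suc k) zero          = zero
adjacent (suc k) (suc i)       = suc (adjacent k i)

adjacent-involutive : ∀ {m} (k : Fin m) i → adjacent k (adjacent k i) ≡ i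
adjacent-involutive zero    zero          = ≡.refl
adjacent-involutive zero    (suc zero)    = ≡.refl
adjacent-involutive zero    (suc (suc i)) = ≡.refl
adjacent-involutive (suc k) zero          = ≡.refl
adjacent-involutive (suc k) (suc i)       = ≡.cong suc (adjacent-involutive k i)

module VandermondeAlternating (R : Ring) where
  open CommutativeRing R hiding (zero)
  open RingOps R
  open Determinant R
  open IntegerSolver R
  open import Algebra.Properties.Ring ring
  open import Relation.Binary.Reasoning.Setoid setoid

  product-adjacent : ∀ {m} (f : Fin (suc m) → Carrier) k → product (f ∘ adjacent k) ≈ product f
  product-adjacent f zero    = solve 3 (λ a b p → b :* (a :* p) := a :* (b :* p)) refl (f zero) (f (suc zero)) _
  product-adjacent f (suc k) = *-congˡ (product-adjacent (f ∘ suc) k)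

  -- Exchanging the first two points negates x₀ - x₁ and permutes the other factors; a later
  -- exchange permutes the factors that contain `x zero` and is handled by induction on the rest.
  vandermonde-adjacent : ∀ {m} (x : Fin (suc m) → Carrier) k → vandermonde (x ∘ adjacent k) ≈ - vandermonde x
  vandermonde-adjacent {suc m} x zero = begin
    vandermonde (x ∘ adjacent zero)
      ≈⟨ trans (vandermonde-suc (x ∘ adjacent zero)) (*-congˡ (vandermonde-suc (x ∘ adjacent zero ∘ suc))) ⟩
    ((x₁ - x₀) * p₁) * (p₀ * v)
      ≈⟨ solve 5 (λ a b p q v → ((b :- a) :* q) :* (p :* v) := :- (((a :- b) :* p) :* (q :* v))) refl x₀ x₁ p₀ p₁ v ⟩
    - (((x₀ - x₁) * p₀) * (p₁ * v))
      ≈⟨ -‿cong (trans (vandermonde-suc x) (*-congˡ (vandermonde-suc (x ∘ suc)))) ⟨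
    - vandermonde x
      ∎
    where
    x₀ x₁ p₀ p₁ v : Carrier
    x₀ = x zero
    x₁ = x (suc zero)
    p₀ = product λ j → x₀ - x (suc (suc j))
    p₁ = product λ j → x₁ - x (suc (suc j))
    v  = vandermonde λ j → x (suc (suc j))
  vandermonde-adjacent {suc m} x (suc k) = begin
    vandermonde (x ∘ adjacent (suc k))
      ≈⟨ vandermonde-suc (x ∘ adjacent (suc k)) ⟩
    product (λ j → x zero - x (suc (adjacent k j))) * vandermonde (x ∘ suc ∘ adjacent k)
      ≈⟨ *-cong (product-adjacent (λ j → x zero - x (suc j)) k) (vandermonde-adjacent (x ∘ suc) k) ⟩
    product (λ j → x zero - x (suc j)) * - vandermonde (x ∘ suc)
      ≈⟨ -‿distribʳ-* _ _ ⟨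
    - (product (λ j → x zero - x (suc j)) * vandermonde (x ∘ suc))
      ≈⟨ -‿cong (vandermonde-suc x) ⟨
    - vandermonde x
      ∎

-- Strictly decreasing, with all entries less than B
data Below : ∀ {m} → ℕ → Vec ℕ m → Set where
  []  : ∀ {B} → Below B []
  _∷_ : ∀ {B m a} {e : Vec ℕ m} → a ℕ.< B → Below a e → Below B (a ∷ e)

-- Z stands for the set of exponent vectors where an alternating function vanishes. The recursive
-- form makes the condition pass to the predicate on tails with a fixed head.
Alternating : ∀ {m} → (Vec ℕ m → Set) → Set
Alternating {zero}        Z = ⊤
Alternating {suc zero}    Z = ⊤
Alternating {suc (suc m)} Z =
  (∀ a b e → Z (a ∷ b ∷ e) → Z (b ∷ a ∷ e)) × (∀ a e → Z (a ∷ a ∷ e)) × (∀ a → Alternating λ e → Z (a ∷ e))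

alternating-∷ : ∀ {m} {Z : Vec ℕ (suc m) → Set} → Alternating Z → ∀ a → Alternating λ e → Z (a ∷ e)
alternating-∷ {zero}  Z a = tt
alternating-∷ {suc m} Z a = proj₂ (proj₂ Z) a

-- Insertion sort
alternating-insert : ∀ {m} {Z : Vec ℕ (suc m) → Set} {B} → Alternating Z → (∀ e → Below B e → Z e) →
                     ∀ {a e} → a ℕ.< B → Below B e → Z (a ∷ e)
alternating-insert alt z {a} {[]} a<B [] = z _ (a<B ∷ [])
alternating-insert {suc m} {Z} alt z {a} {b ∷ e} a<B (b<B ∷ e<b) with ℕ.<-cmp a b
... | tri< a<b _ _    = proj₁ alt b a e (alternating-insert (proj₂ (proj₂ alt) b) (λ e e<b → z (b ∷ e) (b<B ∷ e<b)) a<b e<b)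
... | tri≈ _ ≡.refl _ = proj₁ (proj₂ alt) a e
... | tri> _ _ b<a    = z (a ∷ b ∷ e) (a<B ∷ b<a ∷ e<b)

-- Induction on the vector for all Z together: fixing the head a gives a predicate on tails, whose
-- hypothesis for decreasing tails is the insertion of a.
alternating-bounded : ∀ {m} {Z : Vec ℕ m → Set} {B} → Alternating Z → (∀ e → Below B e → Z e) → ∀ e → Allᵥ (ℕ._< B) e → Z e
alternating-bounded         alt z []      []          = z [] []
alternating-bounded {Z = Z} alt z (a ∷ e) (a<B ∷ e<B) =
  alternating-bounded (alternating-∷ {Z = Z} alt a) (λ e → alternating-insert {Z = Z} alt z a<B) e e<B

alternating : ∀ {m} {Z : Vec ℕ m → Set} → Alternating Z → (∀ B e → Below B e → Z e) → ∀ e → Z e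
alternating {Z = Z} alt z e = let (B , e<B) = bound e in alternating-bounded {Z = Z} alt (z B) e e<B
  where
  bound : ∀ {m} (e : Vec ℕ m) → ∃ λ B → Allᵥ (ℕ._< B) e
  bound []      = 0 , []
  bound (a ∷ e) = let (B , e<B) = bound e in
    suc a ℕ.⊔ B , ℕ.m≤m⊔n (suc a) B ∷ Allᵥ.map (λ x<B → ℕ.≤-trans x<B (ℕ.m≤n⊔m (suc a) B)) e<B

-- Newton interpolation

module Polynomials (R : Ring) where
  private module R = CommutativeRing R
  open RingOps R using () renaming (det to detᴿ; _^_ to _^ᴿ_; sum to sumᴿ)
  open Polynomial R

  substitute-hom : ∀ {V W} (σ : V → Poly W) → Hom (polynomialRing V) (polynomialRing W) (substitute σ)
  substitute-hom σ = record
    { additive = record { cong = substitute-cong σ ; +-homo = λ p q → refl }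
    ; *-homo   = λ p q → refl
    ; 1-homo   = refl
    }

  con-hom : ∀ {V} → Hom R (polynomialRing V) con
  con-hom = record
    { additive = record { cong = con-cong ; +-homo = con-+ }
    ; *-homo   = con-*
    ; 1-homo   = refl
    }

  substitute-ext : ∀ {V W} {σ τ : V → Poly W} → (∀ v → σ v ≈ τ v) → ∀ p → substitute σ p ≈ substitute τ p
  substitute-ext e (con c) = refl
  substitute-ext e (var v) = e v
  substitute-ext e (p + q) = +-cong (substitute-ext e p) (substitute-ext e q)
  substitute-ext e (p * q) = *-cong (substitute-ext e p) (substitute-ext e q)
  substitute-ext e (- p)   = -‿cong (substitute-ext e p)

  substitute-∘ : ∀ {U V W} (τ : V → Poly W) (σ : U → Poly V) p →
                 substitute τ (substitute σ p) ≡ substitute (substitute τ ∘ σ) p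
  substitute-∘ τ σ (con c) = ≡.refl
  substitute-∘ τ σ (var v) = ≡.refl
  substitute-∘ τ σ (p + q) = ≡.cong₂ _+_ (substitute-∘ τ σ p) (substitute-∘ τ σ q)
  substitute-∘ τ σ (p * q) = ≡.cong₂ _*_ (substitute-∘ τ σ p) (substitute-∘ τ σ q)
  substitute-∘ τ σ (- p)   = ≡.cong -_ (substitute-∘ τ σ p)

  substitute-var : ∀ {V} (p : Poly V) → substitute var p ≡ p
  substitute-var (con c) = ≡.refl
  substitute-var (var v) = ≡.refl
  substitute-var (p + q) = ≡.cong₂ _+_ (substitute-var p) (substitute-var q)
  substitute-var (p * q) = ≡.cong₂ _*_ (substitute-var p) (substitute-var q)
  substitute-var (- p)   = ≡.cong -_ (substitute-var p)

  -- D p = (p - S p) / ξ, where S is the substitution of σ.  The quotient is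
  -- defined by the twisted product rule D (p q) = D p q + S p D q.
  record TwistedDerivation (V : Set) : Set where
    field
      σ δ        : V → Poly V
      ξ          : Poly V
      difference : ∀ v → var v ≈ σ v + ξ * δ v

    open IntegerSolver (polynomialRing V)

    S D : Poly V → Poly V
    S = substitute σ
    D (con c) = con R.0#
    D (var v) = δ v
    D (p + q) = D p + D q
    D (p * q) = D p * q + S p * D q
    D (- p)   = - D p

    D-difference : ∀ p → p ≈ S p + ξ * D p
    D-difference (con c) = solve 2 (λ c ξ → c := c :+ ξ :* :0) refl (con c) ξ
    D-difference (var v) = difference v
    D-difference (p + q) = trans (+-cong (D-difference p) (D-difference q))
      (solve 5 (λ a b c d ξ → (a :+ ξ :* b) :+ (c :+ ξ :* d) := (a :+ c) :+ ξ :* (b :+ d)) refl (S p) (D p) (S q) (D q) ξ)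
    D-difference (p * q) = trans (*-cong (D-difference p) refl)
      (trans (solve 4 (λ a b q ξ → (a :+ ξ :* b) :* q := a :* q :+ ξ :* (b :* q)) refl (S p) (D p) q ξ)
      (trans (+-cong (*-cong refl (D-difference q)) refl)
      (solve 6 (λ a b c d q ξ → a :* (c :+ ξ :* d) :+ ξ :* (b :* q) := a :* c :+ ξ :* (b :* q :+ a :* d)) refl (S p) (D p) (S q) (D q) q ξ)))
    D-difference (- p)   = trans (-‿cong (D-difference p))
      (solve 3 (λ a b ξ → :- (a :+ ξ :* b) := (:- a) :+ ξ :* (:- b)) refl (S p) (D p) ξ)

    -- D is defined on expressions and has to respect each law of commutative algebras. The twisted
    -- product rule treats p and q differently, so commutativity is the one law for which
    -- `D-difference` is invoked.
    D-cong : ∀ {p q} → p ≈ q → D p ≈ D q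
    D-cong refl              = refl
    D-cong (sym e)           = sym (D-cong e)
    D-cong (trans e e′)      = trans (D-cong e) (D-cong e′)
    D-cong (+-cong e e′)     = +-cong (D-cong e) (D-cong e′)
    D-cong (*-cong e e′)     = +-cong (*-cong (D-cong e) e′) (*-cong (substitute-cong σ e) (D-cong e′))
    D-cong (-‿cong e)        = -‿cong (D-cong e)
    D-cong (+-assoc _ _ _)   = +-assoc _ _ _
    D-cong (+-comm _ _)      = +-comm _ _
    D-cong (+-identity _)    = +-identity _
    D-cong (-‿inverse _)     = -‿inverse _
    D-cong (*-assoc p q r)   = solve 7 (λ p′ q r p″ q′ q″ r′ → (p′ :* q :+ p″ :* q′) :* r :+ (p″ :* q″) :* r′ := p′ :* (q :* r) :+ p″ :* (q′ :* r :+ q″ :* r′))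
      refl (D p) q r (S p) (D q) (S q) (D r)
    -- Both sides are (p q - S p S q) / ξ.
    D-cong (*-comm p q)      = trans (+-cong (*-cong refl (D-difference q)) refl)
      (trans (solve 5 (λ p′ p″ q′ q″ ξ → p′ :* (q″ :+ ξ :* q′) :+ p″ :* q′ := q′ :* (p″ :+ ξ :* p′) :+ q″ :* p′) refl (D p) (S p) (D q) (S q) ξ)
             (+-cong (*-cong refl (sym (D-difference p))) refl))
    D-cong (*-identity p)    = solve 2 (λ p p′ → :0 :* p :+ :1 :* p′ := p′) refl p (D p)
    D-cong (distrib p q r)   = solve 6 (λ p′ p″ q r q′ r′ → p′ :* (q :+ r) :+ p″ :* (q′ :+ r′) := (p′ :* q :+ p″ :* q′) :+ (p′ :* r :+ p″ :* r′))
      refl (D p) (S p) q r (D q) (D r)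
    D-cong (con-cong e)      = refl
    D-cong (con-+ c d)       = sym (+-identity _)
    D-cong (con-* c d)       = solve 2 (λ c d → :0 := :0 :* d :+ c :* :0) refl (con c) (con d)

    -- D is then a left inverse of multiplication by ξ. This yields the regularity of ξ as well as
    -- the action of divided differences on factorial powers.
    D-ξ-* : D ξ ≈ con R.1# → S ξ ≈ con R.0# → ∀ p → D (ξ * p) ≈ p
    D-ξ-* e e′ p = trans (+-cong (*-cong e refl) (*-cong e′ refl))
      (solve 2 (λ p p′ → :1 :* p :+ :0 :* p′ := p) refl p (D p))

    D-additive : Additive (polynomialRing V) (polynomialRing V) D
    D-additive = record { cong = D-cong ; +-homo = λ p q → refl }

  open TwistedDerivation using (S; D; σ; δ; D-cong; D-difference; D-ξ-*; D-additive)

  module _ {V W} (T : TwistedDerivation V) (T′ : TwistedDerivation W) (ρ : V → Poly W)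
           (σ-commutes : ∀ v → S T′ (ρ v) ≈ substitute ρ (σ T v)) where

    S-intertwines : ∀ p → S T′ (substitute ρ p) ≈ substitute ρ (S T p)
    S-intertwines (con c) = refl
    S-intertwines (var v) = σ-commutes v
    S-intertwines (p + q) = +-cong (S-intertwines p) (S-intertwines q)
    S-intertwines (p * q) = *-cong (S-intertwines p) (S-intertwines q)
    S-intertwines (- p)   = -‿cong (S-intertwines p)

    -- Both sides satisfy the same twisted product rule in p, because the substitutions S are
    -- intertwined; agreement on the variables therefore suffices. The rules for exchanging
    -- variables below are instances.
    D-intertwines : (∀ v → D T′ (ρ v) ≈ substitute ρ (δ T v)) → ∀ p → D T′ (substitute ρ p) ≈ substitute ρ (D T p)
    D-intertwines e (con c) = refl
    D-intertwines e (var v) = e v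
    D-intertwines e (p + q) = +-cong (D-intertwines e p) (D-intertwines e q)
    D-intertwines e (p * q) = +-cong (*-cong (D-intertwines e p) refl) (*-cong (S-intertwines p) (D-intertwines e q))
    D-intertwines e (- p)   = -‿cong (D-intertwines e p)

  -- The mixed hypotheses say on variables that each D commutes with the other S; `D-intertwines`
  -- extends this to all p. Applying the product rule twice then gives the same four terms in both
  -- orders.
  D-commutes : ∀ {V} (T T′ : TwistedDerivation V) →
    (∀ v → S T (σ T′ v) ≈ S T′ (σ T v)) → (∀ v → D T (σ T′ v) ≈ S T′ (δ T v)) → (∀ v → S T (δ T′ v) ≈ D T′ (σ T v)) →
    (∀ v → D T (δ T′ v) ≈ D T′ (δ T v)) → ∀ p → D T (D T′ p) ≈ D T′ (D T p)
  D-commutes {V} T T′ ss ds sd dd = go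
    where
    open IntegerSolver (polynomialRing V)
    DS : ∀ p → D T (S T′ p) ≈ S T′ (D T p)
    DS = D-intertwines T T (σ T′) ss ds
    SD : ∀ p → S T (D T′ p) ≈ D T′ (S T p)
    SD p = sym (D-intertwines T′ T′ (σ T) (λ v → sym (ss v)) (λ v → sym (sd v)) p)
    go : ∀ p → D T (D T′ p) ≈ D T′ (D T p)
    go (con c) = refl
    go (var v) = dd v
    go (p + q) = +-cong (go p) (go q)
    go (p * q) = trans
      (+-cong (+-cong (*-cong (go p) refl) (*-cong (SD p) refl))
              (+-cong (*-cong (DS p) refl) (*-cong (S-intertwines T T (σ T′) ss p) (go q))))
      (solve 8 (λ a q b c d e f g → (a :* q :+ b :* c) :+ (d :* e :+ f :* g) := (a :* q :+ d :* e) :+ (b :* c :+ f :* g)) refl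
        (D T′ (D T p)) q (D T′ (S T p)) (D T q) (S T′ (D T p)) (D T′ q) (S T′ (S T p)) (D T′ (D T q)))
    go (- p)   = -‿cong (go p)

  -- The divided difference (p - p|_{xᵢ = e}) / (xᵢ - e)
  divided : ∀ {n} → Fin n → Poly (Fin n) → TwistedDerivation (Fin n)
  divided {n} i e = record
    { σ = λ j → if does (j Fin.≟ i) then e else var j
    ; δ = λ j → if does (j Fin.≟ i) then con R.1# else con R.0#
    ; ξ = var i + - e
    ; difference = difference
    }
    where
    open IntegerSolver (polynomialRing (Fin n))
    difference : ∀ j → var j ≈ (if does (j Fin.≟ i) then e else var j) + (var i + - e) * (if does (j Fin.≟ i) then con R.1# else con R.0#)
    difference j with j Fin.≟ i
    ... | yes ≡.refl = solve 2 (λ v e → v := e :+ (v :+ (:- e)) :* :1) refl (var j) e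
    ... | no _       = solve 2 (λ v ξ → v := v :+ ξ :* :0) refl (var j) (var i + - e)

  -- The divided difference with respect to xᵢ at the node xⱼ undoes multiplication by xᵢ - xⱼ. For
  -- this purpose `divided` admits a polynomial as node.
  var-difference-regular : ∀ {n} {i j : Fin n} → i ≢ j → Regular (polynomialRing (Fin n)) (var i + - var j)
  var-difference-regular {n} {i} {j} i≢j f e = trans (sym (D-ξ-* T Dξ Sξ f)) (D-cong T e)
    where
    open IntegerSolver (polynomialRing (Fin n))
    T : TwistedDerivation (Fin n)
    T = divided i (var j)
    Dξ : D T (var i + - var j) ≈ con R.1#
    Dξ with i Fin.≟ i | j Fin.≟ i
    ... | yes _  | no _     = solve 0 (:1 :+ (:- :0) := :1) refl
    ... | no i≢i | _        = contradiction ≡.refl i≢i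
    ... | yes _  | yes j≡i  = contradiction (≡.sym j≡i) i≢j
    Sξ : S T (var i + - var j) ≈ con R.0#
    Sξ with i Fin.≟ i | j Fin.≟ i
    ... | yes _  | no _     = solve 1 (λ v → v :+ (:- v) := :0) refl (var j)
    ... | no i≢i | _        = contradiction ≡.refl i≢i
    ... | yes _  | yes j≡i  = contradiction (≡.sym j≡i) i≢j

  vandermonde-var-regular : ∀ n → Regular (polynomialRing (Fin n)) (RingOps.vandermonde (polynomialRing (Fin n)) var)
  vandermonde-var-regular n = vandermonde-regular (polynomialRing (Fin n)) var
    λ i<j → var-difference-regular λ i≡j → ℕ.<⇒≢ i<j (≡.cong toℕ i≡j)

  D₀ : ∀ {m} → R.Carrier → Poly (Fin (suc m)) → Poly (Fin (suc m))
  D₀ c = D (divided zero (con c))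

  D₁ : ∀ {m} → R.Carrier → Poly (Fin (suc (suc m))) → Poly (Fin (suc (suc m)))
  D₁ c = D (divided (suc zero) (con c))

  evaluation : ∀ {m} → R.Carrier → Fin (suc m) → Poly (Fin m)
  evaluation c zero    = con c
  evaluation c (suc i) = var i

  E : ∀ {m} → R.Carrier → Poly (Fin (suc m)) → Poly (Fin m)
  E c = substitute (evaluation c)

  weaken : ∀ {m} → Poly (Fin m) → Poly (Fin (suc m))
  weaken = substitute (var ∘ suc)

  -- The coefficient of (x₀ - b₀)⋯(x₀ - b_{r-1}) in the Newton expansion in x₀
  newton : ∀ {m} → (ℕ → R.Carrier) → ℕ → Poly (Fin (suc m)) → Poly (Fin m)
  newton b zero    p = E (b 0) p
  newton b (suc r) p = newton (b ∘ suc) r (D₀ (b 0) p)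

  newton-additive : ∀ {m} b r → Additive (polynomialRing (Fin (suc m))) (polynomialRing (Fin m)) (newton b r)
  newton-additive b zero    = Hom.additive (substitute-hom (evaluation (b 0)))
  newton-additive b (suc r) = record
    { cong   = λ e → N.cong (D-cong (divided zero (con (b 0))) e)
    ; +-homo = λ p q → N.+-homo _ _
    }
    where module N = Additive (newton-additive (b ∘ suc) r)

  module Newton {m} b r = Additive (newton-additive {m} b r)

  E-weaken : ∀ {m} c (p : Poly (Fin m)) → E c (weaken p) ≡ p
  E-weaken c p = ≡.trans (substitute-∘ (evaluation c) (var ∘ suc) p) (substitute-var p)

  S-weaken : ∀ {m} c (p : Poly (Fin m)) → S (divided zero (con c)) (weaken p) ≡ weaken p
  S-weaken c p = substitute-∘ _ (var ∘ suc) p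

  ≡⇒≈ : ∀ {V} {p q : Poly V} → p ≡ q → p ≈ q
  ≡⇒≈ ≡.refl = refl

  D₀-weaken : ∀ {m} c (p : Poly (Fin m)) → D₀ c (weaken p) ≈ con R.0#
  D₀-weaken c (con a) = refl
  D₀-weaken c (var v) = refl
  D₀-weaken c (p + q) = trans (+-cong (D₀-weaken c p) (D₀-weaken c q)) (+-identity _)
  D₀-weaken {m} c (p * q) = trans (+-cong (*-cong (D₀-weaken c p) refl) (*-cong refl (D₀-weaken c q)))
    (solve 2 (λ p q → :0 :* q :+ p :* :0 := :0) refl (S (divided zero (con c)) (weaken p)) (weaken q))
    where open IntegerSolver (polynomialRing (Fin (suc m)))
  D₀-weaken {m} c (- p)   = trans (-‿cong (D₀-weaken c p)) (solve 0 (:- :0 := :0) refl)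
    where open IntegerSolver (polynomialRing (Fin (suc m)))

  newton-linear : ∀ {m} b r (q : Poly (Fin m)) p → newton b r (weaken q * p) ≈ q * newton b r p
  newton-linear b zero    q p = *-cong (≡⇒≈ (E-weaken (b 0) q)) refl
  newton-linear {m} b (suc r) q p = trans (Newton.cong (b ∘ suc) r (trans
      (+-cong (*-cong (D₀-weaken (b 0) q) refl) (*-cong (≡⇒≈ (S-weaken (b 0) q)) refl))
      (solve 3 (λ p q p′ → :0 :* p :+ q :* p′ := q :* p′) refl p (weaken q) (D₀ (b 0) p))))
    (newton-linear (b ∘ suc) r q (D₀ (b 0) p))
    where open IntegerSolver (polynomialRing (Fin (suc m)))

  liftSubstitution : ∀ {m n} → (Fin m → Poly (Fin n)) → Fin (suc m) → Poly (Fin (suc n))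
  liftSubstitution ρ zero    = var zero
  liftSubstitution ρ (suc i) = weaken (ρ i)

  newton-substitute : ∀ {m n} b r (ρ : Fin m → Poly (Fin n)) p →
    newton b r (substitute (liftSubstitution ρ) p) ≈ substitute ρ (newton b r p)
  newton-substitute b zero    ρ p = trans (≡⇒≈ (substitute-∘ _ _ p))
    (trans (substitute-ext (λ { zero → refl ; (suc i) → ≡⇒≈ (E-weaken (b 0) (ρ i)) }) p)
           (sym (≡⇒≈ (substitute-∘ ρ (evaluation (b 0)) p))))
  newton-substitute b (suc r) ρ p = trans
    (Newton.cong (b ∘ suc) r (D-intertwines (divided zero (con (b 0))) (divided zero (con (b 0))) (liftSubstitution ρ)
      (λ { zero → refl ; (suc i) → ≡⇒≈ (S-weaken (b 0) (ρ i)) })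
      (λ { zero → refl ; (suc i) → D₀-weaken (b 0) (ρ i) }) p))
    (newton-substitute (b ∘ suc) r ρ (D₀ (b 0) p))

  value : Poly (Fin 0) → R.Carrier
  value (con c) = c
  value (p + q) = value p R.+ value q
  value (p * q) = value p R.* value q
  value (- p)   = R.- value p

  value-cong : ∀ {p q} → p ≈ q → value p R.≈ value q
  value-cong refl             = R.refl
  value-cong (sym e)          = R.sym (value-cong e)
  value-cong (trans e e′)     = R.trans (value-cong e) (value-cong e′)
  value-cong (+-cong e e′)    = R.+-cong (value-cong e) (value-cong e′)
  value-cong (*-cong e e′)    = R.*-cong (value-cong e) (value-cong e′)
  value-cong (-‿cong e)       = R.-‿cong (value-cong e)
  value-cong (+-assoc _ _ _)  = R.+-assoc _ _ _
  value-cong (+-comm _ _)     = R.+-comm _ _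
  value-cong (+-identity _)   = R.+-identityˡ _
  value-cong (-‿inverse _)    = R.-‿inverseˡ _
  value-cong (*-assoc _ _ _)  = R.*-assoc _ _ _
  value-cong (*-comm _ _)     = R.*-comm _ _
  value-cong (*-identity _)   = R.*-identityˡ _
  value-cong (distrib _ _ _)  = R.distribˡ _ _ _
  value-cong (con-cong e)     = e
  value-cong (con-+ _ _)      = R.refl
  value-cong (con-* _ _)      = R.refl

  con-value : ∀ p → p ≈ con (value p)
  con-value (con c) = refl
  con-value (p + q) = trans (+-cong (con-value p) (con-value q)) (sym (con-+ _ _))
  con-value (p * q) = trans (*-cong (con-value p) (con-value q)) (sym (con-* _ _))
  con-value (- p)   = trans (-‿cong (con-value p)) (sym (Hom.-‿homo con-hom (value p)))

  -- The coefficient of ∏ᵢ (xᵢ - b₀)⋯(xᵢ - b_{eᵢ-1})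
  newtonCoefficient : ∀ {m} → (ℕ → R.Carrier) → Vec ℕ m → Poly (Fin m) → R.Carrier
  newtonCoefficient b []      p = value p
  newtonCoefficient b (r ∷ e) p = newtonCoefficient b e (newton b r p)

  newtonCoefficient-additive : ∀ {m} b (e : Vec ℕ m) → Additive (polynomialRing (Fin m)) R (newtonCoefficient b e)
  newtonCoefficient-additive b []      = record { cong = value-cong ; +-homo = λ p q → R.refl }
  newtonCoefficient-additive b (r ∷ e) = record
    { cong   = λ p≈q → C.cong (Newton.cong b r p≈q)
    ; +-homo = λ p q → R.trans (C.cong (Newton.+-homo b r p q)) (C.+-homo _ _)
    }
    where module C = Additive (newtonCoefficient-additive b e)

  module NewtonCoefficient {m} b (e : Vec ℕ m) = Additive (newtonCoefficient-additive b e)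

  newtonCoefficient-linear : ∀ {m} b (e : Vec ℕ m) c p → newtonCoefficient b e (con c * p) R.≈ c R.* newtonCoefficient b e p
  newtonCoefficient-linear b []      c p = R.refl
  newtonCoefficient-linear b (r ∷ e) c p =
    R.trans (NewtonCoefficient.cong b e (newton-linear b r (con c) p)) (newtonCoefficient-linear b e c (newton b r p))

  infix 9 _[_]
  _[_] : ∀ {V} → Poly (Fin 1) → Poly V → Poly V
  f [ p ] = substitute (λ _ → p) f

  newtonCoefficient₁ : (ℕ → R.Carrier) → ℕ → Poly (Fin 1) → R.Carrier
  newtonCoefficient₁ b r = newtonCoefficient b (r ∷ [])

  newton-[] : ∀ {m} b r f → newton {m} b r (f [ var zero ]) ≈ con (newtonCoefficient₁ b r f)
  newton-[] b r f = trans (Newton.cong b r (substitute-ext (λ { zero → refl }) f))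
    (trans (newton-substitute b r (λ ()) f) (substitute-cong (λ ()) (con-value (newton b r f))))

  -- Row i involves only xᵢ and the functional is taken one variable at a time, so it acts on the
  -- determinant row by row, just as extraction of coefficients does.
  newtonCoefficient-det : ∀ {m} b (e : Vec ℕ m) (f : Fin m → Poly (Fin 1)) →
    newtonCoefficient b e (RingOps.det (polynomialRing (Fin m)) λ i j → f j [ var i ]) R.≈
    detᴿ λ i j → newtonCoefficient₁ b (lookup e i) (f j)
  newtonCoefficient-det b [] f = R.refl
  newtonCoefficient-det {suc m} b (r ∷ e) f = begin
    newtonCoefficient b e (newton b r (P.sum term))
      ≈⟨ R.trans (NewtonCoefficient.cong b e (Newton.sum-homo b r term)) (NewtonCoefficient.sum-homo b e (newton b r ∘ term)) ⟩
    sumᴿ (λ j → newtonCoefficient b e (newton b r (term j)))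
      ≈⟨ Determinant.sum-cong R (λ j → begin
           newtonCoefficient b e (newton b r (term j))
             ≈⟨ NewtonCoefficient.cong b e (newton-term j) ⟩
           newtonCoefficient b e (con ((R.- R.1#) ^ᴿ toℕ j) * (con (ν j) * minor j))
             ≈⟨ R.trans (newtonCoefficient-linear b e _ _) (R.*-congˡ (newtonCoefficient-linear b e (ν j) (minor j))) ⟩
           (R.- R.1#) ^ᴿ toℕ j R.* (ν j R.* newtonCoefficient b e (minor j))
             ≈⟨ R.*-congˡ (R.*-congˡ (newtonCoefficient-det b e (f ∘ punchIn j))) ⟩
           (R.- R.1#) ^ᴿ toℕ j R.* (ν j R.* detᴿ λ i k → newtonCoefficient₁ b (lookup e i) (f (punchIn j k)))
             ∎) ⟩
    detᴿ (λ i j → newtonCoefficient₁ b (lookup (r ∷ e) i) (f j))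
      ∎
    where
    open SetoidReasoning R.setoid
    module P = RingOps (polynomialRing (Fin (suc m)))
    module P′ = RingOps (polynomialRing (Fin m))
    ν : Fin (suc m) → R.Carrier
    ν j = newtonCoefficient₁ b r (f j)
    minor : Fin (suc m) → Poly (Fin m)
    minor j = P′.det λ i k → f (punchIn j k) [ var i ]
    sign : Fin (suc m) → Poly (Fin m)
    sign j = (- con R.1#) P′.^ toℕ j
    term : Fin (suc m) → Poly (Fin (suc m))
    term j = (- con R.1#) P.^ toℕ j * (f j [ var zero ] * P.det λ i k → f (punchIn j k) [ var (suc i) ])
    weaken-minor : ∀ j → weaken (minor j) ≈ P.det λ i k → f (punchIn j k) [ var (suc i) ]
    weaken-minor j = trans (Hom.det-homo (substitute-hom (var ∘ suc)) λ i k → f (punchIn j k) [ var i ])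
      (Determinant.det-cong (polynomialRing (Fin (suc m))) λ i k → ≡⇒≈ (substitute-∘ (var ∘ suc) (λ _ → var i) (f (punchIn j k))))
    newton-term : ∀ j → newton b r (term j) ≈ con ((R.- R.1#) ^ᴿ toℕ j) * (con (ν j) * minor j)
    newton-term j = trans (Newton.cong b r (trans
        (*-cong (sym (Hom.sign-homo (substitute-hom (var ∘ suc)) (toℕ j))) (*-cong refl (sym (weaken-minor j))))
        (solve 3 (λ s f d → s :* (f :* d) := (s :* d) :* f) refl (weaken (sign j)) (f j [ var zero ]) (weaken (minor j)))))
      (trans (newton-linear b r (sign j * minor j) (f j [ var zero ]))
      (trans (*-cong refl (newton-[] b r (f j)))
      (trans (solve′ 3 (λ s d c → (s :*′ d) :*′ c :=′ s :*′ (c :*′ d)) refl (sign j) (minor j) (con (ν j)))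
             (*-cong (sym (Hom.sign-homo con-hom (toℕ j))) refl))))
      where
      open IntegerSolver (polynomialRing (Fin (suc m)))
      open IntegerSolver (polynomialRing (Fin m)) using () renaming (solve to solve′; _:*_ to _:*′_; _:=_ to _:=′_)

  kronecker : ℕ → ℕ → R.Carrier
  kronecker zero    zero    = R.1#
  kronecker (suc r) (suc s) = kronecker r s
  kronecker _       _       = R.0#

  factorialPower : (ℕ → R.Carrier) → ℕ → Poly (Fin 1)
  factorialPower b r = RingOps.product (polynomialRing (Fin 1)) λ (k : Fin r) → var zero + - con (b (toℕ k))

  -- Division by x - b₀ strips the first factor and leaves a factorial power on the shifted nodes.
  -- If there is still a factor when r = 0, evaluation at b₀ kills it; if there is none when r > 0,
  -- the divided difference does.
  newtonCoefficient-factorialPower : ∀ b r s → newtonCoefficient₁ b r (factorialPower b s) R.≈ kronecker r s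
  newtonCoefficient-factorialPower b zero zero = R.refl
  newtonCoefficient-factorialPower b zero (suc s) = value-cong
    (solve 2 (λ b t → (b :+ (:- b)) :* t := :0) refl (con (b 0)) (E (b 0) (factorialPower (b ∘ suc) s)))
    where open IntegerSolver (polynomialRing (Fin 0))
  newtonCoefficient-factorialPower b (suc r) zero = Additive.0-homo (newtonCoefficient-additive (b ∘ suc) (r ∷ []))
  newtonCoefficient-factorialPower b (suc r) (suc s) = R.trans
    (NewtonCoefficient.cong (b ∘ suc) (r ∷ []) (D-ξ-* (divided zero (con (b 0)))
      (solve 0 (:1 :+ (:- :0) := :1) refl) (solve 1 (λ b → b :+ (:- b) := :0) refl (con (b 0))) (factorialPower (b ∘ suc) s)))
    (newtonCoefficient-factorialPower (b ∘ suc) r s)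
    where open IntegerSolver (polynomialRing (Fin 1))

  D₀-degree₀ : ∀ {m} c (p : Poly (Fin (suc m))) → expressionDegree p ≤ 0 → D₀ c p ≈ con R.0#
  D₀-degree₀ c (con a) _ = refl
  D₀-degree₀ {m} c (p + q) h = trans
    (+-cong (D₀-degree₀ c p (ℕ.≤-trans (ℕ.m≤m⊔n (expressionDegree p) (expressionDegree q)) h))
            (D₀-degree₀ c q (ℕ.≤-trans (ℕ.m≤n⊔m (expressionDegree p) (expressionDegree q)) h)))
    (+-identity _)
  D₀-degree₀ {m} c (p * q) h = trans
    (+-cong (*-cong (D₀-degree₀ c p (ℕ.≤-trans (ℕ.m≤m+n (expressionDegree p) (expressionDegree q)) h)) refl)
            (*-cong refl (D₀-degree₀ c q (ℕ.≤-trans (ℕ.m≤n+m (expressionDegree q) (expressionDegree p)) h))))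
    (solve 2 (λ p q → :0 :* q :+ p :* :0 := :0) refl (S (divided zero (con c)) p) q)
    where open IntegerSolver (polynomialRing (Fin (suc m)))
  D₀-degree₀ {m} c (- p)   h = trans (-‿cong (D₀-degree₀ c p h)) (solve 0 (:- :0 := :0) refl)
    where open IntegerSolver (polynomialRing (Fin (suc m)))

  S-degree : ∀ {m} c (p : Poly (Fin (suc m))) → expressionDegree (S (divided zero (con c)) p) ≤ expressionDegree p
  S-degree c (con a)       = z≤n
  S-degree c (var zero)    = z≤n
  S-degree c (var (suc i)) = ℕ.≤-refl
  S-degree c (p + q)       = ℕ.⊔-mono-≤ (S-degree c p) (S-degree c q)
  S-degree c (p * q)       = ℕ.+-mono-≤ (S-degree c p) (S-degree c q)
  S-degree c (- p)         = S-degree c p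

  -- The expression `D₀ c p` may itself be too large: for p of degree 0 the summand `D₀ c p * q` of
  -- the product rule still contains all of q. Such a summand is equal to 0, and `con R.0#` is put
  -- in its place.
  D₀-degree : ∀ {m} c (p : Poly (Fin (suc m))) {d} → expressionDegree p ≤ suc d → DegreeAtMost d (D₀ c p)
  D₀-degree c (con a)       h = con R.0# , refl , z≤n
  D₀-degree c (var zero)    h = con R.1# , refl , z≤n
  D₀-degree c (var (suc i)) h = con R.0# , refl , z≤n
  D₀-degree c (p + q)       h =
    let (p′ , p≈ , p≤) = D₀-degree c p (ℕ.≤-trans (ℕ.m≤m⊔n (expressionDegree p) (expressionDegree q)) h)
        (q′ , q≈ , q≤) = D₀-degree c q (ℕ.≤-trans (ℕ.m≤n⊔m (expressionDegree p) (expressionDegree q)) h)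
    in p′ + q′ , +-cong p≈ q≈ , ℕ.⊔-lub p≤ q≤
  D₀-degree c (- p)         h = let (p′ , p≈ , p≤) = D₀-degree c p h in - p′ , -‿cong p≈ , p≤
  D₀-degree {m} c (p * q) {d} h =
    let (u , u≈ , u≤) = first (expressionDegree p) ≡.refl
        (v , v≈ , v≤) = second (expressionDegree q) ≡.refl
    in u + v , +-cong u≈ v≈ , ℕ.⊔-lub u≤ v≤
    where
    open IntegerSolver (polynomialRing (Fin (suc m)))
    first : ∀ k → expressionDegree p ≡ k → DegreeAtMost d (D₀ c p * q)
    first zero    e = con R.0# , trans (solve 1 (λ q → :0 := :0 :* q) refl q)
      (*-cong (sym (D₀-degree₀ c p (ℕ.≤-reflexive e))) refl) , z≤n
    first (suc k) e = let (p′ , p≈ , p≤) = D₀-degree c p (ℕ.≤-reflexive e) in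
      p′ * q , *-cong p≈ refl , ℕ.≤-trans (ℕ.+-monoˡ-≤ (expressionDegree q) p≤)
        (ℕ.s≤s⁻¹ (≡.subst (λ k → k ℕ.+ expressionDegree q ≤ suc d) e h))
    second : ∀ k → expressionDegree q ≡ k → DegreeAtMost d (S (divided zero (con c)) p * D₀ c q)
    second zero    e = con R.0# , trans (solve 1 (λ p → :0 := p :* :0) refl (S (divided zero (con c)) p))
      (*-cong refl (sym (D₀-degree₀ c q (ℕ.≤-reflexive e)))) , z≤n
    second (suc k) e = let (q′ , q≈ , q≤) = D₀-degree c q (ℕ.≤-reflexive e) in
      S (divided zero (con c)) p * q′ , *-cong refl q≈ , ℕ.≤-trans (ℕ.+-mono-≤ (S-degree c p) q≤)
        (ℕ.s≤s⁻¹ (≡.subst (_≤ suc d) (≡.trans (≡.cong (expressionDegree p ℕ.+_) e) (ℕ.+-suc (expressionDegree p) k)) h))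

  newton-degree : ∀ {m} b {d r} (p : Poly (Fin (suc m))) → DegreeAtMost d p → d ℕ.< r → newton b r p ≈ con R.0#
  newton-degree b {zero} {suc r} p (q , q≈p , q≤0) _ = trans
    (Newton.cong (b ∘ suc) r (trans (D-cong (divided zero (con (b 0))) (sym q≈p)) (D₀-degree₀ (b 0) q q≤0)))
    (Newton.0-homo (b ∘ suc) r)
  newton-degree b {suc d} {suc r} p (q , q≈p , q≤d) (s≤s d<r) =
    let (q′ , q′≈ , q′≤) = D₀-degree (b 0) q q≤d in
    newton-degree (b ∘ suc) (D₀ (b 0) p) (q′ , trans q′≈ (D-cong (divided zero (con (b 0))) q≈p) , q′≤) d<r

  newtonCoefficient-degree : ∀ {m} b r (e : Vec ℕ m) p → expressionDegree p ℕ.< r → newtonCoefficient b (r ∷ e) p R.≈ R.0#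
  newtonCoefficient-degree b r e p h = R.trans
    (NewtonCoefficient.cong b e (newton-degree b p (p , refl , ℕ.≤-refl) h)) (NewtonCoefficient.0-homo b e)

  -- p = weaken (E b₀ p) + (x₀ - b₀) D₀ p
  newton-injective : ∀ {m} d b (p : Poly (Fin (suc m))) → DegreeAtMost d p → (∀ r → newton b r p ≈ con R.0#) → p ≈ con R.0#
  newton-injective {m} d b p h e = trans (D-difference T p)
    (trans (+-cong (trans S≈weaken (substitute-cong (var ∘ suc) (e 0))) (*-cong refl (rest d h)))
           (solve 1 (λ ξ → :0 :+ ξ :* :0 := :0) refl (var zero + - con (b 0))))
    where
    open IntegerSolver (polynomialRing (Fin (suc m)))
    T : TwistedDerivation (Fin (suc m))
    T = divided zero (con (b 0))
    S≈weaken : S T p ≈ weaken (E (b 0) p)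
    S≈weaken = trans (substitute-ext (λ { zero → refl ; (suc i) → refl }) p) (sym (≡⇒≈ (substitute-∘ (var ∘ suc) (evaluation (b 0)) p)))
    rest : ∀ d → DegreeAtMost d p → D₀ (b 0) p ≈ con R.0#
    rest zero    (q , q≈p , q≤0) = trans (D-cong T (sym q≈p)) (D₀-degree₀ (b 0) q q≤0)
    rest (suc d) (q , q≈p , q≤d) = let (q′ , q′≈ , q′≤) = D₀-degree (b 0) q q≤d in
      newton-injective d (b ∘ suc) (D₀ (b 0) p) (q′ , trans q′≈ (D-cong T q≈p) , q′≤) (e ∘ suc)

  newtonCoefficient-injective : ∀ {m} b (p : Poly (Fin m)) → (∀ e → newtonCoefficient b e p R.≈ R.0#) → p ≈ con R.0#
  newtonCoefficient-injective {zero}  b p e = trans (con-value p) (con-cong (e []))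
  newtonCoefficient-injective {suc m} b p e = newton-injective (expressionDegree p) b p (p , refl , ℕ.≤-refl)
    λ r → newtonCoefficient-injective b (newton b r p) (λ e′ → e (r ∷ e′))

  exchange : ∀ {m} → Poly (Fin (suc (suc m))) → Poly (Fin (suc (suc m)))
  exchange = substitute (var ∘ adjacent zero)

  D₀-exchange : ∀ {m} c (p : Poly (Fin (suc (suc m)))) → D₀ c (exchange p) ≈ exchange (D₁ c p)
  D₀-exchange c = D-intertwines (divided (suc zero) (con c)) (divided zero (con c)) (var ∘ adjacent zero)
    (λ { zero → refl ; (suc zero) → refl ; (suc (suc i)) → refl })
    (λ { zero → refl ; (suc zero) → refl ; (suc (suc i)) → refl })

  D₁-exchange : ∀ {m} c (p : Poly (Fin (suc (suc m)))) → D₁ c (exchange p) ≈ exchange (D₀ c p)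
  D₁-exchange c = D-intertwines (divided zero (con c)) (divided (suc zero) (con c)) (var ∘ adjacent zero)
    (λ { zero → refl ; (suc zero) → refl ; (suc (suc i)) → refl })
    (λ { zero → refl ; (suc zero) → refl ; (suc (suc i)) → refl })

  D₀-E : ∀ {m} c d (p : Poly (Fin (suc (suc m)))) → D₀ c (E d p) ≈ E d (D₁ c p)
  D₀-E c d = D-intertwines (divided (suc zero) (con c)) (divided zero (con c)) (evaluation d)
    (λ { zero → refl ; (suc zero) → refl ; (suc (suc i)) → refl })
    (λ { zero → refl ; (suc zero) → refl ; (suc (suc i)) → refl })

  D₀-D₁ : ∀ {m} c d (p : Poly (Fin (suc (suc m)))) → D₀ c (D₁ d p) ≈ D₁ d (D₀ c p)
  D₀-D₁ c d = D-commutes (divided zero (con c)) (divided (suc zero) (con d))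
    (λ { zero → refl ; (suc zero) → refl ; (suc (suc i)) → refl })
    (λ { zero → refl ; (suc zero) → refl ; (suc (suc i)) → refl })
    (λ { zero → refl ; (suc zero) → refl ; (suc (suc i)) → refl })
    (λ { zero → refl ; (suc zero) → refl ; (suc (suc i)) → refl })

  D₀-newton : ∀ {m} c b r (p : Poly (Fin (suc (suc m)))) → D₀ c (newton b r p) ≈ newton b r (D₁ c p)
  D₀-newton c b zero    p = D₀-E c (b 0) p
  D₀-newton c b (suc r) p = trans (D₀-newton c (b ∘ suc) r (D₀ (b 0) p))
    (Newton.cong (b ∘ suc) r (sym (D₀-D₁ (b 0) c p)))

  -- The two functionals act on different variables, so their order is immaterial: a divided
  -- difference moved through the other functional becomes `D₁`, and `exchange` turns it back into
  -- `D₀`. Two sequences of nodes are needed since the recursion shifts each of them separately.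
  newton-exchange : ∀ {m} b c s r (p : Poly (Fin (suc (suc m)))) →
                    newton b s (newton c r (exchange p)) ≈ newton c r (newton b s p)
  newton-exchange b c zero zero p = trans (≡⇒≈ (≡.trans
      (≡.cong (E (b 0)) (substitute-∘ (evaluation (c 0)) (var ∘ adjacent zero) p)) (substitute-∘ (evaluation (b 0)) _ p)))
    (trans (substitute-ext (λ { zero → refl ; (suc zero) → refl ; (suc (suc i)) → refl }) p)
           (sym (≡⇒≈ (substitute-∘ (evaluation (c 0)) (evaluation (b 0)) p))))
  newton-exchange b c zero (suc r) p = trans (Newton.cong b 0 (Newton.cong (c ∘ suc) r (D₀-exchange (c 0) p)))
    (trans (newton-exchange b (c ∘ suc) 0 r (D₁ (c 0) p)) (Newton.cong (c ∘ suc) r (sym (D₀-E (c 0) (b 0) p))))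
  newton-exchange b c (suc s) r p = trans (Newton.cong (b ∘ suc) s (trans (D₀-newton (b 0) c r (exchange p))
      (Newton.cong c r (D₁-exchange (b 0) p))))
    (newton-exchange (b ∘ suc) c s r (D₀ (b 0) p))

  Antisymmetric : ∀ {m} → Poly (Fin m) → Set
  Antisymmetric {zero}  p = ⊤
  Antisymmetric {suc m} p = ∀ k → substitute (var ∘ adjacent k) p ≈ - p

  newton-antisymmetric : ∀ {m} b r {p : Poly (Fin (suc m))} → Antisymmetric p → Antisymmetric (newton b r p)
  newton-antisymmetric {zero}  b r anti   = tt
  newton-antisymmetric {suc m} b r {p} anti k = trans (sym (newton-substitute b r (var ∘ adjacent k) p))
    (trans (Newton.cong b r (trans (substitute-ext (λ { zero → refl ; (suc i) → refl }) p) (anti (suc k)))) (Newton.-‿homo b r p))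

  -- For a repeated exponent, antisymmetry says only that the coefficient equals its own negative;
  -- inverting 2 makes it 0.
  module _ (half : ∃ λ h → h R.* (R.1# R.+ R.1#) R.≈ R.1#) where
    private
      x≈-x⇒x≈0 : ∀ {x} → x R.≈ R.- x → x R.≈ R.0#
      x≈-x⇒x≈0 {x} e = begin
        x                                        ≈⟨ R.*-identityˡ x ⟨
        R.1# R.* x                               ≈⟨ R.*-congʳ (proj₂ half) ⟨
        (proj₁ half R.* (R.1# R.+ R.1#)) R.* x
          ≈⟨ solve 2 (λ h x → (h :* (:1 :+ :1)) :* x := h :* (x :+ x)) R.refl (proj₁ half) x ⟩
        proj₁ half R.* (x R.+ x)                 ≈⟨ R.*-congˡ (R.trans (R.+-congˡ e) (R.-‿inverseʳ x)) ⟩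
        proj₁ half R.* R.0#                      ≈⟨ R.zeroʳ _ ⟩
        R.0#                                     ∎
        where
        open IntegerSolver R
        open SetoidReasoning R.setoid

    newtonCoefficient-exchange : ∀ {m} b r s (e : Vec ℕ m) {p} → exchange p ≈ - p →
      newtonCoefficient b (s ∷ r ∷ e) p R.≈ R.- newtonCoefficient b (r ∷ s ∷ e) p
    newtonCoefficient-exchange b r s e {p} anti = R.trans
      (NewtonCoefficient.cong b e (sym (newton-exchange b b s r p)))
      (R.trans (NewtonCoefficient.cong b (r ∷ s ∷ e) anti) (NewtonCoefficient.-‿homo b (r ∷ s ∷ e) p))

    newtonCoefficient-alternating : ∀ {m} b {p : Poly (Fin m)} → Antisymmetric p →
                                    Alternating λ e → newtonCoefficient b e p R.≈ R.0#
    newtonCoefficient-alternating {zero}        b anti = tt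
    newtonCoefficient-alternating {suc zero}    b anti = tt
    newtonCoefficient-alternating {suc (suc m)} b {p} anti =
        (λ r s e z → R.trans (newtonCoefficient-exchange b r s e (anti zero)) (R.trans (R.-‿cong z) -0#≈0#))
      , (λ r e → x≈-x⇒x≈0 (newtonCoefficient-exchange b r r e (anti zero)))
      , (λ r → newtonCoefficient-alternating b (newton-antisymmetric b r {p} anti))
      where open import Algebra.Properties.Ring R.ring using (-0#≈0#)

    -- The Newton coefficients use the same nodes in all variables, so those of an antisymmetric
    -- polynomial alternate in the exponent vector. Sorting reduces the vanishing of all of them to
    -- strictly decreasing exponents.
    antisymmetric-injective : ∀ {m} b {p : Poly (Fin m)} → Antisymmetric p →
      (∀ B e → Below B e → newtonCoefficient b e p R.≈ R.0#) → p ≈ con R.0#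
    antisymmetric-injective b {p} anti z = newtonCoefficient-injective b p
      (alternating {Z = λ e → newtonCoefficient b e p R.≈ R.0#} (newtonCoefficient-alternating b {p} anti) z)

-- Determinants of Kronecker deltas

lookup-below : ∀ {m B} {e : Vec ℕ m} → Below B e → ∀ i → lookup e i ℕ.< B
lookup-below (a<B ∷ e<a) zero    = a<B
lookup-below (a<B ∷ e<a) (suc i) = ℕ.<-trans (lookup-below e<a i) a<B

module KroneckerDeterminant (R : Ring) where
  open CommutativeRing R hiding (zero)
  open RingOps R
  open Determinant R
  open Polynomials R using (kronecker)

  kronecker-diagonal : ∀ r → kronecker r r ≈ 1#
  kronecker-diagonal zero    = refl
  kronecker-diagonal (suc r) = kronecker-diagonal r

  kronecker-≢ : ∀ {r s} → r ≢ s → kronecker r s ≈ 0#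
  kronecker-≢ {zero}  {zero}  r≢s = contradiction ≡.refl r≢s
  kronecker-≢ {zero}  {suc s} r≢s = refl
  kronecker-≢ {suc r} {zero}  r≢s = refl
  kronecker-≢ {suc r} {suc s} r≢s = kronecker-≢ (r≢s ∘ ≡.cong suc)

  matrix : ∀ {m} → Vec ℕ m → Vec ℕ m → Fin m → Fin m → Carrier
  matrix e r i j = kronecker (lookup e i) (lookup r j)

  det-head : ∀ {m} a {e r : Vec ℕ m} → Below a r → det (matrix (a ∷ e) (a ∷ r)) ≈ det (matrix e r)
  det-head {m} a {e} {r} r<a = trans
    (+-cong (trans (*-identityˡ _) (trans (*-congʳ (kronecker-diagonal a)) (*-identityˡ _)))
      (sum≈0 {f = λ j → sign (suc j) * (kronecker a (lookup r j) * minor j)} λ j →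
        trans (*-congˡ (trans (*-congʳ (kronecker-≢ (ℕ.<⇒≢ (lookup-below r<a j) ∘ ≡.sym))) (zeroˡ _))) (zeroʳ _)))
    (+-identityʳ _)
    where
    minor : Fin m → Carrier
    minor j = det λ i k → matrix (a ∷ e) (a ∷ r) (suc i) (punchIn (suc j) k)

  det-kronecker-same : ∀ {m B} {e : Vec ℕ m} → Below B e → det (matrix e e) ≈ 1#
  det-kronecker-same []          = refl
  det-kronecker-same {e = a ∷ e} (a<B ∷ e<a) = trans (det-head a {e} e<a) (det-kronecker-same e<a)

  -- If the heads differ, the larger one exceeds every entry of the other vector, and its row or
  -- column is zero. Equal heads are removed by `det-head`.
  det-kronecker-different : ∀ {m B C} {e r : Vec ℕ m} → Below B e → Below C r → e ≢ r → det (matrix e r) ≈ 0#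
  det-kronecker-different {e = []} {[]} _ _ e≢r = contradiction ≡.refl e≢r
  det-kronecker-different {suc m} {e = a ∷ e} {c ∷ r} (_ ∷ e<a) (_ ∷ r<c) e≢r with ℕ.<-cmp a c
  ... | tri≈ _ ≡.refl _ = trans (det-head a {e} r<c) (det-kronecker-different e<a r<c (e≢r ∘ ≡.cong (a ∷_)))
  ... | tri< a<c _ _ = det-zeroFirstColumn (matrix (a ∷ e) (c ∷ r)) λ
    { zero    → kronecker-≢ (ℕ.<⇒≢ a<c)
    ; (suc i) → kronecker-≢ (ℕ.<⇒≢ (ℕ.<-trans (lookup-below e<a i) a<c)) }
  ... | tri> _ _ c<a = sum≈0 {f = λ j → sign j * (kronecker a (lookup (c ∷ r) j) * minor j)} λ j →
    trans (*-congˡ (trans (*-congʳ (firstRow j)) (zeroˡ _))) (zeroʳ _)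
    where
    minor : Fin (suc m) → Carrier
    minor j = det λ i k → matrix (a ∷ e) (c ∷ r) (suc i) (punchIn j k)
    firstRow : ∀ j → kronecker a (lookup (c ∷ r) j) ≈ 0#
    firstRow zero    = kronecker-≢ (ℕ.<⇒≢ c<a ∘ ≡.sym)
    firstRow (suc j) = kronecker-≢ (ℕ.<⇒≢ (ℕ.<-trans (lookup-below r<c j) c<a) ∘ ≡.sym)

-- Partitions

decreasing? : Decidable (Linked _≥_)
decreasing? = Linked.linked? (λ m n → n ℕ.≤? m)

positive? : Decidable (All (0 ℕ.<_))
positive? = All.all? (0 ℕ.<?_)

decreasing : ∀ ν → Linked _≥_ (parts ν)
decreasing (partition l d p) = recompute (decreasing? l) d

positive : ∀ ν → All (0 ℕ.<_) (parts ν)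
positive (partition l d p) = recompute (positive? l) p

parts-injective : ∀ {μ ν} → parts μ ≡ parts ν → μ ≡ ν
parts-injective ≡.refl = ≡.refl

_≟ₚ_ : DecidableEquality Partition
μ ≟ₚ ν with List.≡-dec ℕ._≟_ (parts μ) (parts ν)
... | yes e = yes (parts-injective e)
... | no ¬e = no (¬e ∘ ≡.cong parts)

tailₚ : Partition → Partition
tailₚ (partition []      _ _) = partition [] [] []
tailₚ (partition (k ∷ l) d p) = partition l (Linked.tail d) (All.tail p)

part-tailₚ : ∀ ν j → part (tailₚ ν) j ≡ part ν (suc j)
part-tailₚ (partition []      _ _) j = ≡.refl
part-tailₚ (partition (k ∷ l) _ _) j = ≡.refl

part-decreasing : ∀ ν j → part ν (suc j) ≤ part ν j
part-decreasing ν@(partition []          _ _) j       = z≤n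
part-decreasing ν@(partition (k ∷ [])    _ _) j       = z≤n
part-decreasing ν@(partition (k ∷ l ∷ m) _ _) zero    = Linked.head (decreasing ν)
part-decreasing ν@(partition (k ∷ l ∷ m) _ _) (suc j) = part-decreasing (tailₚ ν) j

part-≥ℓ : ∀ ν {j} → ℓ ν ≤ j → part ν j ≡ 0
part-≥ℓ (partition []        _ _) h       = ≡.refl
part-≥ℓ ν@(partition (k ∷ l) _ _) (s≤s h) = part-≥ℓ (tailₚ ν) h

part-<ℓ : ∀ ν {j} → j ℕ.< ℓ ν → 0 ℕ.< part ν j
part-<ℓ ν@(partition (k ∷ l) _ _) {zero}  h       = All.head (positive ν)
part-<ℓ ν@(partition (k ∷ l) _ _) {suc j} (s≤s h) = part-<ℓ (tailₚ ν) h

part-injective : ∀ μ ν → (∀ j → part μ j ≡ part ν j) → μ ≡ ν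
part-injective (partition l d p) (partition m d′ p′) e = parts-injective (go l m d p d′ p′ e)
  where
  go : ∀ l m .d .p .d′ .p′ → (∀ j → part (partition l d p) j ≡ part (partition m d′ p′) j) → l ≡ m
  go []      []      _ _ _  _  e = ≡.refl
  go []      (k ∷ m) _ _ d′ p′ e = contradiction (e 0) (ℕ.<⇒≢ (All.head (positive (partition (k ∷ m) d′ p′))))
  go (k ∷ l) []      d p _  _  e = contradiction (≡.sym (e 0)) (ℕ.<⇒≢ (All.head (positive (partition (k ∷ l) d p))))
  go (k ∷ l) (_ ∷ m) d p d′ p′ e =
    ≡.cong₂ _∷_ (e 0) (go l m (Linked.tail d) (All.tail p) (Linked.tail d′) (All.tail p′) (e ∘ suc))

-- The vector λ + δ with δ = (N-1, ..., 1, 0). The lemmas below make it a bijection from partitions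
-- with at most N parts to strictly decreasing vectors of length N.
exponents : Partition → ∀ N → Vec ℕ N
exponents ν N = tabulate (exponent ν N)

exponents-suc : ∀ ν N → exponents ν (suc N) ≡ (part ν 0 ℕ.+ N) ∷ exponents (tailₚ ν) N
exponents-suc ν N = ≡.cong ((part ν 0 ℕ.+ N) ∷_) (Vec.tabulate-cong λ j → ≡.cong (ℕ._+ (N ∸ suc (toℕ j))) (≡.sym (part-tailₚ ν (toℕ j))))

exponents-below : ∀ ν N {c} → part ν 0 ≤ c → Below (c ℕ.+ N) (exponents ν N)
exponents-below ν zero    h = []
exponents-below ν (suc N) {c} h = ≡.subst (Below (c ℕ.+ suc N)) (≡.sym (exponents-suc ν N))
  (ℕ.≤-<-trans (ℕ.+-monoˡ-≤ N h) (ℕ.+-monoʳ-< c (ℕ.n<1+n N)) ∷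
   exponents-below (tailₚ ν) N (≡.subst (_≤ part ν 0) (≡.sym (part-tailₚ ν 0)) (part-decreasing ν 0)))

exponents-injective : ∀ {μ ν} N → ℓ μ ≤ N → ℓ ν ≤ N → exponents μ N ≡ exponents ν N → μ ≡ ν
exponents-injective {μ} {ν} N μ≤N ν≤N e = part-injective μ ν λ j → go j (j ℕ.<? N)
  where
  go : ∀ j → Dec (j ℕ.< N) → part μ j ≡ part ν j
  go j (no j≮N)  = ≡.trans (part-≥ℓ μ (ℕ.≤-trans μ≤N (ℕ.≮⇒≥ j≮N))) (≡.sym (part-≥ℓ ν (ℕ.≤-trans ν≤N (ℕ.≮⇒≥ j≮N))))
  go j (yes j<N) = ≡.subst (λ j → part μ j ≡ part ν j) (Fin.toℕ-fromℕ< j<N)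
    (ℕ.+-cancelʳ-≡ (N ∸ suc (toℕ i)) _ _ (≡.trans (≡.sym (Vec.lookup∘tabulate (exponent μ N) i))
      (≡.trans (≡.cong (λ e → lookup e i) e) (Vec.lookup∘tabulate (exponent ν N) i))))
    where
    i : Fin N
    i = fromℕ< j<N

∅ : Partition
∅ = partition [] [] []

-- A partition cannot store a part 0. When k = 0 the bound forces every part of ν to be 0, so the
-- empty partition serves.
cons : ∀ k ν → part ν 0 ≤ k → ∃ λ μ → (part μ 0 ≡ k) × (∀ j → part μ (suc j) ≡ part ν j) × (ℓ μ ≤ suc (ℓ ν))
cons zero    ν                           h = ∅ , ≡.refl , (λ j → ≡.sym (ℕ.n≤0⇒n≡0 (bounded j))) , z≤n
  where
  bounded : ∀ j → part ν j ≤ 0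
  bounded zero    = h
  bounded (suc j) = ℕ.≤-trans (part-decreasing ν j) (bounded j)
cons (suc k) (partition []      d p)   h = partition (suc k ∷ []) [-] (s≤s z≤n ∷ []) , ≡.refl , (λ j → ≡.refl) , ℕ.≤-refl
cons (suc k) (partition (l ∷ m) d p)   h = partition (suc k ∷ l ∷ m) (h ∷ d) (s≤s z≤n ∷ p) , ≡.refl , (λ j → ≡.refl) , ℕ.≤-refl

exponents-surjective : ∀ {N B} {e : Vec ℕ N} → Below B e → ∃ λ ν → (ℓ ν ≤ N) × (exponents ν N ≡ e)
exponents-surjective []                          = ∅ , z≤n , ≡.refl
exponents-surjective {suc N} {e = a ∷ e} (_ ∷ e<a) =
  let (ν , ν≤N , νe) = exponents-surjective e<a
      -- The first entry of e is part ν 0 + N - 1 and lies below a. So a ∸ N is a true difference,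
      -- and it is at least the first part of ν.
      N+ν≤a = bound ν ν≤N (≡.subst (Below a) (≡.sym νe) e<a)
      (μ , μ₀ , μₛ , ℓμ) = cons (a ∸ N) ν (ℕ.m+n≤o⇒m≤o∸n (part ν 0) N+ν≤a)
  in μ , ℕ.≤-trans ℓμ (s≤s ν≤N) , ≡.cong₂ _∷_
       (≡.trans (≡.cong (ℕ._+ N) μ₀) (ℕ.m∸n+n≡m (ℕ.m+n≤o⇒n≤o (part ν 0) N+ν≤a)))
       (≡.trans (Vec.tabulate-cong λ j → ≡.cong (ℕ._+ (N ∸ suc (toℕ j))) (μₛ (toℕ j))) νe)
  where
  bound : ∀ {N a} ν → ℓ ν ≤ N → Below a (exponents ν N) → part ν 0 ℕ.+ N ≤ a
  bound {zero}  {a} ν ν≤0 []          rewrite part-≥ℓ ν ν≤0 = z≤n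
  bound {suc N} {a} ν ν≤N (h ∷ _) = ≡.subst (_≤ a) (≡.sym (ℕ.+-suc (part ν 0) N)) h

module _ {P : ℕ → Set} (P? : Decidable P) where

  -- For a downward closed property the filtered list is an initial segment, so its length is a
  -- threshold. This translates `diagonal`, defined by counting, into the condition j < part ν j on
  -- a single row.
  filter-initial : ∀ (f : ℕ → ℕ) → (∀ j → P (f (suc j)) → P (f j)) → ∀ n j →
    (j ℕ.< length (filter P? (applyUpTo f n)) → P (f j)) × (j ℕ.< n → P (f j) → j ℕ.< length (filter P? (applyUpTo f n)))
  filter-initial f closed zero    j = (λ ()) , (λ ())
  filter-initial f closed (suc n) j with P? (f 0) | filter-initial (f ∘ suc) (closed ∘ suc) n
  filter-initial f closed (suc n) zero    | yes p | ih = (λ _ → p) , (λ _ _ → s≤s z≤n)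
  filter-initial f closed (suc n) (suc j) | yes p | ih =
    (λ { (s≤s h) → proj₁ (ih j) h }) , (λ { (s≤s h) q → s≤s (proj₂ (ih j) h q) })
  ... | no ¬p | ih = (λ h → contradiction (descend (suc j) (proj₁ (ih j) h)) ¬p)
                   , (λ _ q → contradiction (descend j q) ¬p)
    where
    descend : ∀ j → P (f j) → P (f 0)
    descend zero    q = q
    descend (suc j) q = descend j (closed j q)

<diagonal⇒<part : ∀ ν {j} → j ℕ.< diagonal ν → j ℕ.< part ν j
<diagonal⇒<part ν {j} = proj₁ (filter-initial (λ j → j ℕ.<? part ν j) id
  (λ j h → ℕ.≤-trans (ℕ.<⇒≤ h) (part-decreasing ν j)) (ℓ ν) j)

<part⇒<diagonal : ∀ ν {j} → j ℕ.< part ν j → j ℕ.< diagonal ν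
<part⇒<diagonal ν {j} h = proj₂ (filter-initial (λ j → j ℕ.<? part ν j) id
  (λ j h → ℕ.≤-trans (ℕ.<⇒≤ h) (part-decreasing ν j)) (ℓ ν) j)
  (ℕ.≰⇒> λ ℓ≤j → contradiction (≡.subst (j ℕ.<_) (part-≥ℓ ν ℓ≤j) h) (λ ())) h

private
  boundedLists : ℕ → ℕ → List (List ℕ)
  boundedLists zero    M = [] ∷ []
  boundedLists (suc n) M = [] ∷ concatMap (λ k → List.map (k ∷_) (boundedLists n M)) (upTo (suc M))

  ∈-boundedLists : ∀ {n M l} → length l ≤ n → All (_≤ M) l → l ∈ boundedLists n M
  ∈-boundedLists {zero}  {l = []}    _       _           = here ≡.refl
  ∈-boundedLists {suc n} {l = []}    _       _           = here ≡.refl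
  ∈-boundedLists {suc n} {l = k ∷ l} (s≤s h) (k≤M ∷ l≤M) = there (∈-concatMap⁺ _
    (Any.map (λ { ≡.refl → ∈-map⁺ (_ ∷_) (∈-boundedLists h l≤M) }) (∈-upTo⁺ (s≤s k≤M))))

  toPartition : List ℕ → List Partition
  toPartition l with decreasing? l | positive? l
  ... | yes d | yes p = partition l d p ∷ []
  ... | _     | _     = []

  ∈-toPartition : ∀ ν → ν ∈ toPartition (parts ν)
  ∈-toPartition ν with decreasing? (parts ν) | positive? (parts ν)
  ... | yes d | yes p = here ≡.refl
  ... | no ¬d | _     = contradiction (decreasing ν) ¬d
  ... | yes _ | no ¬p = contradiction (positive ν) ¬p

-- The partitions with at most n parts, all of them at most M
partitionsIn : ℕ → ℕ → List Partition
partitionsIn n M = deduplicate _≟ₚ_ (concatMap toPartition (boundedLists n M))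

partitionsIn-unique : ∀ n M → Unique (partitionsIn n M)
partitionsIn-unique n M = Unique.deduplicate-! _≟ₚ_ (concatMap toPartition (boundedLists n M))

∈-partitionsIn : ∀ {n M} ν → ℓ ν ≤ n → part ν 0 ≤ M → ν ∈ partitionsIn n M
∈-partitionsIn ν@(partition l d p) h h′ = ∈-deduplicate⁺ _≟ₚ_ (∈-concatMap⁺ _
  (Any.map (λ { ≡.refl → ∈-toPartition ν }) (∈-boundedLists h (bounded l d p h′))))
  where
  bounded : ∀ {M} l .d .p → part (partition l d p) 0 ≤ M → All (_≤ M) l
  bounded []      d p h = []
  bounded (k ∷ l) d p h = h ∷ bounded l (Linked.tail d) (All.tail p) (ℕ.≤-trans (part-decreasing (partition (k ∷ l) d p) 0) h)

-- Finite sums and products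

module _ (R : Ring) where
  open CommutativeRing R hiding (zero)

  foldr-kronecker : ∀ {I : Set} (f : I → Carrier) {i} → (∀ {j} → j ≢ i → f j ≈ 0#) →
    ∀ {is} → Unique is → i ∈ is → foldr _+_ 0# (List.map f is) ≈ f i
  foldr-kronecker f {i} z {j ∷ js} (j∉ ∷ u) (here ≡.refl) = trans (+-congˡ (rest js j∉)) (+-identityʳ _)
    where
    rest : ∀ js → All (i ≢_) js → foldr _+_ 0# (List.map f js) ≈ 0#
    rest []       []         = refl
    rest (j ∷ js) (i≢j ∷ h) = trans (+-cong (z (i≢j ∘ ≡.sym)) (rest js h)) (+-identityˡ _)
  foldr-kronecker f {i} z {j ∷ js} (j∉ ∷ u) (there i∈) =
    trans (+-cong (z (All.lookup j∉ i∈)) (foldr-kronecker f z u i∈)) (+-identityˡ _)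

  foldr-zero : ∀ {I : Set} (f : I → Carrier) → ∀ {is} → (∀ {j} → j ∈ is → f j ≈ 0#) → foldr _+_ 0# (List.map f is) ≈ 0#
  foldr-zero f {[]}     z = refl
  foldr-zero f {j ∷ js} z = trans (+-cong (z (here ≡.refl)) (foldr-zero f (z ∘ there))) (+-identityˡ _)

  foldr-cong : ∀ {I : Set} {f g : I → Carrier} → (∀ i → f i ≈ g i) → ∀ is → foldr _+_ 0# (List.map f is) ≈ foldr _+_ 0# (List.map g is)
  foldr-cong e []       = refl
  foldr-cong e (i ∷ is) = +-cong (e i) (foldr-cong e is)

module RangeProduct (R : Ring) where
  open CommutativeRing R hiding (zero)
  open RingOps R
  open Determinant R using (product-cong)

  -- With factors indexed by ℕ instead of `Fin n`, a range can be split or rewritten along an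
  -- equation for its length.
  rangeProduct : ℕ → (ℕ → Carrier) → Carrier
  rangeProduct n f = product {n} (f ∘ toℕ)

  rangeProduct-+ : ∀ m n f → rangeProduct (m ℕ.+ n) f ≈ rangeProduct m f * rangeProduct n (f ∘ (m ℕ.+_))
  rangeProduct-+ zero    n f = sym (*-identityˡ _)
  rangeProduct-+ (suc m) n f = trans (*-congˡ (rangeProduct-+ m n (f ∘ suc))) (sym (*-assoc _ _ _))

  rangeProduct-last : ∀ n f → rangeProduct (suc n) f ≈ f n * rangeProduct n f
  rangeProduct-last zero    f = refl
  rangeProduct-last (suc n) f = trans (*-congˡ (rangeProduct-last n (f ∘ suc)))
    (trans (sym (*-assoc _ _ _)) (trans (*-congʳ (*-comm _ _)) (*-assoc _ _ _)))

  rangeProduct-inverse : ∀ n f g → (∀ k → f k * g k ≈ 1#) → rangeProduct n f * rangeProduct n g ≈ 1#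
  rangeProduct-inverse n f g e = trans (sym (Determinant.product-* R {n} (f ∘ toℕ) (g ∘ toℕ))) (Determinant.product≈1 R {n} λ i → e (toℕ i))

  rangeProduct-cong : ∀ {m n} → m ≡ n → ∀ {f g} → (∀ k → f k ≈ g k) → rangeProduct m f ≈ rangeProduct n g
  rangeProduct-cong {m} ≡.refl e = product-cong {m} (λ i → e (toℕ i))

shift : ∀ m n → ℤ.+ suc m ℤ.- ℤ.+ suc n ≡ ℤ.+ m ℤ.- ℤ.+ n
shift m n = ≡.trans (ℤ.m-n≡m⊖n (suc m) (suc n)) (≡.trans (ℤ.[1+m]⊖[1+n]≡m⊖n m n) (≡.sym (ℤ.m-n≡m⊖n m n)))

m-[m+k]≡-k : ∀ m k → ℤ.+ m ℤ.- ℤ.+ (m ℕ.+ k) ≡ ℤ.- ℤ.+ k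
m-[m+k]≡-k zero    k = ℤ.+-identityˡ (ℤ.- ℤ.+ k)
m-[m+k]≡-k (suc m) k = ≡.trans (shift m (m ℕ.+ k)) (m-[m+k]≡-k m k)

-- Dual Schur functions

module DualPowers (R : Ring) (α : ℤ → ∣ R ∣) where
  open CommutativeRing R hiding (zero)
  open RingOps R
  open PowerSeries R
  open Series R
  open RangeProduct powerSeriesRing
  open RingOps powerSeriesRing using () renaming (_^_ to _^ˢ_)
  open Polynomials R
  open Polynomial R using (con; var; Poly)
  private
    module Q = Polynomial R
    module ≋ = SetoidReasoning P.setoid
  open IntegerSolver powerSeriesRing using (solve; _:=_; _:*_; :1)

  node : ℕ → ℕ → Carrier
  node N k = α (ℤ.+ N ℤ.- ℤ.+ k)

  numerator : ℕ → Series₁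
  numerator N = rangeProduct N λ k → linear (α (ℤ.+ suc k))

  -- The Boolean says whether N ≤ r. For r = λⱼ + N - j this is the case distinction of the matrix
  -- A, and the truncated differences count the factors of A_ij.
  dualFactor : ℕ → ℕ → Bool → Series₁
  dualFactor N r true  = rangeProduct (suc r ∸ N) λ k → geometricSeries (α (ℤ.- ℤ.+ k))
  dualFactor N r false = rangeProduct (N ∸ suc r) λ k → linear (α (ℤ.+ suc k))

  -- The entries of the matrix of a dual Schur function in N variables are
  -- the values of the series dualPower N r.
  dualPower : ℕ → ℕ → Series₁
  dualPower N r = indeterminate ^ˢ r ⊛ dualFactor N r (does (N ℕ.≤? r))

  -- The first m nodes a_{m+s}, ..., a_{s+1} run backwards through the last m factors of the
  -- numerator.
  numerator-factors : ∀ m s → rangeProduct m (linear ∘ node (m ℕ.+ s)) ⊛ numerator s ≋ numerator (m ℕ.+ s)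
  numerator-factors zero    s = P.*-identityˡ (numerator s)
  numerator-factors (suc m) s = ≋.begin
    (linear (node (suc (m ℕ.+ s)) 0) ⊛ rangeProduct m (linear ∘ node (suc (m ℕ.+ s)) ∘ suc)) ⊛ numerator s
      ≋.≈⟨ P.*-congʳ {numerator s} (P.*-cong
             {linear (node (suc (m ℕ.+ s)) 0)} {linear (α (ℤ.+ suc (m ℕ.+ s)))}
             {rangeProduct m (linear ∘ node (suc (m ℕ.+ s)) ∘ suc)} {rangeProduct m (linear ∘ node (m ℕ.+ s))}
             (P.reflexive (≡.cong (linear ∘ α) (ℤ.+-identityʳ (ℤ.+ suc (m ℕ.+ s)))))
             (rangeProduct-cong {m} ≡.refl λ k → P.reflexive (≡.cong (linear ∘ α) (shift (m ℕ.+ s) k)))) ⟩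
    (l ⊛ rangeProduct m (linear ∘ node (m ℕ.+ s))) ⊛ numerator s
      ≋.≈⟨ P.*-assoc l (rangeProduct m (linear ∘ node (m ℕ.+ s))) (numerator s) ⟩
    l ⊛ (rangeProduct m (linear ∘ node (m ℕ.+ s)) ⊛ numerator s)
      ≋.≈⟨ P.*-congˡ {l} (numerator-factors m s) ⟩
    l ⊛ numerator (m ℕ.+ s)
      ≋.≈⟨ rangeProduct-last (m ℕ.+ s) (λ k → linear (α (ℤ.+ suc k))) ⟨
    numerator (suc (m ℕ.+ s))
      ≋.∎
    where
    l : Series₁
    l = linear (α (ℤ.+ suc (m ℕ.+ s)))

  inverses : ∀ m (c : ℕ → Carrier) → rangeProduct m (geometricSeries ∘ c) ⊛ rangeProduct m (linear ∘ c) ≋ P.1#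
  inverses m c = rangeProduct-inverse m (geometricSeries ∘ c) (linear ∘ c) λ k →
    P.trans {geometricSeries (c k) ⊛ linear (c k)} (P.*-comm (geometricSeries (c k)) (linear (c k))) (linear-inverse (c k))

  dualFactor-quotient : ∀ N r (N≤r? : Dec (N ≤ r)) →
    rangeProduct (suc r) (geometricSeries ∘ node N) ⊛ numerator N ≋ dualFactor N r (does N≤r?)
  dualFactor-quotient N r (yes N≤r) = ≋.begin
    rangeProduct (suc r) (geometricSeries ∘ node N) ⊛ numerator N
      ≋.≈⟨ P.*-congʳ {numerator N} (P.trans {rangeProduct (suc r) (geometricSeries ∘ node N)}
             (rangeProduct-cong (≡.sym (ℕ.m+[n∸m]≡n (ℕ.m≤n⇒m≤1+n N≤r))) (λ k → P.refl {geometricSeries (node N k)}))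
             (rangeProduct-+ N l (geometricSeries ∘ node N))) ⟩
    (rangeProduct N (geometricSeries ∘ node N) ⊛ rangeProduct l (geometricSeries ∘ node N ∘ (N ℕ.+_))) ⊛ numerator N
      ≋.≈⟨ P.*-congˡ {rangeProduct N (geometricSeries ∘ node N) ⊛ rangeProduct l (geometricSeries ∘ node N ∘ (N ℕ.+_))} numerator-nodes ⟨
    (rangeProduct N (geometricSeries ∘ node N) ⊛ rangeProduct l (geometricSeries ∘ node N ∘ (N ℕ.+_))) ⊛ rangeProduct N (linear ∘ node N)
      ≋.≈⟨ solve 3 (λ a b c → (a :* b) :* c := (a :* c) :* b) (λ _ → refl)
             (rangeProduct N (geometricSeries ∘ node N)) (rangeProduct l (geometricSeries ∘ node N ∘ (N ℕ.+_))) (rangeProduct N (linear ∘ node N)) ⟩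
    (rangeProduct N (geometricSeries ∘ node N) ⊛ rangeProduct N (linear ∘ node N)) ⊛ rangeProduct l (geometricSeries ∘ node N ∘ (N ℕ.+_))
      ≋.≈⟨ P.*-cong {rangeProduct N (geometricSeries ∘ node N) ⊛ rangeProduct N (linear ∘ node N)} {P.1#}
             {rangeProduct l (geometricSeries ∘ node N ∘ (N ℕ.+_))} {dualFactor N r true} (inverses N (node N))
             (rangeProduct-cong {l} ≡.refl λ k → P.reflexive (≡.cong (geometricSeries ∘ α) (m-[m+k]≡-k N k))) ⟩
    P.1# ⊛ dualFactor N r true
      ≋.≈⟨ P.*-identityˡ (dualFactor N r true) ⟩
    dualFactor N r true
      ≋.∎
    where
    l : ℕ
    l = suc r ∸ N
    numerator-nodes : rangeProduct N (linear ∘ node N) ≋ numerator N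
    numerator-nodes = ≋.begin
      rangeProduct N (linear ∘ node N)
        ≋.≈⟨ rangeProduct-cong {N} ≡.refl {linear ∘ node N} {linear ∘ node (N ℕ.+ 0)}
               (λ k → P.reflexive (≡.cong (λ n → linear (node n k)) (≡.sym (ℕ.+-identityʳ N)))) ⟩
      rangeProduct N (linear ∘ node (N ℕ.+ 0))
        ≋.≈⟨ P.*-identityʳ (rangeProduct N (linear ∘ node (N ℕ.+ 0))) ⟨
      rangeProduct N (linear ∘ node (N ℕ.+ 0)) ⊛ P.1#
        ≋.≈⟨ numerator-factors N 0 ⟩
      numerator (N ℕ.+ 0)
        ≋.≈⟨ P.reflexive (≡.cong numerator (ℕ.+-identityʳ N)) ⟩
      numerator N
        ≋.∎
  dualFactor-quotient N r (no N≰r) = ≋.begin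
    g ⊛ numerator N
      ≋.≈⟨ P.*-congˡ {g} (P.sym {rangeProduct (suc r) (linear ∘ node N) ⊛ numerator s} (≡.subst
             (λ n → rangeProduct (suc r) (linear ∘ node n) ⊛ numerator s ≋ numerator n)
             (ℕ.m+[n∸m]≡n (ℕ.≰⇒> N≰r)) (numerator-factors (suc r) s))) ⟩
    g ⊛ (rangeProduct (suc r) (linear ∘ node N) ⊛ numerator s)
      ≋.≈⟨ P.*-assoc g (rangeProduct (suc r) (linear ∘ node N)) (numerator s) ⟨
    (g ⊛ rangeProduct (suc r) (linear ∘ node N)) ⊛ numerator s
      ≋.≈⟨ P.*-congʳ {numerator s} (inverses (suc r) (node N)) ⟩
    P.1# ⊛ numerator s
      ≋.≈⟨ P.*-identityˡ (numerator s) ⟩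
    numerator s
      ≋.∎
    where
    s : ℕ
    s = N ∸ suc r
    g : Series₁
    g = rangeProduct (suc r) (geometricSeries ∘ node N)

  -- The coefficients of g(t) / (1 - x t)
  quotient : Series₁ → ℕ → Poly (Fin 1)
  quotient g zero    = con (g 0)
  quotient g (suc k) = var zero Q.* quotient g k Q.+ con (g (suc k))

  geometricSeries-⊛-suc : ∀ c g k → (geometricSeries c ⊛ g) (suc k) ≈ c * (geometricSeries c ⊛ g) k + g (suc k)
  geometricSeries-⊛-suc c g k = trans (+-cong (*-identityˡ _) (·-⊛ c (geometricSeries c) g k)) (+-comm _ _)

  geometricSeries-⊛-zero : ∀ c g → (geometricSeries c ⊛ g) 0 ≈ g 0
  geometricSeries-⊛-zero c g = trans (⊛-zero (geometricSeries c) g) (*-identityˡ _)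

  S-quotient : ∀ c g k → TwistedDerivation.S (divided zero (con c)) (quotient g k) Q.≈ con ((geometricSeries c ⊛ g) k)
  S-quotient c g zero    = Q.con-cong (sym (geometricSeries-⊛-zero c g))
  S-quotient c g (suc k) = Q.trans (Q.+-cong (Q.*-cong Q.refl (S-quotient c g k)) Q.refl)
    (Q.trans (Q.+-cong (Q.sym (Q.con-* c _)) Q.refl)
    (Q.trans (Q.sym (Q.con-+ _ _)) (Q.con-cong (sym (geometricSeries-⊛-suc c g k)))))

  value-quotient : ∀ c g k → value (E c (quotient g k)) ≈ (geometricSeries c ⊛ g) k
  value-quotient c g zero    = sym (geometricSeries-⊛-zero c g)
  value-quotient c g (suc k) = trans (+-congʳ (*-congˡ (value-quotient c g k))) (sym (geometricSeries-⊛-suc c g k))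

  -- The divided difference of 1 / (1 - x t) in x at c is t / ((1 - x t)(1 - c t)): the same shape,
  -- with g multiplied by t / (1 - c t).
  D₀-quotient : ∀ c g k → D₀ c (quotient g k) Q.≈ quotient (indeterminate ⊛ (geometricSeries c ⊛ g)) k
  D₀-quotient c g zero    = Q.con-cong (sym (indeterminate-zero (geometricSeries c ⊛ g)))
  D₀-quotient c g (suc k) = Q.trans
    (Q.+-cong (Q.+-cong (Q.*-cong Q.refl (Q.trans (TwistedDerivation.D-difference (divided zero (con c)) (quotient g k))
       (Q.+-cong (S-quotient c g k) Q.refl))) Q.refl) Q.refl)
    (Q.trans (solve₁ 4 (λ h x c d → (:1₁ :*₁ (h :+₁ (x :+₁ (:-₁ c)) :*₁ d) :+₁ c :*₁ d) :+₁ :0₁ :=₁ x :*₁ d :+₁ h) Q.refl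
       (con ((geometricSeries c ⊛ g) k)) (var zero) (con c) (D₀ c (quotient g k)))
    (Q.+-cong (Q.*-cong Q.refl (D₀-quotient c g k)) (Q.con-cong (sym (indeterminate-⊛ (geometricSeries c ⊛ g) k)))))
    where open IntegerSolver (Q.polynomialRing (Fin 1)) using () renaming (solve to solve₁; _:*_ to _:*₁_; _:+_ to _:+₁_; :-_ to :-₁_; _:=_ to _:=₁_; :1 to :1₁; :0 to :0₁)

  -- Each of the r divided differences contributes t / (1 - b_k t), and the final evaluation at b_r
  -- contributes one more denominator without a t.
  newton-quotient : ∀ b r g k → newtonCoefficient₁ b r (quotient g k) ≈
                    ((indeterminate ^ˢ r ⊛ rangeProduct (suc r) (geometricSeries ∘ b)) ⊛ g) k
  newton-quotient b zero g k = trans (value-quotient (b 0) g k)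
    (solve 2 (λ p g → p :* g := (:1 :* (p :* :1)) :* g) (λ _ → refl) (geometricSeries (b 0)) g k)
  newton-quotient b (suc r) g k = trans
    (NewtonCoefficient.cong (b ∘ suc) (r ∷ []) (D₀-quotient (b 0) g k))
    (trans (newton-quotient (b ∘ suc) r (indeterminate ⊛ (geometricSeries (b 0) ⊛ g)) k)
           (solve 5 (λ t tr p q g → (tr :* p) :* (t :* (q :* g)) := ((t :* tr) :* (q :* p)) :* g) (λ _ → refl)
             indeterminate (indeterminate ^ˢ r) (rangeProduct (suc r) (geometricSeries ∘ b ∘ suc)) (geometricSeries (b 0)) g k))

  newton-numerator : ∀ N r k → newtonCoefficient₁ (node N) r (quotient (numerator N) k) ≈ dualPower N r k
  newton-numerator N r k = trans (newton-quotient (node N) r (numerator N) k)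
    (P.trans {(indeterminate ^ˢ r ⊛ rangeProduct (suc r) (geometricSeries ∘ node N)) ⊛ numerator N}
      (P.*-assoc (indeterminate ^ˢ r) (rangeProduct (suc r) (geometricSeries ∘ node N)) (numerator N))
      (P.*-congˡ {indeterminate ^ˢ r} (dualFactor-quotient N r (N ℕ.≤? r))) k)

  quotient-[] : ∀ {V} g (p : Poly V) k → (quotient g k [ p ]) Q.≈
    PowerSeries._⊛_ (Q.polynomialRing V) (con ∘ g) (PowerSeries.geometricSeries (Q.polynomialRing V) p) k
  quotient-[] {V} g p k = Q.trans (go k) (PowerSeries.⊛-comm (Q.polynomialRing V) (PowerSeries.geometricSeries (Q.polynomialRing V) p) (con ∘ g) k)
    where
    module A = PowerSeries (Q.polynomialRing V)
    go : ∀ k → (quotient g k [ p ]) Q.≈ (A.geometricSeries p A.⊛ (con ∘ g)) k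
    go zero    = Q.sym (Q.trans (A.⊛-zero (A.geometricSeries p) (con ∘ g)) (Q.*-identity _))
    go (suc k) = Q.trans (Q.+-cong (Q.*-cong Q.refl (go k)) Q.refl)
      (Q.sym (Q.trans (Q.+-cong (Q.*-identity _) (A.·-⊛ p (A.geometricSeries p) (con ∘ g) k)) (Q.+-comm _ _)))

  module Generating (N : ℕ) where
    A : Ring
    A = Q.polynomialRing (Fin N)

    private
      module MA = MultivariateSeries A
      module MR = MultivariateSeries R
      module A = CommutativeRing A
      module AS = PowerSeries A
      module Â = CommutativeRing (MA.seriesRing N)
      module R̂ = CommutativeRing (MR.seriesRing N)
      module M = Multivariate A
      module DÂ = Determinant (MA.seriesRing N)
      module OÂ = RingOps (MA.seriesRing N)
      module OR̂ = RingOps (MR.seriesRing N)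

    generatingSeries : AS.Series₁
    generatingSeries = (con ∘ numerator N) AS.⊛ RingOps.product AS.powerSeriesRing (AS.geometricSeries ∘ var)

    private
      y : Fin N → ∣ MA.seriesRing N ∣
      y = MA.x N

      V : Poly (Fin N)
      V = RingOps.vandermonde A var

      row : Fin N → AS.Series₁
      row j = (con ∘ numerator N) AS.⊛ AS.geometricSeries (var j)

      kernel : ∣ MA.seriesRing N ∣
      kernel = MA.scalar N V Â.* OÂ.product λ i → M.embed N i generatingSeries

      -- Row i is a Cauchy row multiplied by the numerator in yᵢ. In Cauchy's formula these row
      -- factors complete the product of the 1 / (1 - xⱼ yᵢ) to the generating series at each yᵢ.
      det-rows : OÂ.det (λ i j → M.embed N i (row j)) Â.≈ OÂ.vandermonde y Â.* kernel
      det-rows = begin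
        OÂ.det (λ i j → M.embed N i (row j))
          ≈⟨ DÂ.det-cong {N = λ i j → c i Â.* g i j} (λ i j → Â.trans {M.embed N i (row j)}
               (Hom.*-homo (M.embed-hom N i) (con ∘ numerator N) (AS.geometricSeries (var j)))
               (Â.*-congˡ {c i} (M.embed-geometricSeries N i (var j)))) ⟩
        OÂ.det (λ i j → c i Â.* g i j)
          ≈⟨ DÂ.det-rowScale c g ⟩
        OÂ.product c Â.* OÂ.det g
          ≈⟨ Â.*-congˡ {OÂ.product c} (DÂ.cauchy y (MA.scalar N ∘ var) g inverse) ⟩
        OÂ.product c Â.* ((OÂ.vandermonde y Â.* OÂ.vandermonde (MA.scalar N ∘ var)) Â.* OÂ.product (λ i → OÂ.product (g i)))
          ≈⟨ solveÂ 4 (λ c v w p → c *Â ((v *Â w) *Â p) =Â v *Â (w *Â (c *Â p))) Â.refl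
               (OÂ.product c) (OÂ.vandermonde y) (OÂ.vandermonde (MA.scalar N ∘ var)) (OÂ.product λ i → OÂ.product (g i)) ⟩
        OÂ.vandermonde y Â.* (OÂ.vandermonde (MA.scalar N ∘ var) Â.* (OÂ.product c Â.* OÂ.product (λ i → OÂ.product (g i))))
          ≈⟨ Â.*-congˡ {OÂ.vandermonde y} (Â.*-cong
               {OÂ.vandermonde (MA.scalar N ∘ var)}
               (Â.sym {MA.scalar N V} (Hom.vandermonde-homo (M.scalar-hom N) var))
               (Â.trans {OÂ.product c Â.* OÂ.product (λ i → OÂ.product (g i))}
                 (Â.sym {OÂ.product (λ i → c i Â.* OÂ.product (g i))} (DÂ.product-* c (λ i → OÂ.product (g i))))
                 (DÂ.product-cong {N} {λ i → c i Â.* OÂ.product (g i)} (λ i → Â.sym {M.embed N i generatingSeries} (embed-generatingSeries i))))) ⟩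
        OÂ.vandermonde y Â.* kernel
          ∎
        where
        open SetoidReasoning Â.setoid
        open IntegerSolver (MA.seriesRing N) using () renaming (solve to solveÂ; _:*_ to _*Â_; _:=_ to _=Â_)
        c : Fin N → ∣ MA.seriesRing N ∣
        c i = M.embed N i (con ∘ numerator N)
        g : Fin N → Fin N → ∣ MA.seriesRing N ∣
        g i j = MA.geometric N (var j) i
        inverse : ∀ i j → (Â.1# Â.- y i Â.* MA.scalar N (var j)) Â.* g i j Â.≈ Â.1#
        inverse i j = Â.trans {(Â.1# Â.- y i Â.* MA.scalar N (var j)) Â.* g i j}
          (Â.*-congʳ {g i j} (Â.+-congˡ {Â.1#} (Â.-‿cong (Â.*-comm (y i) (MA.scalar N (var j))))))
          (MA.geometric-inverse N (var j) i)
        embed-generatingSeries : ∀ i → M.embed N i generatingSeries Â.≈ c i Â.* OÂ.product (g i)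
        embed-generatingSeries i = Â.trans {M.embed N i generatingSeries}
          (Hom.*-homo (M.embed-hom N i) (con ∘ numerator N) (RingOps.product AS.powerSeriesRing (AS.geometricSeries ∘ var)))
          (Â.*-congˡ {c i} (Â.trans {M.embed N i (RingOps.product AS.powerSeriesRing (AS.geometricSeries ∘ var))}
            (Hom.product-homo (M.embed-hom N i) (AS.geometricSeries ∘ var))
            (DÂ.product-cong {N} λ j → M.embed-geometricSeries N i (var j))))

    dualMatrix : Vec ℕ N → Fin N → Fin N → ∣ MR.seriesRing N ∣
    dualMatrix e i j = Multivariate.embed R N i (dualPower N (lookup e j))

    -- The Cauchy determinant is the generating function of the polynomials
    -- quotient (numerator N); the Newton coefficients of these are dual powers.
    dualSchur-coefficient : ∀ e f → OR̂.IsBialternant (MR.x N) (dualMatrix e) f → ∀ β →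
      MR.coefficient N β f ≈ newtonCoefficient (node N) e (V A.* RingOps.product A (λ i → generatingSeries (lookup β i)))
    dualSchur-coefficient e f bialternant β = begin
      MR.coefficient N β f
        ≈⟨ Multivariate.Coefficient.cong R N β (regular-cancel (MR.seriesRing N) (Multivariate.vandermonde-x-regular R N)
             {f} {φ̂ kernel}
             (R̂.trans {OR̂.vandermonde x R̂.* f} (R̂.trans {OR̂.vandermonde x R̂.* f} (R̂.*-comm (OR̂.vandermonde x) f) bialternant)
               (R̂.sym {OR̂.vandermonde x R̂.* φ̂ kernel} vandermonde-φ̂))) ⟩
      MR.coefficient N β (φ̂ kernel)
        ≡⟨ coefficient-map A R φ N β kernel ⟩
      φ (MA.coefficient N β kernel)
        ≈⟨ Φ.cong (M.coefficient-scalar N β V (OÂ.product λ i → M.embed N i generatingSeries)) ⟩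
      φ (V A.* MA.coefficient N β (OÂ.product λ i → M.embed N i generatingSeries))
        ≈⟨ Φ.cong (Q.*-cong Q.refl (M.coefficient-product N β λ i → generatingSeries)) ⟩
      φ (V A.* RingOps.product A (λ i → generatingSeries (lookup β i)))
        ∎
      where
      open SetoidReasoning setoid
      x : Fin N → ∣ MR.seriesRing N ∣
      x = MR.x N
      φ : Poly (Fin N) → Carrier
      φ = newtonCoefficient (node N) e
      module Φ = NewtonCoefficient (node N) e
      φ̂ : ∣ MA.seriesRing N ∣ → ∣ MR.seriesRing N ∣
      φ̂ = mapCoefficients A R φ N
      φ̂-det : ∀ β → MR.coefficient N β (φ̂ (OÂ.det λ i j → M.embed N i (row j))) ≈
                     MR.coefficient N β (OR̂.det (dualMatrix e))
      φ̂-det β = begin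
        MR.coefficient N β (φ̂ (OÂ.det λ i j → M.embed N i (row j)))
          ≡⟨ coefficient-map A R φ N β (OÂ.det λ i j → M.embed N i (row j)) ⟩
        φ (MA.coefficient N β (OÂ.det λ i j → M.embed N i (row j)))
          ≈⟨ Φ.cong (M.coefficient-det N β λ i j → row j) ⟩
        φ (RingOps.det A λ i j → row j (lookup β i))
          ≈⟨ Φ.cong (Determinant.det-cong A {M = λ i j → row j (lookup β i)} λ i j → Q.sym (quotient-[] (numerator N) (var j) (lookup β i))) ⟩
        φ (RingOps.det A λ i j → quotient (numerator N) (lookup β i) [ var j ])
          -- `newtonCoefficient-det` wants row i to involve only xᵢ, whereas up to here row i
          -- belongs to yᵢ. A second transposition below returns to rows indexed by y.
          ≈⟨ Φ.cong (Determinant.det-transpose A λ i j → quotient (numerator N) (lookup β j) [ var i ]) ⟩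
        φ (RingOps.det A λ i j → quotient (numerator N) (lookup β j) [ var i ])
          ≈⟨ newtonCoefficient-det (node N) e (λ j → quotient (numerator N) (lookup β j)) ⟩
        det (λ i j → newtonCoefficient₁ (node N) (lookup e i) (quotient (numerator N) (lookup β j)))
          ≈⟨ Determinant.det-cong R (λ i j → newton-numerator N (lookup e i) (lookup β j)) ⟩
        det (λ i j → dualPower N (lookup e i) (lookup β j))
          ≈⟨ Determinant.det-transpose R (λ i j → dualPower N (lookup e j) (lookup β i)) ⟩
        det (λ i j → dualPower N (lookup e j) (lookup β i))
          ≈⟨ Multivariate.coefficient-det R N β (λ i j → dualPower N (lookup e j)) ⟨
        MR.coefficient N β (OR̂.det (dualMatrix e))
          ∎
      vandermonde-φ̂ : OR̂.vandermonde x R̂.* φ̂ kernel R̂.≈ OR̂.det (dualMatrix e)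
      vandermonde-φ̂ = R̂.trans {OR̂.vandermonde x R̂.* φ̂ kernel}
        -- V(y) has coefficients in the base ring, so it can be moved inside φ̂, where it completes
        -- the kernel to the Cauchy determinant.
        (R̂.sym {φ̂ (lift (OR̂.vandermonde x) Â.* kernel)}
          (mapCoefficients-linear A R Φ-additive (newtonCoefficient-linear (node N) e) N (OR̂.vandermonde x) kernel))
        (R̂.trans {φ̂ (lift (OR̂.vandermonde x) Â.* kernel)} (φ̂-cong (Â.trans {lift (OR̂.vandermonde x) Â.* kernel}
            (Â.*-congʳ {kernel} lift-vandermonde)
            (Â.sym {OÂ.det λ i j → M.embed N i (row j)} det-rows)))
          (Multivariate.coefficient-injective R N φ̂-det))
        where
        Φ-additive : Additive A R φ
        Φ-additive = newtonCoefficient-additive (node N) e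
        φ̂-cong : ∀ {F G} → F Â.≈ G → φ̂ F R̂.≈ φ̂ G
        φ̂-cong = Additive.cong (mapCoefficients-additive A R Φ-additive N)
        lift : ∣ MR.seriesRing N ∣ → ∣ MA.seriesRing N ∣
        lift = mapCoefficients R A con N
        lift-vandermonde : lift (OR̂.vandermonde x) Â.≈ OÂ.vandermonde y
        lift-vandermonde = Â.trans {lift (OR̂.vandermonde x)}
          (Hom.vandermonde-homo (mapCoefficients-hom R A con-hom N) x)
          (DÂ.vandermonde-cong (mapCoefficients-x R A con-hom N))

-- Stability of the dual Schur functions and their matrix entries

[m+o]∸[n+o]≡m∸n : ∀ m n o → (m ℕ.+ o) ∸ (n ℕ.+ o) ≡ m ∸ n
[m+o]∸[n+o]≡m∸n m n o = ≡.trans (≡.cong₂ _∸_ (ℕ.+-comm m o) (ℕ.+-comm n o)) (ℕ.[m+n]∸[m+o]≡n∸o o m n)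

punchIn-fromℕ : ∀ {n} (k : Fin n) → punchIn (fromℕ n) k ≡ inject₁ k
punchIn-fromℕ zero    = ≡.refl
punchIn-fromℕ (suc k) = ≡.cong suc (punchIn-fromℕ k)

exponent-inject₁ : ∀ ν {n} (j : Fin n) → exponent ν (suc n) (inject₁ j) ≡ suc (exponent ν n j)
exponent-inject₁ ν {n} j rewrite Fin.toℕ-inject₁ j =
  ≡.trans (≡.cong (part ν (toℕ j) ℕ.+_) (≡.sym (ℕ.suc-pred (n ∸ toℕ j) {{ℕ.>-nonZero (ℕ.m<n⇒0<n∸m (Fin.toℕ<n j))}})))
  (≡.trans (ℕ.+-suc _ _) (≡.cong (λ m → suc (part ν (toℕ j) ℕ.+ m)) (ℕ.pred[m∸n]≡m∸[1+n] n (toℕ j))))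

exponent-fromℕ : ∀ ν n → exponent ν (suc n) (fromℕ n) ≡ part ν n
exponent-fromℕ ν n rewrite Fin.toℕ-fromℕ n | ℕ.n∸n≡0 n = ℕ.+-identityʳ _

module Stability (R : Ring) (α : ℤ → ∣ R ∣) where
  open CommutativeRing R hiding (zero)
  open PowerSeries R
  open Series R
  open DualPowers R α
  open RingOps powerSeriesRing using () renaming (_^_ to _^ˢ_)
  open MultivariateSeries R
  open Multivariate R using (embed; embed-hom; embed-indeterminate; scalar-hom; x-regular; vandermonde-x-regular)
  private
    module S n = CommutativeRing (seriesRing n)
    module O n = RingOps (seriesRing n)

  dualFactor-suc : ∀ n r b → dualFactor (suc n) (suc r) b ≡ dualFactor n r b
  dualFactor-suc n r true  = ≡.refl
  dualFactor-suc n r false = ≡.refl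

  does-suc : ∀ n r → does (suc n ℕ.≤? suc r) ≡ does (n ℕ.≤? r)
  does-suc zero    r = ≡.refl
  does-suc (suc n) r = ≡.refl

  -- The correction factor depends only on how n and r compare and on their difference, so raising
  -- both by 1 merely adds a power of t.
  dualPower-suc : ∀ n r → dualPower (suc n) (suc r) ≋ indeterminate ⊛ dualPower n r
  dualPower-suc n r = P.trans {dualPower (suc n) (suc r)}
    (P.*-congˡ {indeterminate ⊛ indeterminate ^ˢ r} (P.reflexive
      (≡.trans (dualFactor-suc n r (does (suc n ℕ.≤? suc r))) (≡.cong (dualFactor n r) (does-suc n r)))))
    (P.*-assoc indeterminate (indeterminate ^ˢ r) (dualFactor n r (does (n ℕ.≤? r))))

  dualPower-suc-0 : ∀ n r → dualPower n (suc r) 0 ≈ 0#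
  dualPower-suc-0 n r = trans (P.*-assoc indeterminate (indeterminate ^ˢ r) factor 0) (indeterminate-zero (indeterminate ^ˢ r ⊛ factor))
    where
    factor : Series₁
    factor = dualFactor n (suc r) (does (n ℕ.≤? suc r))

  dualPower-0-0 : ∀ n → dualPower (suc n) 0 0 ≈ 1#
  dualPower-0-0 n = trans (P.*-identityˡ (dualFactor (suc n) 0 false) 0)
    (trans (Hom.product-homo evaluate₀-hom {n} (λ i → linear (α (ℤ.+ suc (toℕ i)))))
           (Determinant.product≈1 R {n} λ i → linear-zero (α (ℤ.+ suc (toℕ i)))))

  matrix : Partition → ∀ n → Fin n → Fin n → ∣ seriesRing n ∣
  matrix ν n i j = embed n i (dualPower n (exponent ν n j))

  IsDualSchurAt : Partition → ∀ n → ∣ seriesRing n ∣ → Set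
  IsDualSchurAt ν n f = (ℓ ν ≤ n → O.IsBialternant n (x n) (matrix ν n) f) × (n ℕ.< ℓ ν → S._≈_ n f (S.0# n))

  module _ (n : ℕ) (ν : Partition) where
    private
      module C = CommutativeRing (seriesRing n)
      module O′ = RingOps (seriesRing n)
      module O″ = RingOps (seriesRing (suc n))
      module D = Determinant (seriesRing n)
      open SetoidReasoning C.setoid
      V : C.Carrier
      V = O′.vandermonde (x n)

      Π- : C.Carrier
      Π- = O′.product λ j → C.0# C.- x n j

      vandermonde₀ : O″.vandermonde (x (suc n)) 0 C.≈ Π- C.* V
      vandermonde₀ = C.trans (Hom.vandermonde-homo (Series.evaluate₀-hom (seriesRing n)) (x (suc n)))
        (D.vandermonde-suc (λ i → x (suc n) i 0))

      Π-V-regular : Regular (seriesRing n) (Π- C.* V)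
      Π-V-regular = *-regular (seriesRing n)
        (product-regular (seriesRing n) (λ j → C.0# C.- x n j) λ j f e → x-regular n j f
          (begin
            x n j C.* f
              ≈⟨ solve 2 (λ x f → x :* f := :- ((:0 :- x) :* f)) C.refl (x n j) f ⟩
            C.- ((C.0# C.- x n j) C.* f)
              ≈⟨ C.-‿cong e ⟩
            C.- C.0#
              ≈⟨ solve 0 (:- :0 := :0) C.refl ⟩
            C.0#
              ∎))
        (vandermonde-x-regular n)
        where open IntegerSolver (seriesRing n)

      row₀ : Fin (suc n) → C.Carrier
      row₀ j = scalar n (dualPower (suc n) (exponent ν (suc n) j) 0)

      minor : Fin (suc n) → C.Carrier
      minor j = O′.det λ i k → embed n i (dualPower (suc n) (exponent ν (suc n) (punchIn j k)))

      term : Fin (suc n) → C.Carrier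
      term j = D.sign j C.* (row₀ j C.* minor j)

      det₀ : O″.det (matrix ν (suc n)) 0 C.≈ O′.sum term
      det₀ = Hom.det-homo (Series.evaluate₀-hom (seriesRing n)) (matrix ν (suc n))

      row₀-suc : ∀ j {r} → exponent ν (suc n) j ≡ suc r → row₀ j C.≈ C.0#
      row₀-suc j {r} e = C.trans (Hom.cong (scalar-hom n)
        (trans (reflexive (≡.cong (λ r → dualPower (suc n) r 0) e)) (dualPower-suc-0 (suc n) r)))
        (Hom.0-homo (scalar-hom n))

      term-zero : ∀ j → row₀ j C.≈ C.0# → term j C.≈ C.0#
      term-zero j e = C.trans (C.*-congˡ (C.trans (C.*-congʳ e) (C.zeroˡ _))) (C.zeroʳ _)

      -- At first variable 0 the top row is (0, ..., 0, 1): all exponents but the last are positive,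
      -- and the last one is `part ν n`, which is 0. Raising n by 1 raises the other exponents by 1,
      -- so row i of the remaining minor acquires a factor xᵢ.
      lastTerm : ℓ ν ≤ n → O′.sum term C.≈ D.sign (fromℕ n) C.* (O′.product (x n) C.* O′.det (matrix ν n))
      lastTerm ν≤n = begin
        O′.sum term
          ≈⟨ sum-init-last term ⟩
        O′.sum (term ∘ inject₁) C.+ term (fromℕ n)
          ≈⟨ C.+-congʳ (D.sum≈0 {f = term ∘ inject₁} λ j → term-zero (inject₁ j) (row₀-suc (inject₁ j) (exponent-inject₁ ν j))) ⟩
        C.0# C.+ term (fromℕ n)
          ≈⟨ C.+-identityˡ _ ⟩
        D.sign (fromℕ n) C.* (row₀ (fromℕ n) C.* minor (fromℕ n))
          ≈⟨ C.*-congˡ (C.trans (C.*-congʳ row₀-last) (C.*-identityˡ _)) ⟩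
        D.sign (fromℕ n) C.* minor (fromℕ n)
          ≈⟨ C.*-congˡ (D.det-cong {N = λ i k → x n i C.* matrix ν n i k} λ i k → C.trans
               (Hom.cong (embed-hom n i) (P.trans {dualPower (suc n) (exponent ν (suc n) (punchIn (fromℕ n) k))}
                 (P.reflexive (≡.cong (dualPower (suc n)) (≡.trans (≡.cong (exponent ν (suc n)) (punchIn-fromℕ k)) (exponent-inject₁ ν k))))
                 (dualPower-suc n (exponent ν n k))))
               (C.trans (Hom.*-homo (embed-hom n i) indeterminate (dualPower n (exponent ν n k))) (C.*-congʳ (embed-indeterminate n i)))) ⟩
        D.sign (fromℕ n) C.* O′.det (λ i k → x n i C.* matrix ν n i k)
          ≈⟨ C.*-congˡ (D.det-rowScale (x n) (matrix ν n)) ⟩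
        D.sign (fromℕ n) C.* (O′.product (x n) C.* O′.det (matrix ν n))
          ∎
        where
        open import Algebra.Properties.Monoid.Sum C.+-monoid using (sum-init-last)
        row₀-last : row₀ (fromℕ n) C.≈ C.1#
        row₀-last = C.trans (Hom.cong (scalar-hom n) (trans
          (reflexive (≡.cong (λ r → dualPower (suc n) r 0) (≡.trans (exponent-fromℕ ν n) (part-≥ℓ ν ν≤n)))) (dualPower-0-0 n)))
          (Hom.1-homo (scalar-hom n))

      signed-product : ∀ {m} (y : Fin m → C.Carrier) → (C.- C.1#) O′.^ m C.* O′.product y C.≈ O′.product λ j → C.0# C.- y j
      signed-product {zero}  y = C.*-identityˡ _
      signed-product {suc m} y = C.trans
        (solve 3 (λ s y p → (:- :1 :* s) :* (y :* p) := (:0 :- y) :* (s :* p)) C.refl ((C.- C.1#) O′.^ m) (y zero) (O′.product (y ∘ suc)))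
        (C.*-congˡ (signed-product (y ∘ suc)))
        where open IntegerSolver (seriesRing n)

    -- The variable set to 0 is the first, since it is the outermost one of `seriesRing`. For ℓ(ν) ≤
    -- n the factor ∏ (-xⱼ) of the Vandermonde product matches the signed row factors of the
    -- determinant; for ℓ(ν) = n + 1 all exponents are positive, so the top row vanishes; beyond
    -- that both functions are 0.
    stable₀ : ∀ {f g} → IsDualSchurAt ν (suc n) f → IsDualSchurAt ν n g → f 0 C.≈ g
    stable₀ {f} {g} (bf , zf) (bg , zg) with ℕ.<-cmp (ℓ ν) (suc n)
    ... | tri< (s≤s ν≤n) _ _ = regular-cancel (seriesRing n) Π-V-regular (begin
      (Π- C.* V) C.* f 0
        ≈⟨ C.trans (C.*-comm _ _) (C.*-congˡ (C.sym vandermonde₀)) ⟩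
      f 0 C.* O″.vandermonde (x (suc n)) 0
        ≈⟨ PowerSeries.⊛-zero (seriesRing n) f (O″.vandermonde (x (suc n))) ⟨
      (PowerSeries._⊛_ (seriesRing n) f (O″.vandermonde (x (suc n)))) 0
        ≈⟨ bf (ℕ.m≤n⇒m≤1+n ν≤n) 0 ⟩
      O″.det (matrix ν (suc n)) 0
        ≈⟨ C.trans det₀ (lastTerm ν≤n) ⟩
      D.sign (fromℕ n) C.* (O′.product (x n) C.* O′.det (matrix ν n))
        ≈⟨ C.*-assoc _ _ _ ⟨
      (D.sign (fromℕ n) C.* O′.product (x n)) C.* O′.det (matrix ν n)
        ≈⟨ C.*-cong (C.trans (C.*-congʳ (C.reflexive (≡.cong ((C.- C.1#) O′.^_) (Fin.toℕ-fromℕ n)))) (signed-product (x n)))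
             (C.trans (C.sym (bg ν≤n)) (C.*-comm g V)) ⟩
      Π- C.* (V C.* g)
        ≈⟨ C.*-assoc _ _ _ ⟨
      (Π- C.* V) C.* g
        ∎)
    ... | tri≈ _ ν≡1+n _ = C.trans (Π-V-regular (f 0) (begin
      (Π- C.* V) C.* f 0
        ≈⟨ C.trans (C.*-comm _ _) (C.*-congˡ (C.sym vandermonde₀)) ⟩
      f 0 C.* O″.vandermonde (x (suc n)) 0
        ≈⟨ PowerSeries.⊛-zero (seriesRing n) f (O″.vandermonde (x (suc n))) ⟨
      (PowerSeries._⊛_ (seriesRing n) f (O″.vandermonde (x (suc n)))) 0
        ≈⟨ bf (ℕ.≤-reflexive ν≡1+n) 0 ⟩
      O″.det (matrix ν (suc n)) 0
        ≈⟨ det₀ ⟩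
      O′.sum term
        ≈⟨ D.sum≈0 {f = term} (λ j → term-zero j (row₀-suc j (≡.sym (ℕ.suc-pred (exponent ν (suc n) j)
             {{ℕ.>-nonZero (ℕ.≤-trans (part-<ℓ ν (≡.subst (toℕ j ℕ.<_) (≡.sym ν≡1+n) (Fin.toℕ<n j))) (ℕ.m≤m+n _ _))}})))) ⟩
      C.0#
        ∎)) (C.sym (zg (ℕ.≤-reflexive (≡.sym ν≡1+n))))
    ... | tri> _ _ 1+n<ν = C.trans (zf 1+n<ν 0) (C.sym (zg (ℕ.<-trans (ℕ.n<1+n n) 1+n<ν)))

-- With q = n - (j + 1) one has n = j + 1 + q and r = part ν j + q. So n ≤ r means j < part ν j,
-- that is j < `diagonal ν`, and q cancels from the numbers of factors.
dualEntry-dualPower : ∀ ν n i j → CommutativeRing._≈_ (MultivariateSeries.seriesRing ℚ[a]-ring n)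
  (dualEntry ν n i j) (Multivariate.embed ℚ[a]-ring n i (DualPowers.dualPower ℚ[a]-ring a n (exponent ν n j)))
dualEntry-dualPower ν n i j = S.sym (S.trans
  (H.*-homo _ (dualFactor n r (does (n ℕ.≤? r))))
  (S.*-cong (S.trans (H.^-homo indeterminate r) (^-congˡ r (M.embed-indeterminate n i))) (factor (toℕ j ℕ.<? diagonal ν) (n ℕ.≤? r))))
  where
  R : Ring
  R = ℚ[a]-ring
  module M = Multivariate R
  module S = CommutativeRing (MultivariateSeries.seriesRing R n)
  module O = RingOps (MultivariateSeries.seriesRing R n)
  module H = Hom (M.embed-hom n i)
  open import Algebra.Properties.Semiring.Exp S.semiring using (^-congˡ)
  open DualPowers R a using (dualFactor)
  open PowerSeries R using (indeterminate; constant; geometricSeries; _⊛_)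
  open MultivariateSeries R using (geometric; scalar; x)
  open RangeProduct (MultivariateSeries.seriesRing R n) using (rangeProduct-cong)
  open Series R using (linear; module P)
  r : ℕ
  r = exponent ν n j
  λⱼ q : ℕ
  λⱼ = part ν (toℕ j)
  q = n ∸ suc (toℕ j)
  n≡ : suc (toℕ j) ℕ.+ q ≡ n
  n≡ = ℕ.m+[n∸m]≡n (Fin.toℕ<n j)
  embed-linear : ∀ c → M.embed n i (linear c) S.≈ S.1# S.- scalar n c S.* x n i
  embed-linear c = S.trans (H.+-homo P.1# (P.- (constant c ⊛ indeterminate)))
    (S.+-cong H.1-homo (S.trans (H.-‿homo (constant c ⊛ indeterminate)) (S.-‿cong
      (S.trans (H.*-homo (constant c) indeterminate) (S.*-cong (M.embed-constant n i c) (M.embed-indeterminate n i))))))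
  factor : (d : Dec (toℕ j ℕ.< diagonal ν)) (d′ : Dec (n ≤ r)) → M.embed n i (dualFactor n r (does d′)) S.≈
      (if does d then (O.product λ (k : Fin (λⱼ ∸ toℕ j)) → geometric n (a (ℤ.- ℤ.+ toℕ k)) i)
       else (O.product λ (k : Fin (toℕ j ∸ λⱼ)) → S.1# S.- scalar n (a (ℤ.+ suc (toℕ k))) S.* x n i))
  factor (yes j<d) (yes n≤r) = S.trans (H.product-homo {suc r ∸ n} λ k → geometricSeries (a (ℤ.- ℤ.+ toℕ k)))
      (rangeProduct-cong (≡.trans (≡.cong (suc r ∸_) (≡.sym n≡)) ([m+o]∸[n+o]≡m∸n λⱼ (toℕ j) q))
        {λ k → M.embed n i (geometricSeries (a (ℤ.- ℤ.+ k)))} {λ k → geometric n (a (ℤ.- ℤ.+ k)) i}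
        (λ k → M.embed-geometricSeries n i (a (ℤ.- ℤ.+ k))))
  factor (no j≮d) (no n≰r) = S.trans (H.product-homo {n ∸ suc r} λ k → linear (a (ℤ.+ suc (toℕ k))))
      (rangeProduct-cong (≡.trans (≡.cong (_∸ suc r) (≡.sym n≡)) ([m+o]∸[n+o]≡m∸n (toℕ j) λⱼ q))
        {λ k → M.embed n i (linear (a (ℤ.+ suc k)))} {λ k → S.1# S.- scalar n (a (ℤ.+ suc k)) S.* x n i}
        (λ k → embed-linear (a (ℤ.+ suc k))))
  factor (yes j<d) (no n≰r) = contradiction (≡.subst (_≤ r) n≡ (ℕ.+-monoˡ-≤ q (<diagonal⇒<part ν j<d))) n≰r
  factor (no j≮d) (yes n≤r) = contradiction (<part⇒<diagonal ν (ℕ.+-cancelʳ-≤ q (suc (toℕ j)) λⱼ (≡.subst (_≤ r) (≡.sym n≡) n≤r))) j≮d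

-- The ring Λ(x‖a)

PositiveIntegersInvertible : Ring → Set
PositiveIntegersInvertible T = ∀ k → ∃ λ u → u * (suc k ⋆ 1#) ≈ 1#
  where
  open CommutativeRing T
  open import Algebra.Properties.Semiring.Mult semiring using () renaming (_×_ to _⋆_)

module _ {A B : Ring} {f : ∣ A ∣ → ∣ B ∣} (F : Hom A B f) where
  private
    module A = CommutativeRing A
    module B = CommutativeRing B
    module F = Hom F
  open import Algebra.Properties.Semiring.Mult A.semiring using () renaming (_×_ to _×ᴬ_)
  open import Algebra.Properties.Semiring.Mult B.semiring using () renaming (_×_ to _×ᴮ_; ×-congʳ to ×ᴮ-congʳ)

  ×-homo : ∀ k x → f (k ×ᴬ x) B.≈ k ×ᴮ f x
  ×-homo zero    x = F.0-homo
  ×-homo (suc k) x = B.trans (F.+-homo x (k ×ᴬ x)) (B.+-congˡ (×-homo k x))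

  invertible-homo : PositiveIntegersInvertible A → PositiveIntegersInvertible B
  invertible-homo inverse k = let (u , e) = inverse k in f u , B.trans
    (B.*-congˡ (B.trans (×ᴮ-congʳ (suc k) (B.sym F.1-homo)) (B.sym (×-homo (suc k) A.1#))))
    (B.trans (B.sym (F.*-homo u _)) (B.trans (F.cong e) F.1-homo))

  logDerivative-homo : ∀ {s q} → Series.LogDerivative A s q → Series.LogDerivative B (f ∘ s) (f ∘ q)
  logDerivative-homo {s} {q} e k = B.trans (B.sym (×-homo k (s k)))
    (B.trans (F.cong (e k)) (Hom.*-homo (map-hom A B F) q s k))

invertible-ℚ : PositiveIntegersInvertible ℚ.+-*-commutativeRing
invertible-ℚ k = ℚ.1/_ n {{n≢0}} , ℚ.*-inverseˡ n {{n≢0}}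
  where
  open import Algebra.Properties.Semiring.Mult (CommutativeRing.semiring ℚ.+-*-commutativeRing) using () renaming (_×_ to _⋆_)
  nonNegative : ∀ k → ℚ.0ℚ ℚ.≤ k ⋆ ℚ.1ℚ
  nonNegative zero    = ℚ.≤-refl
  nonNegative (suc k) = ℚ.+-mono-≤ {ℚ.0ℚ} {ℚ.1ℚ} (ℚ.nonNegative⁻¹ ℚ.1ℚ) (nonNegative k)
  n : ℚ.ℚ
  n = suc k ⋆ ℚ.1ℚ
  n≢0 : ℚ.NonZero n
  n≢0 = ℚ.>-nonZero {n} (ℚ.+-mono-<-≤ {ℚ.0ℚ} {ℚ.1ℚ} (ℚ.positive⁻¹ ℚ.1ℚ) (nonNegative k))

private
  R : Ring
  R = ℚ[a]-ring
  module R = CommutativeRing R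
  module Q = Polynomial R
  module L = CommutativeRing Λ-ring
  module T = CommutativeRing Λ⊗Λ-ring

open Polynomials R
open MultivariateSeries R using (seriesRing; coefficient)
open Multivariate R using (module Coefficient; coefficient-scalar)
open DualPowers R a using (node; numerator; dualPower; module Generating)
open Stability R a using (IsDualSchurAt; matrix; stable₀)

constantΛ-hom : Hom R Λ-ring constantΛ
constantΛ-hom = record
  { additive = record { cong = λ e n → Q.con-cong e ; +-homo = λ c d n → Q.con-+ c d }
  ; *-homo   = λ c d n → Q.con-* c d
  ; 1-homo   = λ n → Q.refl
  }

at-hom : ∀ N → Hom Λ-ring (Q.polynomialRing (Fin N)) (λ P → at P N)
at-hom N = record
  { additive = record { cong = λ e → e N ; +-homo = λ P Q → Q.refl }
  ; *-homo   = λ P Q → Q.refl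
  ; 1-homo   = Q.refl
  }

⊗1-hom : Hom Λ-ring Λ⊗Λ-ring (_⊗ L.1#)
⊗1-hom = record
  { additive = record { cong = λ e → ⊗-cong {b = L.1#} {L.1#} e (L.refl {L.1#}) ; +-homo = λ P Q → ⊗-distʳ P Q L.1# }
  ; *-homo   = λ P Q → ⊗-cong {P L.* Q} {P L.* Q} {L.1#} {L.1# L.* L.1#} (L.refl {P L.* Q}) (L.sym {L.1# L.* L.1#} {L.1#} (L.*-identityˡ L.1#))
  ; 1-homo   = refl
  }
  where open TensorProduct R Λ-ring Λ-ring constantΛ constantΛ

1⊗-hom : Hom Λ-ring Λ⊗Λ-ring (L.1# ⊗_)
1⊗-hom = record
  { additive = record { cong = λ e → ⊗-cong {L.1#} {L.1#} (L.refl {L.1#}) e ; +-homo = λ P Q → ⊗-distˡ L.1# P Q }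
  ; *-homo   = λ P Q → ⊗-cong {L.1#} {L.1# L.* L.1#} {P L.* Q} {P L.* Q} (L.sym {L.1# L.* L.1#} {L.1#} (L.*-identityˡ L.1#)) (L.refl {P L.* Q})
  ; 1-homo   = refl
  }
  where open TensorProduct R Λ-ring Λ-ring constantΛ constantΛ

invertible-R : PositiveIntegersInvertible R
invertible-R = invertible-homo (Polynomials.con-hom ℚ.+-*-commutativeRing) invertible-ℚ

invertible-Λ : PositiveIntegersInvertible Λ-ring
invertible-Λ = invertible-homo constantΛ-hom invertible-R

half : ∃ λ h → h R.* (R.1# R.+ R.1#) R.≈ R.1#
half = let (u , e) = invertible-R 1 in u , R.trans (R.*-congˡ {u} (R.+-congˡ {R.1#} (R.sym (R.+-identityʳ R.1#)))) e

-- The entry 0 at index 0 makes this a series without constant term, as is required of a logarithmic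
-- derivative that determines its series.
powerSums : ℕ → Λ
powerSums zero    = L.0#
powerSums (suc k) = p (suc k)

module _ (N : ℕ) where
  open Generating N using (A; generatingSeries)
  private
    module A = CommutativeRing A
    module AS = Series A

  open RingOps A using (_^_)

  -- Logarithmic derivatives add up over products: the factor 1 - aᵢ t contributes the terms -aᵢᵏ tᵏ
  -- and 1 / (1 - xᵢ t) the terms xᵢᵏ tᵏ, together the double power sums.
  generatingSeries-logDerivative : AS.LogDerivative generatingSeries (λ k → at (powerSums k) N)
  generatingSeries-logDerivative k = A.trans
    (AS.logDerivative-⊛
      {Q.con ∘ numerator N} {RingOps.product (PowerSeries.powerSeriesRing A) (PowerSeries.geometricSeries A ∘ Q.var)} {q₁} {q₂}
      numerator-derivative
      (AS.logDerivative-product (PowerSeries.geometricSeries A ∘ Q.var) (AS.positivePowers ∘ Q.var)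
        (λ i → AS.geometricSeries-logDerivative (Q.var i))) k)
    (PowerSeries.⊛-cong A {g = generatingSeries} q≈powerSums (λ _ → A.refl) k)
    where
    c : Fin N → A.Carrier
    c i = Q.con (positives (toℕ i))
    q₁ q₂ : ℕ → A.Carrier
    q₁ = RingOps.sum (PowerSeries.powerSeriesRing A) (λ i → AS.P.- AS.positivePowers (c i))
    q₂ = RingOps.sum (PowerSeries.powerSeriesRing A) (AS.positivePowers ∘ Q.var)
    con-linear : ∀ d → (Q.con ∘ Series.linear R d) AS.P.≈ AS.linear (Q.con d)
    con-linear d = AS.P.trans {Q.con ∘ Series.linear R d} (C.∸-homo (Series.P.1# R) (PowerSeries._⊛_ R (PowerSeries.constant R d) (PowerSeries.indeterminate R)))
      (AS.P.+-cong {Q.con ∘ Series.P.1# R} C.1-homo (AS.P.-‿cong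
        {Q.con ∘ PowerSeries._⊛_ R (PowerSeries.constant R d) (PowerSeries.indeterminate R)}
        (AS.P.trans {Q.con ∘ PowerSeries._⊛_ R (PowerSeries.constant R d) (PowerSeries.indeterminate R)}
          (C.*-homo (PowerSeries.constant R d) (PowerSeries.indeterminate R))
          (AS.P.*-cong {Q.con ∘ PowerSeries.constant R d} (map-constant R A (Hom.additive con-hom) d) (map-indeterminate R A con-hom)))))
      where module C = Hom (map-hom R A con-hom)
    con-numerator : (Q.con ∘ numerator N) AS.P.≈ RingOps.product (PowerSeries.powerSeriesRing A) (AS.linear ∘ c)
    con-numerator = AS.P.trans {Q.con ∘ numerator N}
      (Hom.product-homo (map-hom R A con-hom) {N} (λ i → Series.linear R (positives (toℕ i))))
      (Determinant.product-cong (PowerSeries.powerSeriesRing A) {N} λ i → con-linear (positives (toℕ i)))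
    numerator-derivative : AS.LogDerivative (Q.con ∘ numerator N) q₁
    numerator-derivative = AS.P.trans {AS.θ (Q.con ∘ numerator N)} (AS.θ-cong con-numerator)
      (AS.P.trans {AS.θ (RingOps.product (PowerSeries.powerSeriesRing A) (AS.linear ∘ c))}
        (AS.logDerivative-product (AS.linear ∘ c) (λ i → AS.P.- AS.positivePowers (c i)) (AS.linear-logDerivative ∘ c))
        (AS.P.*-congˡ {q₁} (AS.P.sym {Q.con ∘ numerator N} con-numerator)))
    sum-at : ∀ {n} (f : Fin n → ℕ → A.Carrier) k → RingOps.sum (PowerSeries.powerSeriesRing A) f k ≡ RingOps.sum A (λ i → f i k)
    sum-at {zero}  f k = ≡.refl
    sum-at {suc n} f k = ≡.cong (f zero k A.+_) (sum-at (f ∘ suc) k)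
    q≈powerSums : ∀ k → q₁ k A.+ q₂ k A.≈ at (powerSums k) N
    q≈powerSums zero = A.trans (A.+-cong
      (A.trans (A.reflexive (sum-at (λ i → AS.P.- AS.positivePowers (c i)) 0)) (Determinant.sum≈0 A {N} λ i → -0#≈0#))
      (A.trans (A.reflexive (sum-at (AS.positivePowers ∘ Q.var) 0)) (Determinant.sum≈0 A {N} λ i → A.refl))) (A.+-identityʳ _)
      where open import Algebra.Properties.Ring A.ring using (-0#≈0#)
    q≈powerSums (suc k) = A.trans (A.+-cong
        (A.reflexive (sum-at (λ i → AS.P.- AS.positivePowers (c i)) (suc k))) (A.reflexive (sum-at (AS.positivePowers ∘ Q.var) (suc k))))
      (A.trans (A.+-comm _ _)
      (A.trans (A.sym (∑-distrib-+ {N} (λ i → Q.var i ^ suc k) (λ i → A.- (c i ^ suc k))))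
               (Determinant.sum-cong A {N} λ i → A.+-congˡ {Q.var i ^ suc k} (A.-‿cong (con-^ (positives (toℕ i)) (suc k))))))
      where open import Algebra.Properties.CommutativeMonoid.Sum A.+-commutativeMonoid using (∑-distrib-+)

  generatingSeries-0 : generatingSeries 0 A.≈ A.1#
  generatingSeries-0 = A.trans
    (E₀.*-homo (Q.con ∘ numerator N) (RingOps.product (PowerSeries.powerSeriesRing A) (PowerSeries.geometricSeries A ∘ Q.var)))
    (A.trans (A.*-cong
      (Hom.cong con-hom (R.trans (Hom.product-homo (Series.evaluate₀-hom R) {N} (λ i → Series.linear R (positives (toℕ i))))
        (Determinant.product≈1 R {N} {λ i → Series.linear R (positives (toℕ i)) 0} λ i → Series.linear-zero R (positives (toℕ i)))))
      (A.trans (E₀.product-homo {N} (PowerSeries.geometricSeries A ∘ Q.var)) (Determinant.product≈1 A {N} {λ i → A.1#} λ i → A.refl)))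
    (A.*-identityˡ A.1#))
    where module E₀ = Hom AS.evaluate₀-hom

-- The elements hₖ(x‖a) and the Cauchy kernel

-- The solution of k hₖ = ∑_{i ≥ 1} pᵢ hₖ₋ᵢ; the first argument bounds the depth of the recursion.
private
  complete′ : ℕ → ℕ → Λ
  complete′ _       zero    = L.1#
  -- A default value: the depth k with which `complete` starts suffices for the recursion.
  complete′ zero    (suc k) = L.1#
  complete′ (suc d) (suc k) = proj₁ (invertible-Λ k) L.*
    RingOps.sum Λ-ring {suc k} λ i → powerSums (suc (toℕ i)) L.* complete′ d (k ∸ toℕ i)

-- hₖ(x‖a), the coefficient of tᵏ in ∏ᵢ (1 - aᵢ t) / (1 - xᵢ t)
complete : ℕ → Λ
complete k = complete′ k k

-- Defining hₖ by recursion inside Λ(x‖a) lets it inherit symmetry, bounded degree and stability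
-- from the power sums. That it has the expected generating series follows because the coefficients
-- of that series obey the same recursion.
complete′-at : ∀ N d {k} → k ≤ d → at (complete′ d k) N Q.≈ Generating.generatingSeries N k
complete′-at N d       {zero}  _         = Q.sym (generatingSeries-0 N)
complete′-at N (suc d) {suc k} (s≤s k≤d) = begin
  u Q.* at (RingOps.sum Λ-ring {suc k} λ i → powerSums (suc (toℕ i)) L.* complete′ d (k ∸ toℕ i)) N
    ≈⟨ Q.*-cong Q.refl (Hom.sum-homo (at-hom N) {suc k} λ i → powerSums (suc (toℕ i)) L.* complete′ d (k ∸ toℕ i)) ⟩
  u Q.* RingOps.sum A {suc k} (λ i → at (powerSums (suc (toℕ i))) N Q.* at (complete′ d (k ∸ toℕ i)) N)
    ≈⟨ Q.*-cong Q.refl (Determinant.sum-cong A {suc k} λ i → A.*-congˡ {at (powerSums (suc (toℕ i))) N} (complete′-at N d (ℕ.≤-trans (ℕ.m∸n≤m k (toℕ i)) k≤d))) ⟩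
  u Q.* RingOps.sum A {suc k} (λ i → at (powerSums (suc (toℕ i))) N Q.* H (k ∸ toℕ i))
    ≈⟨ Q.*-cong Q.refl (Q.trans (Q.sym (A.+-identityˡ _)) (A.+-congʳ (A.sym (A.zeroˡ (H (suc k)))))) ⟩
  u Q.* (at (powerSums 0) N Q.* H (suc k) Q.+ RingOps.sum A {suc k} (λ i → at (powerSums (suc (toℕ i))) N Q.* H (k ∸ toℕ i)))
    ≈⟨ Q.*-cong Q.refl (generatingSeries-logDerivative N (suc k)) ⟨
  u Q.* (suc k ⋆ H (suc k))
    ≈⟨ Q.*-cong Q.refl (A.trans (×-assoc-* (suc k) A.1# (H (suc k))) (×-congʳ (suc k) (A.*-identityˡ (H (suc k))))) ⟨
  u Q.* ((suc k ⋆ A.1#) Q.* H (suc k))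
    ≈⟨ Q.*-assoc _ _ _ ⟨
  (u Q.* (suc k ⋆ A.1#)) Q.* H (suc k)
    ≈⟨ Q.*-cong (proj₂ (invertible-homo (at-hom N) invertible-Λ k)) Q.refl ⟩
  A.1# Q.* H (suc k)
    ≈⟨ Q.*-identity _ ⟩
  H (suc k)
    ∎
  where
  A : Ring
  A = Q.polynomialRing (Fin N)
  module A = CommutativeRing A
  open SetoidReasoning A.setoid
  open import Algebra.Properties.Semiring.Mult A.semiring using (×-assoc-*; ×-congʳ) renaming (_×_ to _⋆_)
  H : ℕ → A.Carrier
  H = Generating.generatingSeries N
  u : A.Carrier
  u = at (proj₁ (invertible-Λ k)) N

complete-at : ∀ N k → at (complete k) N Q.≈ Generating.generatingSeries N k
complete-at N k = complete′-at N k ℕ.≤-refl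

complete-logDerivative : Series.LogDerivative Λ-ring complete powerSums
complete-logDerivative k N = A.trans (×-homo (at-hom N) k (complete k))
  (A.trans (×-congʳ k (complete-at N k))
  (A.trans (generatingSeries-logDerivative N k)
  (A.trans (PowerSeries.⊛-cong A {λ k → at (powerSums k) N} (λ _ → A.refl) (λ k → A.sym (complete-at N k)) k)
           (A.sym (Hom.*-homo (map-hom Λ-ring A (at-hom N)) powerSums complete k)))))
  where
  A : Ring
  A = Q.polynomialRing (Fin N)
  module A = CommutativeRing A
  open import Algebra.Properties.Semiring.Mult A.semiring using (×-congʳ)

-- ∏ⱼ h_{αⱼ}, the coefficient of yᵅ in the Cauchy kernel ∏ᵢⱼ (1 - aᵢ yⱼ) / (1 - xᵢ yⱼ)
kernel : ∀ {n} → Vec ℕ n → Λ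
kernel {n} α = RingOps.product Λ-ring {n} λ i → complete (lookup α i)

-- The zeros go in front because `stable₀` removes the first variable.
pad : ∀ m {n} → Vec ℕ n → Vec ℕ (m ℕ.+ n)
pad zero    α = α
pad (suc m) α = 0 ∷ pad m α

kernel-pad : ∀ m {n} (α : Vec ℕ n) → kernel (pad m α) L.≈ kernel α
kernel-pad zero    α = L.refl {kernel α}
kernel-pad (suc m) α = L.trans {L.1# L.* kernel (pad m α)} {kernel (pad m α)} {kernel α}
  (L.*-identityˡ (kernel (pad m α))) (kernel-pad m α)

-- The comultiplication of hₖ(x‖a)

module Comultiplication (Δ : Λ → Λ⊗Λ) (isΔ : IsComultiplication Δ) where
  open IsComultiplication isΔ renaming (powerSums to Δ-powerSums)
  open RingMorphisms.IsRingHomomorphism isRingHomomorphism using (⟦⟧-cong; +-homo; *-homo; 1#-homo)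

  Δ-hom : Hom Λ-ring Λ⊗Λ-ring Δ
  Δ-hom = record { additive = record { cong = ⟦⟧-cong ; +-homo = +-homo } ; *-homo = *-homo ; 1-homo = 1#-homo }

  -- As series indexed by k, both sides have constant term 1 and the logarithmic derivative with
  -- coefficients pₖ ⊗ 1 + 1 ⊗ pₖ, so uniqueness applies.
  Δ-complete : ∀ k → Δ (complete k) T.≈ RingOps.sum Λ⊗Λ-ring {suc k} λ i → (complete (toℕ i) ⊗ L.1#) T.* (L.1# ⊗ complete (k ∸ toℕ i))
  Δ-complete = logDerivative-unique (invertible-homo ⊗1-hom invertible-Λ) {q} q₀
    {Δ ∘ complete} {(λ k → complete k ⊗ L.1#) ⊛ (λ k → L.1# ⊗ complete k)}
    (P.trans {θ (Δ ∘ complete)} (logDerivative-homo Δ-hom {complete} {powerSums} complete-logDerivative)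
      (P.*-congʳ {Δ ∘ complete} Δq))
    (logDerivative-⊛ {λ k → complete k ⊗ L.1#} {λ k → L.1# ⊗ complete k} {λ k → powerSums k ⊗ L.1#} {λ k → L.1# ⊗ powerSums k}
      (logDerivative-homo ⊗1-hom {complete} {powerSums} complete-logDerivative)
      (logDerivative-homo 1⊗-hom {complete} {powerSums} complete-logDerivative))
    (T.trans (Hom.1-homo Δ-hom) (T.sym (T.trans (⊛-zero (λ k → complete k ⊗ L.1#) (λ k → L.1# ⊗ complete k)) (T.*-identityˡ (L.1# ⊗ L.1#)))))
    where
    open Series Λ⊗Λ-ring
    open PowerSeries Λ⊗Λ-ring
    q : ℕ → Λ⊗Λ
    q k = powerSums k ⊗ L.1# T.+ L.1# ⊗ powerSums k
    q₀ : q 0 T.≈ T.0#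
    q₀ = T.trans (T.+-cong (Hom.0-homo ⊗1-hom) (Hom.0-homo 1⊗-hom)) (T.+-identityˡ T.0#)
    Δq : ∀ k → Δ (powerSums k) T.≈ q k
    Δq zero    = T.trans (Hom.0-homo Δ-hom) (T.sym q₀)
    Δq (suc k) = Δ-powerSums (suc k) (s≤s z≤n)

-- Functionals dual to the double Schur functions

module Functional (s : Partition → Λ) (isDoubleSchur : ∀ λ′ → IsDoubleSchur λ′ (s λ′)) where

  vandermonde : ∀ N → Q.Poly (Fin N)
  vandermonde N = RingOps.vandermonde (Q.polynomialRing (Fin N)) Q.var

  -- The coefficient of s_ν in P, read off in N ≥ ℓ(ν) variables
  dual : Partition → ℕ → Λ → R.Carrier
  dual ν N P = newtonCoefficient (node N) (exponents ν N) (vandermonde N Q.* at P N)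

  dual-additive : ∀ ν N → Additive Λ-ring R (dual ν N)
  dual-additive ν N = record
    { cong   = λ e → C.cong (Q.*-cong Q.refl (e N))
    ; +-homo = λ P Q → R.trans (C.cong (Q.distrib (vandermonde N) (at P N) (at Q N))) (C.+-homo _ _)
    }
    where module C = NewtonCoefficient (node N) (exponents ν N)

  module Dual ν N = Additive (dual-additive ν N)

  dual-linear : ∀ ν N c P → dual ν N (constantΛ c *Λ P) R.≈ c R.* dual ν N P
  dual-linear ν N c P = R.trans
    (NewtonCoefficient.cong (node N) (exponents ν N)
      (solve 3 (λ v c p → v :* (c :* p) := c :* (v :* p)) Q.refl (vandermonde N) (Q.con c) (at P N)))
    (newtonCoefficient-linear (node N) (exponents ν N) c (vandermonde N Q.* at P N))
    where open IntegerSolver (Q.polynomialRing (Fin N))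

  dual-det : ∀ ν {μ} N → ℓ μ ≤ N → dual ν N (s μ) R.≈
    RingOps.det R (KroneckerDeterminant.matrix R (exponents ν N) (exponents μ N))
  dual-det ν {μ} N μ≤N = R.trans
    (C.cong (Q.trans (Q.*-comm (vandermonde N) (at (s μ) N)) (Q.trans (proj₁ (isDoubleSchur μ N) μ≤N)
      (Determinant.det-cong A {M = λ i j → doublePower N i (exponent μ N j)} λ i j →
        Q.sym (Hom.product-homo (substitute-hom (λ _ → Q.var i)) {exponent μ N j} λ k → Q.var zero Q.+ Q.- Q.con (node N (toℕ k)))))))
    (R.trans (newtonCoefficient-det (node N) (exponents ν N) (λ j → factorialPower (node N) (exponent μ N j)))
      (Determinant.det-cong R λ i j → R.trans
        (newtonCoefficient-factorialPower (node N) (lookup (exponents ν N) i) (exponent μ N j))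
        (R.reflexive (≡.cong (kronecker (lookup (exponents ν N) i)) (≡.sym (Vec.lookup∘tabulate (exponent μ N) j))))))
    where
    module C = NewtonCoefficient (node N) (exponents ν N)
    A : Ring
    A = Q.polynomialRing (Fin N)

  dual-same : ∀ ν N → ℓ ν ≤ N → dual ν N (s ν) R.≈ R.1#
  dual-same ν N ν≤N = R.trans (dual-det ν N ν≤N) (KroneckerDeterminant.det-kronecker-same R (exponents-below ν N ℕ.≤-refl))

  dual-different : ∀ {ν μ} N → ℓ ν ≤ N → μ ≢ ν → dual ν N (s μ) R.≈ R.0#
  dual-different {ν} {μ} N ν≤N μ≢ν with ℓ μ ℕ.≤? N
  ... | yes μ≤N = R.trans (dual-det ν N μ≤N) (KroneckerDeterminant.det-kronecker-different R
    (exponents-below ν N ℕ.≤-refl) (exponents-below μ N ℕ.≤-refl) λ e → μ≢ν (exponents-injective N μ≤N ν≤N (≡.sym e)))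
  ... | no μ≰N = R.trans (NewtonCoefficient.cong (node N) (exponents ν N) (Q.trans
      (Q.*-cong Q.refl (proj₂ (isDoubleSchur μ N) (ℕ.≰⇒> μ≰N)))
      (solve 1 (λ v → v :* :0 := :0) Q.refl (vandermonde N))))
    (NewtonCoefficient.0-homo (node N) (exponents ν N))
    where open IntegerSolver (Q.polynomialRing (Fin N))

  vandermonde-antisymmetric : ∀ N (P : Λ) → Antisymmetric (vandermonde N Q.* at P N)
  vandermonde-antisymmetric zero    P   = tt
  vandermonde-antisymmetric (suc N) P k = Q.trans
    (Q.*-cong
      (Q.trans (Hom.vandermonde-homo (substitute-hom (Q.var ∘ adjacent k)) Q.var)
               (VandermondeAlternating.vandermonde-adjacent (Q.polynomialRing (Fin (suc N))) Q.var k))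
      (Λ.symmetric P (suc N) (permutation (adjacent k) (adjacent k) (adjacent-involutive k) (adjacent-involutive k))))
    (solve 2 (λ v p → (:- v) :* p := :- (v :* p)) Q.refl (vandermonde (suc N)) (at P (suc N)))
    where open IntegerSolver (Q.polynomialRing (Fin (suc N)))

  dual-injective-at : ∀ N P → (∀ ν → ℓ ν ≤ N → dual ν N P R.≈ R.0#) → at P N Q.≈ Q.con R.0#
  dual-injective-at N P z = vandermonde-var-regular N (at P N)
    (antisymmetric-injective half (node N) {vandermonde N Q.* at P N} (vandermonde-antisymmetric N P) λ B e e<B →
      let (ν , ν≤N , νe) = exponents-surjective e<B in
      ≡.subst (λ e → newtonCoefficient (node N) e (vandermonde N Q.* at P N) R.≈ R.0#) νe (z ν ν≤N))

  stable-zero : ∀ (P : Λ) m N → at P (m ℕ.+ N) Q.≈ Q.con R.0# → at P N Q.≈ Q.con R.0#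
  stable-zero P zero    N e = e
  stable-zero P (suc m) N e = stable-zero P m N
    (Q.trans (Q.sym (Λ.stable P (m ℕ.+ N))) (Q.substitute-cong (ℚ[a][x].snoc Q.var (Q.con (a (ℤ.+ suc (m ℕ.+ N))))) e))

  -- Vanishing in N + n variables descends to N variables by stability. The numbers of variables
  -- have the form m + n because this is the length of `pad m α`.
  dual-injective : ∀ n P → (∀ m ν → ℓ ν ≤ m ℕ.+ n → dual ν (m ℕ.+ n) P R.≈ R.0#) → P L.≈ L.0#
  dual-injective n P z N = stable-zero P n N
    (≡.subst (λ k → at P k Q.≈ Q.con R.0#) (ℕ.+-comm N n) (dual-injective-at (N ℕ.+ n) P (z N)))

  combination : (Partition → R.Carrier) → List Partition → Λ
  combination c μs = foldr L._+_ L.0# (List.map (λ μ → constantΛ (c μ) *Λ s μ) μs)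

  open Membership _≟ₚ_ using (_∈?_)

  dual-combination : ∀ {c n M} → (∀ {ν} → ν ∉ partitionsIn n M → c ν R.≈ R.0#) → ∀ ν N → ℓ ν ≤ N →
                     dual ν N (combination c (partitionsIn n M)) R.≈ c ν
  dual-combination {c} {n} {M} vanishes ν N ν≤N = R.trans
    (Dual.foldr-homo ν N (λ μ → constantΛ (c μ) *Λ s μ) (partitionsIn n M))
    (R.trans (foldr-cong R (λ μ → dual-linear ν N (c μ) (s μ)) (partitionsIn n M)) (evaluate (ν ∈? partitionsIn n M)))
    where
    term : Partition → R.Carrier
    term μ = c μ R.* dual ν N (s μ)
    zeroTerm : ∀ {μ} → μ ≢ ν → term μ R.≈ R.0#
    zeroTerm {μ} μ≢ν = R.trans (R.*-congˡ {c μ} (dual-different N ν≤N μ≢ν)) (R.zeroʳ (c μ))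
    evaluate : Dec (ν ∈ partitionsIn n M) → foldr R._+_ R.0# (List.map term (partitionsIn n M)) R.≈ c ν
    evaluate (yes ν∈) = R.trans (foldr-kronecker R term {ν} zeroTerm (partitionsIn-unique n M) ν∈)
      (R.trans (R.*-congˡ {c ν} (dual-same ν N ν≤N)) (R.*-identityʳ (c ν)))
    evaluate (no ν∉)  = R.trans (foldr-zero R term {partitionsIn n M} λ μ∈ → zeroTerm λ { ≡.refl → ν∉ μ∈ }) (R.sym (vanishes ν∉))

-- The Cauchy identity

module CauchyIdentity
  (s : Partition → Λ) (isDoubleSchur : ∀ λ′ → IsDoubleSchur λ′ (s λ′))
  (ŝ : Partition → Λ̂) (isDualSchur : ∀ λ′ → IsDualSchur λ′ (ŝ λ′)) where
  open Functional s isDoubleSchur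

  isDualSchurAt : ∀ ν N → IsDualSchurAt ν N (sequence (ŝ ν) N)
  isDualSchurAt ν N = (λ ν≤N → S.trans {sequence (ŝ ν) N S.* O.vandermonde (MultivariateSeries.x R N)}
      (proj₁ (isDualSchur ν N) ν≤N)
      (Determinant.det-cong (seriesRing N) (λ i j → dualEntry-dualPower ν N i j)))
    , proj₂ (isDualSchur ν N)
    where
    module S = CommutativeRing (seriesRing N)
    module O = RingOps (seriesRing N)

  dualCoefficient : ∀ {n} → Vec ℕ n → Partition → R.Carrier
  dualCoefficient {n} α ν = coefficient n α (sequence (ŝ ν) n)

  -- The number of variables y equals that of the x, since the Cauchy matrix is square. Other
  -- lengths of α are reached through padding.
  dual-kernel′ : ∀ ν N → ℓ ν ≤ N → ∀ β → dualCoefficient {N} β ν R.≈ dual ν N (kernel β)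
  dual-kernel′ ν N ν≤N β = R.trans
    (Generating.dualSchur-coefficient N (exponents ν N) (sequence (ŝ ν) N)
      (S.trans {sequence (ŝ ν) N S.* O.vandermonde (MultivariateSeries.x R N)} (proj₁ (isDualSchurAt ν N) ν≤N)
        (Determinant.det-cong (seriesRing N) {M = matrix ν N} {N = Generating.dualMatrix N (exponents ν N)} λ i j →
          S.reflexive (≡.cong (λ r → Multivariate.embed R N i (dualPower N r)) (≡.sym (Vec.lookup∘tabulate (exponent ν N) j))))) β)
    (NewtonCoefficient.cong (node N) (exponents ν N) (Q.*-cong Q.refl
      (Q.sym (Q.trans (Hom.product-homo (at-hom N) {N} λ i → complete (lookup β i))
        (Determinant.product-cong (Q.polynomialRing (Fin N)) {N} λ i → complete-at N (lookup β i))))))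
    where
    module S = CommutativeRing (seriesRing N)
    module O = RingOps (seriesRing N)

  dualCoefficient-pad : ∀ m {n} (α : Vec ℕ n) ν → dualCoefficient (pad m α) ν R.≈ dualCoefficient α ν
  dualCoefficient-pad zero        α ν = R.refl
  dualCoefficient-pad (suc m) {n} α ν = R.trans
    (Coefficient.cong (m ℕ.+ n) (pad m α) (stable₀ (m ℕ.+ n) ν {sequence (ŝ ν) (suc (m ℕ.+ n))} (isDualSchurAt ν (suc (m ℕ.+ n))) (isDualSchurAt ν (m ℕ.+ n))))
    (dualCoefficient-pad m α ν)

  bound : ∀ {n} → Vec ℕ n → ℕ
  bound {n} α = Q.expressionDegree (vandermonde n Q.* at (kernel α) n)

  support : ∀ {n} → Vec ℕ n → List Partition
  support {n} α = partitionsIn n (bound α)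

  -- ν₁ is at most the degree of the polynomial whose Newton coefficient is taken.
  dualCoefficient-vanishes : ∀ {n} (α : Vec ℕ n) {ν} → ν ∉ support α → dualCoefficient α ν R.≈ R.0#
  dualCoefficient-vanishes {n} α {ν} ν∉ with ℓ ν ℕ.≤? n | part ν 0 ℕ.≤? bound α
  ... | yes ν≤n | yes ν₁≤M = contradiction (∈-partitionsIn ν ν≤n ν₁≤M) ν∉
  ... | no ν≰n  | _        = R.trans (Coefficient.cong n α (proj₂ (isDualSchur ν n) (ℕ.≰⇒> ν≰n))) (Coefficient.0-homo n α)
  dualCoefficient-vanishes {zero}  [] {ν} ν∉ | yes ν≤0 | no ν₁≰M =
    contradiction (ℕ.≤-trans (ℕ.≤-reflexive (part-≥ℓ ν ν≤0)) z≤n) ν₁≰M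
  dualCoefficient-vanishes {suc n} α {ν} ν∉ | yes ν≤n | no ν₁≰M = R.trans (dual-kernel′ ν (suc n) ν≤n α)
    (R.trans (R.reflexive (≡.cong (λ e → newtonCoefficient (node (suc n)) e V*K) (exponents-suc ν n)))
      (newtonCoefficient-degree (node (suc n)) (part ν 0 ℕ.+ n) (exponents (tailₚ ν) n) V*K
        (ℕ.≤-trans (ℕ.≰⇒> ν₁≰M) (ℕ.m≤m+n (part ν 0) n))))
    where
    V*K : Q.Poly (Fin (suc n))
    V*K = vandermonde (suc n) Q.* at (kernel α) (suc n)

  -- The coefficient of yᵅ in ∑_ν s_ν(x‖a) ŝ_ν(y‖a) = ∏ᵢⱼ (1 - aᵢ yⱼ) / (1 - xᵢ yⱼ)
  cauchyIdentity : ∀ {n} (α : Vec ℕ n) → kernel α L.≈ combination (dualCoefficient α) (support α)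
  cauchyIdentity {n} α = x∙y⁻¹≈ε⇒x≈y K Σ (dual-injective n (K L.- Σ) λ m ν ν≤m+n → begin
    dual ν (m ℕ.+ n) (K L.- Σ)
      ≈⟨ Dual.∸-homo ν (m ℕ.+ n) K Σ ⟩
    dual ν (m ℕ.+ n) K R.- dual ν (m ℕ.+ n) Σ
      ≈⟨ R.+-cong (begin
           dual ν (m ℕ.+ n) K
             -- Padding gives as many y as the functional has x; the kernel and the coefficient of
             -- `ŝ ν` are both unaffected by it.
             ≈⟨ Dual.cong ν (m ℕ.+ n) {kernel (pad m α)} {K} (kernel-pad m α) ⟨
           dual ν (m ℕ.+ n) (kernel (pad m α))
             ≈⟨ dual-kernel′ ν (m ℕ.+ n) ν≤m+n (pad m α) ⟨
           dualCoefficient (pad m α) ν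
             ≈⟨ dualCoefficient-pad m α ν ⟩
           dualCoefficient α ν
             ∎)
           (R.-‿cong (dual-combination {dualCoefficient α} {n} {bound α} (dualCoefficient-vanishes α) ν (m ℕ.+ n) ν≤m+n)) ⟩
    dualCoefficient α ν R.- dualCoefficient α ν
      ≈⟨ R.-‿inverseʳ (dualCoefficient α ν) ⟩
    R.0#
      ∎)
    where
    open SetoidReasoning R.setoid
    open import Algebra.Properties.Group L.+-group using (x∙y⁻¹≈ε⇒x≈y)
    K Σ : Λ
    K = kernel α
    Σ = combination (dualCoefficient α) (support α)

  -- The length n of α may be smaller or larger than ℓ(ν), so the value is read off from the Cauchy
  -- identity, which holds in Λ(x‖a) independently of the number of x.
  dual-kernel : ∀ ν {n} (α : Vec ℕ n) → dual ν (ℓ ν) (kernel α) R.≈ dualCoefficient α ν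
  dual-kernel ν {n} α = R.trans
    (Dual.cong ν (ℓ ν) {kernel α} {combination (dualCoefficient α) (support α)} (cauchyIdentity α))
    (dual-combination {dualCoefficient α} {n} {bound α} (dualCoefficient-vanishes α) ν (ℓ ν) ℕ.≤-refl)

-- Functionals on the tensor product

module TensorFunctional
  (s : Partition → Λ) (isDoubleSchur : ∀ λ′ → IsDoubleSchur λ′ (s λ′)) (λ′ μ : Partition) where
  open Functional s isDoubleSchur
  open TensorProduct R Λ-ring Λ-ring constantΛ constantΛ hiding (_*_; _⊗_; scale)

  φ ψ : Λ → R.Carrier
  φ = dual λ′ (ℓ λ′)
  ψ = dual μ (ℓ μ)

  -- The coefficient of s_λ ⊗ s_μ
  dual² : Λ⊗Λ → R.Carrier
  dual² t = foldr R._+_ R.0# (List.map (λ (P , Q) → φ P R.* ψ Q) t)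

  dual²-++ : ∀ t u → dual² (t ++ u) R.≈ dual² t R.+ dual² u
  dual²-++ []            u = R.sym (R.+-identityˡ (dual² u))
  dual²-++ ((P , Q) ∷ t) u = R.trans (R.+-congˡ {φ P R.* ψ Q} (dual²-++ t u)) (R.sym (R.+-assoc (φ P R.* ψ Q) (dual² t) (dual² u)))

  private
    module φ = Dual λ′ (ℓ λ′)
    module ψ = Dual μ (ℓ μ)
    open IntegerSolver R using (solve; _:=_; _:*_; _:+_; :0)

  dual²-cong : ∀ {t u} → t ≈ u → dual² t R.≈ dual² u
  dual²-cong refl           = R.refl
  dual²-cong (sym e)        = R.sym (dual²-cong e)
  dual²-cong (trans e e′)   = R.trans (dual²-cong e) (dual²-cong e′)
  dual²-cong (++-cong {t} {t′} {u} {u′} e e′) =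
    R.trans (dual²-++ t u) (R.trans (R.+-cong (dual²-cong e) (dual²-cong e′)) (R.sym (dual²-++ t′ u′)))
  dual²-cong (++-comm t u)  = R.trans (dual²-++ t u) (R.trans (R.+-comm (dual² t) (dual² u)) (R.sym (dual²-++ u t)))
  dual²-cong (⊗-cong {a} {a′} {b} {b′} e e′) = R.+-congʳ {R.0#} (R.*-cong (φ.cong {a} {a′} e) (ψ.cong {b} {b′} e′))
  dual²-cong (⊗-zero b)     = R.trans (R.+-identityʳ (φ L.0# R.* ψ b)) (R.trans (R.*-congʳ {ψ b} φ.0-homo) (R.zeroˡ (ψ b)))
  dual²-cong (⊗-distʳ a a′ b) = R.trans (R.+-congʳ {R.0#} (R.*-congʳ {ψ b} (φ.+-homo a a′)))
    (solve 3 (λ a a′ b → (a :+ a′) :* b :+ :0 := a :* b :+ (a′ :* b :+ :0)) R.refl (φ a) (φ a′) (ψ b))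
  dual²-cong (⊗-distˡ a b b′) = R.trans (R.+-congʳ {R.0#} (R.*-congˡ {φ a} (ψ.+-homo b b′)))
    (solve 3 (λ a b b′ → a :* (b :+ b′) :+ :0 := a :* b :+ (a :* b′ :+ :0)) R.refl (φ a) (ψ b) (ψ b′))
  dual²-cong (balanced r a b) = R.trans (R.+-congʳ {R.0#} (R.*-congʳ {ψ b} (dual-linear λ′ (ℓ λ′) r a)))
    (R.trans (solve 3 (λ r a b → (r :* a) :* b :+ :0 := a :* (r :* b) :+ :0) R.refl r (φ a) (ψ b))
      (R.+-congʳ {R.0#} (R.*-congˡ {φ a} (R.sym (dual-linear μ (ℓ μ) r b)))))

  dual²-additive : Additive Λ⊗Λ-ring R dual²
  dual²-additive = record { cong = dual²-cong ; +-homo = dual²-++ }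

  module Dual² = Additive dual²-additive

  dual²-linear : ∀ c t → dual² (c • t) R.≈ c R.* dual² t
  dual²-linear c []            = R.sym (R.zeroʳ c)
  dual²-linear c ((P , Q) ∷ t) = R.trans
    (R.+-cong (R.*-cong (dual-linear λ′ (ℓ λ′) c P) (ψ.cong {L.1# L.* Q} {Q} (L.*-identityˡ Q))) (dual²-linear c t))
    (solve 4 (λ c p q t → (c :* p) :* q :+ c :* t := c :* (p :* q :+ t)) R.refl c (φ P) (ψ Q) (dual² t))

  -- On the expansion of Δ(s_ν), the functional annihilates every term except the multiple of s_λ ⊗
  -- s_μ, where it returns the coefficient.
  dual²-coefficient : ∀ (Δ : Λ → Λ⊗Λ) ĉ → IsDualLittlewoodRichardson s Δ ĉ → ∀ ν → ĉ λ′ μ ν R.≈ dual² (Δ (s ν))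
  dual²-coefficient Δ ĉ lr ν = R.trans (R.sym (evaluate ((λ′ , μ) ∈? support)))
    (R.trans (R.sym (Dual².foldr-homo term support)) (dual²-cong total))
    where
    open HasSum (lr ν)
    open Membership (≡-dec _≟ₚ_ _≟ₚ_) using (_∈?_)
    term : Partition × Partition → Λ⊗Λ
    term (κ , ρ) = ĉ κ ρ ν • s κ ⊗ s ρ
    value-term : ∀ κ ρ → dual² (term (κ , ρ)) R.≈ ĉ κ ρ ν R.* (φ (s κ) R.* ψ (s ρ))
    value-term κ ρ = R.trans (dual²-linear (ĉ κ ρ ν) (s κ ⊗ s ρ)) (R.*-congˡ {ĉ κ ρ ν} (R.+-identityʳ (φ (s κ) R.* ψ (s ρ))))
    zeroTerm : ∀ {i} → i ≢ (λ′ , μ) → dual² (term i) R.≈ R.0#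
    zeroTerm {κ , ρ} i≢ with κ ≟ₚ λ′ | ρ ≟ₚ μ
    ... | yes ≡.refl | yes ≡.refl = contradiction ≡.refl i≢
    ... | no κ≢λ | _      = R.trans (value-term κ ρ) (R.trans
      (R.*-congˡ {ĉ κ ρ ν} (R.trans (R.*-congʳ {ψ (s ρ)} (dual-different (ℓ λ′) ℕ.≤-refl κ≢λ)) (R.zeroˡ (ψ (s ρ))))) (R.zeroʳ (ĉ κ ρ ν)))
    ... | yes _  | no ρ≢μ = R.trans (value-term κ ρ) (R.trans
      (R.*-congˡ {ĉ κ ρ ν} (R.trans (R.*-congˡ {φ (s κ)} (dual-different (ℓ μ) ℕ.≤-refl ρ≢μ)) (R.zeroʳ (φ (s κ))))) (R.zeroʳ (ĉ κ ρ ν)))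
    value-self : dual² (term (λ′ , μ)) R.≈ ĉ λ′ μ ν
    value-self = R.trans (value-term λ′ μ) (R.trans
      (R.*-congˡ {ĉ λ′ μ ν} (R.trans (R.*-cong (dual-same λ′ (ℓ λ′) ℕ.≤-refl) (dual-same μ (ℓ μ) ℕ.≤-refl)) (R.*-identityˡ R.1#)))
      (R.*-identityʳ (ĉ λ′ μ ν)))
    evaluate : Dec ((λ′ , μ) ∈ support) → foldr R._+_ R.0# (List.map (dual² ∘ term) support) R.≈ ĉ λ′ μ ν
    evaluate (yes i∈) = R.trans (foldr-kronecker R (dual² ∘ term) zeroTerm unique i∈) value-self
    -- Outside the support it is the tensor, not yet its coefficient, that is known to vanish;
    -- applying the functional to it gives ĉ = 0.
    evaluate (no i∉)  = R.trans (foldr-zero R (dual² ∘ term) {support} λ j∈ → zeroTerm λ { ≡.refl → i∉ j∈ })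
      (R.trans (R.sym (dual²-cong (vanishes i∉))) value-self)

  module _ (Δ : Λ → Λ⊗Λ) (isΔ : IsComultiplication Δ) where
    open Comultiplication Δ isΔ

    -- The coefficients of f and g are values of φ and ψ on those of Cauchy
    -- kernels; so are the coefficients of f g, as Δ K = (K ⊗ 1) (1 ⊗ K).
    dual²-product : ∀ {n} (f g : ∣ seriesRing n ∣) P Q →
      (∀ β → coefficient n β f R.≈ φ (P L.* kernel β)) →
      (∀ β → coefficient n β g R.≈ ψ (Q L.* kernel β)) →
      ∀ α → coefficient n α (CommutativeRing._*_ (seriesRing n) f g) R.≈ dual² ((P ⊗ Q) T.* Δ (kernel α))
    dual²-product {zero} f g P Q F G [] = R.trans (R.*-cong (F []) (G []))
      (R.trans (R.sym (R.+-identityʳ (φ (P L.* L.1#) R.* ψ (Q L.* L.1#))))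
        (dual²-cong (T.*-congˡ {P ⊗ Q} (T.sym (Hom.1-homo Δ-hom)))))
    dual²-product {suc n} f g P Q F G (k ∷ α) = begin
      coefficient n α (RingOps.sum (seriesRing n) {suc k} λ i → f (toℕ i) S.* g (k ∸ toℕ i))
        ≈⟨ Coefficient.sum-homo n α {suc k} (λ i → f (toℕ i) S.* g (k ∸ toℕ i)) ⟩
      RingOps.sum R {suc k} (λ i → coefficient n α (f (toℕ i) S.* g (k ∸ toℕ i)))
        -- Peeling off the first variable splits the kernel of i ∷ β as hᵢ times the kernel of β.
        -- The factors hᵢ and h_{k-i} are absorbed into P and Q, which are carried along for this
        -- purpose.
        ≈⟨ Determinant.sum-cong R {suc k} (λ i → dual²-product (f (toℕ i)) (g (k ∸ toℕ i))
             (P L.* complete (toℕ i)) (Q L.* complete (k ∸ toℕ i))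
             (λ β → R.trans (F (toℕ i ∷ β)) (φ.cong {P L.* (complete (toℕ i) L.* kernel β)} {(P L.* complete (toℕ i)) L.* kernel β}
               (L.sym {(P L.* complete (toℕ i)) L.* kernel β} {P L.* (complete (toℕ i) L.* kernel β)} (L.*-assoc P (complete (toℕ i)) (kernel β)))))
             (λ β → R.trans (G (k ∸ toℕ i ∷ β)) (ψ.cong {Q L.* (complete (k ∸ toℕ i) L.* kernel β)} {(Q L.* complete (k ∸ toℕ i)) L.* kernel β}
               (L.sym {(Q L.* complete (k ∸ toℕ i)) L.* kernel β} {Q L.* (complete (k ∸ toℕ i) L.* kernel β)} (L.*-assoc Q (complete (k ∸ toℕ i)) (kernel β)))))
             α) ⟩
      RingOps.sum R {suc k} (λ i → dual² (term i))
        ≈⟨ Dual².sum-homo {suc k} term ⟨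
      dual² (RingOps.sum Λ⊗Λ-ring {suc k} term)
        ≈⟨ dual²-cong (T.sym expand) ⟩
      dual² ((P ⊗ Q) T.* Δ (complete k L.* K))
        ∎
      where
      open SetoidReasoning R.setoid
      open import Algebra.Properties.Semiring.Sum T.semiring using (*-distribˡ-sum; *-distribʳ-sum)
      module S = CommutativeRing (seriesRing n)
      K : Λ
      K = kernel α
      h⊗h : Fin (suc k) → Λ⊗Λ
      h⊗h i = (complete (toℕ i) ⊗ L.1#) T.* (L.1# ⊗ complete (k ∸ toℕ i))
      term : Fin (suc k) → Λ⊗Λ
      term i = ((P L.* complete (toℕ i)) ⊗ (Q L.* complete (k ∸ toℕ i))) T.* Δ K
      absorb : ∀ i → (P ⊗ Q) T.* h⊗h i T.≈ (P L.* complete (toℕ i)) ⊗ (Q L.* complete (k ∸ toℕ i))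
      absorb i = ⊗-cong
        {P L.* (complete (toℕ i) L.* L.1#)} {P L.* complete (toℕ i)} {Q L.* (L.1# L.* complete (k ∸ toℕ i))} {Q L.* complete (k ∸ toℕ i)}
        (L.*-congˡ {P} {complete (toℕ i) L.* L.1#} {complete (toℕ i)} (L.*-identityʳ (complete (toℕ i))))
        (L.*-congˡ {Q} {L.1# L.* complete (k ∸ toℕ i)} {complete (k ∸ toℕ i)} (L.*-identityˡ (complete (k ∸ toℕ i))))
      expand : (P ⊗ Q) T.* Δ (complete k L.* K) T.≈ RingOps.sum Λ⊗Λ-ring {suc k} term
      expand =
        T.trans (T.*-congˡ {P ⊗ Q} (T.trans (Hom.*-homo Δ-hom (complete k) K) (T.*-congʳ {Δ K} (Δ-complete k))))
        (T.trans (T.sym (T.*-assoc (P ⊗ Q) (RingOps.sum Λ⊗Λ-ring {suc k} h⊗h) (Δ K)))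
        (T.trans (T.*-congʳ {Δ K} (*-distribˡ-sum {suc k} (P ⊗ Q) h⊗h))
        (T.trans (*-distribʳ-sum {suc k} (Δ K) (λ i → (P ⊗ Q) T.* h⊗h i))
                 (Determinant.sum-cong Λ⊗Λ-ring {suc k} λ i → T.*-congʳ {Δ K} (absorb i)))))

theorem4p3 : (s : Partition → Λ) → (∀ λ′ → IsDoubleSchur λ′ (s λ′)) →
    (Δ : Λ → Λ⊗Λ) → IsComultiplication Δ →
    (ĉ : Partition → Partition → Partition → ℚ[a]) → IsDualLittlewoodRichardson s Δ ĉ →
    (ŝ : Partition → Λ̂) → (∀ λ′ → IsDualSchur λ′ (ŝ λ′)) →
    let open CommutativeRing sequenceRing using (_*_) in
    ∀ λ′ μ → sequence (ŝ λ′) * sequence (ŝ μ) ≈∑ λ ν → ĉ λ′ μ ν •̂ sequence (ŝ ν)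
theorem4p3 s isDoubleSchur Δ isΔ ĉ lr ŝ isDualSchur λ′ μ n α = record
  -- The list depends on α alone: for every other ν the coefficient of yᵅ in ŝ_ν is 0, whatever the
  -- value of ĉ.
  { support  = support α
  ; unique   = partitionsIn-unique n (bound α)
  ; vanishes = λ {ν} ν∉ → R.trans (coefficient-term ν)
      (R.trans (R.*-congˡ {ĉ λ′ μ ν} (dualCoefficient-vanishes α ν∉)) (R.zeroʳ (ĉ λ′ μ ν)))
  ; total    = begin
      foldr R._+_ R.0# (List.map (λ ν → coefficient n α ((ĉ λ′ μ ν •̂ sequence (ŝ ν)) n)) (support α))
        ≈⟨ foldr-cong R (λ ν → R.trans (coefficient-term ν) (R.trans
             (R.*-congʳ {dualCoefficient α ν} (dual²-coefficient Δ ĉ lr ν)) (R.*-comm (dual² (Δ (s ν))) (dualCoefficient α ν)))) (support α) ⟩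
      foldr R._+_ R.0# (List.map (λ ν → dualCoefficient α ν R.* dual² (Δ (s ν))) (support α))
        -- The coefficients of ŝ_ν lie in ℚ[a] and can be taken inside Δ by linearity; the sum
        -- becomes Δ of the expansion in the Cauchy identity.
        ≈⟨ foldr-cong R (λ ν → R.trans (dual²-cong (linear (dualCoefficient α ν) (s ν))) (dual²-linear (dualCoefficient α ν) (Δ (s ν)))) (support α) ⟨
      foldr R._+_ R.0# (List.map (λ ν → dual² (Δ (constantΛ (dualCoefficient α ν) *Λ s ν))) (support α))
        ≈⟨ Additive.foldr-homo dual²∘Δ (λ ν → constantΛ (dualCoefficient α ν) *Λ s ν) (support α) ⟨
      dual² (Δ (combination (dualCoefficient α) (support α)))
        ≈⟨ Additive.cong dual²∘Δ {kernel α} {combination (dualCoefficient α) (support α)} (cauchyIdentity α) ⟨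
      dual² (Δ (kernel α))
        -- P = Q = 1 is the starting point for the induction over the variables in `dual²-product`.
        ≈⟨ dual²-cong (T.*-identityˡ (Δ (kernel α))) ⟨
      dual² ((L.1# ⊗ L.1#) T.* Δ (kernel α))
        ≈⟨ dual²-product Δ isΔ (sequence (ŝ λ′) n) (sequence (ŝ μ) n) L.1# L.1# (coefficient-dual λ′) (coefficient-dual μ) α ⟨
      coefficient n α (sequence (ŝ λ′) n S.* sequence (ŝ μ) n)
        ∎
  }
  where
  open SetoidReasoning R.setoid
  open Functional s isDoubleSchur
  open CauchyIdentity s isDoubleSchur ŝ isDualSchur
  open TensorFunctional s isDoubleSchur λ′ μ
  open IsComultiplication isΔ using (linear)
  module S = CommutativeRing (seriesRing n)
  module Δ = Hom (Comultiplication.Δ-hom Δ isΔ)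
  dual²∘Δ : Additive Λ-ring R (dual² ∘ Δ)
  dual²∘Δ = record
    { cong   = λ {P} {Q} e → dual²-cong (Δ.cong {P} {Q} e)
    ; +-homo = λ P Q → R.trans (dual²-cong (Δ.+-homo P Q)) (dual²-++ (Δ P) (Δ Q))
    }
  coefficient-term : ∀ ν → coefficient n α ((ĉ λ′ μ ν •̂ sequence (ŝ ν)) n) R.≈ ĉ λ′ μ ν R.* dualCoefficient α ν
  coefficient-term ν = coefficient-scalar n α (ĉ λ′ μ ν) (sequence (ŝ ν) n)
  coefficient-dual : ∀ ν β → coefficient n β (sequence (ŝ ν) n) R.≈ dual ν (ℓ ν) (L.1# L.* kernel β)
  coefficient-dual ν β = R.trans (R.sym (dual-kernel ν β))
    (Dual.cong ν (ℓ ν) {kernel β} {L.1# L.* kernel β}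
      (L.sym {L.1# L.* kernel β} {kernel β} (L.*-identityˡ (kernel β))))
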